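{- Let $m\ge1$. Let $\overline Z$ be the unique formal power series in $t$ with constant term $0$ such that $t=\overline Z(1-\overline Z)^{m^2+2m}$, and $\overline U$ the unique formal power series in $t$ with coefficients in $\mathbb{Q}[x]$ such that \[ x=\frac{\overline U}{(1-\overline Z)^{m+2}}\left(1-\overline Z\,\frac{\overline U^{m+1}-1}{\overline U-1}\right). \] Then the generating function $\overline I$ of ordinary $m$-Tamari intervals of positive size, counted by size (variable $t$) and final descent length of the maximal element (variable $x$), satisfies \[ x^2\overline I=\frac{\overline Z\,\overline U^{m+2}}{(1-\overline Z)^{2m+4}}\left(1-\overline Z\sum_{e=0}^m\overline U^e(m+1-e)\right). \] In particular $1+\overline I(1)=\frac{1-(m+1)\overline Z}{(1-\overline Z)^{m+2}}$, so that the number of ordinary $m$-Tamari intervals in $\mathcal D_{m,n}$ is $\frac{m+1}{n(mn+1)}\binom{(m+1)^2n+m}{n-1}$ for $n\ge1$. Moreover \[ \overline J_m=\frac{x-1}{x}\cdot\frac{\overline Z\,\overline U^{m+1}}{\overline U-1+\overline Z}, \] and for $0\le i\le m+1$, \[ \frac{\overline J_i}{x^{m-i-1}}=\overline Z(1-\overline Z)^{(m+2)(m-i-1)}H_i(\overline Z;\overline U), \] where $H_{m+1}(z;u)=u^{m+2}\left(1-z\sum_{e=0}^m u^e(m+1-e)\right)$ and, for $0\le i\le m$, \[ H_i(z;u)=u^{i+1}\left(1+\sum_{k=1}^{i+1}(-z)^k\binom{i+1}{k}\sum_{e=0}^{m-i}\binom{e+k-1}{e}u^e+\sum_{k=1}^{i}(-z)^k\binom{m+k-i-1}{k-1}\sum_{e=0}^{i-k}\binom{e+k}{e}u^{m+1-k-e}\right).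 \]
   Context: An $m$-Dyck path of size $n$ is a word with $n$ letters $1$ (up steps $(+m,+m)$) and $mn$ letters $0$ (down steps $(+1,-1)$) whose lattice path from $(0,0)$ never goes strictly below the horizontal axis; $\mathcal D_{m,n}$ is the set of them, $\varnothing$ the empty path. The final descent length $d(w)$ is the length $k$ of the longest suffix $0^k$ of $w$. A valley is an occurrence of $01$; a Dyck factor is a factor which is itself an $m$-Dyck path. The ordinary $m$-Tamari order is generated by the cover relations $w\triangleleft w'$, one per valley of $w$, where $w'$ is obtained by swapping the down step of the valley with the shortest non-empty Dyck factor immediately following it. An interval $[v,w]$ is a pair of paths of the same size $n$ with $v\le w$, weighted by $t^nx^{d(w)}$ in generating functions; $F(1)$ denotes specialisation at $x=1$. $D(w_1,\dots,w_{m+1})$ denotes $1w_10\,w_20\cdots w_m0\,w_{m+1}$. For $0\le i\le m+1$, $\overline J_i$ is the generating function of ordinary $m$-Tamari intervals $[v,w]$ of positive size with $v=D(v_1,\dots,v_i,\varnothing,\dots,\varnothing)$ for some (possibly empty) $m$-Dyck paths $v_j$; $\overline J_{m+1}=\overline I$. -}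

module Defs where

open import Data.Bool using (Bool; true; false; T; if_then_else_)
open import Data.Nat as ℕ using (ℕ; zero; suc; _≤_; _∸_; _≤ᵇ_)
import Data.Nat.Combinatorics as Comb
open import Data.Integer using (+_)
open import Data.Rational as Q using (ℚ; 0ℚ; 1ℚ)
open import Data.List using (List; []; _∷_; _++_; reverse; length; replicate; map; concat)
open import Data.List.Relation.Unary.All using (All)
open import Data.Product using (Σ; _×_)
open import Data.Irrelevant using (Irrelevant)
open import Relation.Binary.PropositionalEquality using (_≡_; _≢_)
open import Relation.Nullary using (¬_)
open import Relation.Binary.Construct.Closure.ReflexiveTransitive using (Star)

-- m-Dyck paths.  A word is a list of letters; true = letter 1 (up step
-- (+m,+m)), false = letter 0 (down step (+1,-1)).

Word : Set
Word = List Bool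

ups : Word → ℕ
ups []          = 0
ups (true ∷ w)  = suc (ups w)
ups (false ∷ w) = ups w

downs : Word → ℕ
downs []          = 0
downs (true ∷ w)  = downs w
downs (false ∷ w) = suc (downs w)

nonneg : ℕ → ℕ → Word → Bool
nonneg m h []                = true
nonneg m h (true ∷ w)        = nonneg m (h ℕ.+ m) w
nonneg m zero (false ∷ w)    = false
nonneg m (suc h) (false ∷ w) = nonneg m h w

IsDyck : ℕ → ℕ → Word → Set
IsDyck m n w = (ups w ≡ n) × (downs w ≡ m ℕ.* n) × T (nonneg m 0 w)

IsDyckAny : ℕ → Word → Set
IsDyckAny m w = Σ ℕ (λ n → IsDyck m n w)

leadingZeros : Word → ℕ
leadingZeros (false ∷ w) = suc (leadingZeros w)
leadingZeros _           = 0

finalDescent : Word → ℕ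
finalDescent w = leadingZeros (reverse w)

-- ordinary m-Tamari order.  Cover relation: for the valley formed by the
-- displayed 0 followed by the first letter of u, u is the shortest
-- non-empty Dyck factor immediately following that 0; the 0 and u swap.

data Cover (m : ℕ) : Word → Word → Set where
  swap : (p u s : Word) →
         IsDyckAny m u →
         u ≢ [] →
         (∀ a b → u ≡ a ++ b → a ≢ [] → b ≢ [] → ¬ IsDyckAny m a) →
         Cover m (p ++ false ∷ u ++ s) (p ++ u ++ false ∷ s)

TamariLe : ℕ → Word → Word → Set
TamariLe m = Star (Cover m)

-- intervals [v,w] of positive size n (proof fields irrelevant, so two
-- intervals are equal iff their lower and upper paths are equal)
record Interval (m n : ℕ) : Set where
  constructor interval
  field
    lower      : Word
    upper      : Word
    .positive  : 1 ≤ n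
    .lowerDyck : IsDyck m n lower
    .upperDyck : IsDyck m n upper
    .le        : TamariLe m lower upper
open Interval public

Dcons : List Word → Word
Dcons []       = []
Dcons (w ∷ ws) = true ∷ w ++ concat (map (false ∷_) ws)

JShape : ℕ → ℕ → Word → Set
JShape m i v =
  Σ (List Word) λ vs →
    (length vs ≡ i) × All (IsDyckAny m) vs ×
    (v ≡ Dcons (vs ++ replicate (suc m ∸ i) []))

IntervalsD : ℕ → ℕ → ℕ → Set
IntervalsD m n k = Σ (Interval m n) λ I → Irrelevant (finalDescent (upper I) ≡ k)

IntervalsJ : ℕ → ℕ → ℕ → ℕ → Set
IntervalsJ m i n k =
  Σ (Interval m n) λ I →
    Irrelevant (JShape m i (lower I) × (finalDescent (upper I) ≡ k))

-- formal power series in t and x with rational coefficients: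
-- f n k is the coefficient of t^n x^k.

Series : Set
Series = ℕ → ℕ → ℚ

fromℕ : ℕ → ℚ
fromℕ n = + n Q./ 1

_≈S_ : Series → Series → Set
f ≈S g = ∀ n k → f n k ≡ g n k

infix 4 _≈S_
infixl 6 _+S_ _-S_
infixl 7 _*S_ _·S_
infixr 8 _^S_

sumBelow : ℕ → (ℕ → ℚ) → ℚ
sumBelow zero    f = 0ℚ
sumBelow (suc n) f = sumBelow n f Q.+ f n

sumTo : ℕ → (ℕ → ℚ) → ℚ
sumTo n f = sumBelow (suc n) f

constS : ℚ → Series
constS c zero zero = c
constS c _    _    = 0ℚ

0S 1S tS xS : Series
0S _ _ = 0ℚ
1S = constS 1ℚ
tS (suc zero) zero = 1ℚ
tS _ _ = 0ℚ
xS zero (suc zero) = 1ℚ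
xS _ _ = 0ℚ

_+S_ _-S_ _*S_ : Series → Series → Series
(f +S g) n k = f n k Q.+ g n k
(f -S g) n k = f n k Q.- g n k
(f *S g) n k = sumTo n λ a → sumTo k λ b → f a b Q.* g (n ∸ a) (k ∸ b)

-S_ : Series → Series
(-S f) n k = Q.- f n k

_·S_ : ℚ → Series → Series
(c ·S f) n k = c Q.* f n k

_^S_ : Series → ℕ → Series
f ^S zero  = 1S
f ^S suc e = f *S (f ^S e)

sumBelowS : ℕ → (ℕ → Series) → Series
sumBelowS zero    f = 0S
sumBelowS (suc n) f = sumBelowS n f +S f n

-- Σ_{j=a}^{b} f j (empty if b < a)
sumRangeS : ℕ → ℕ → (ℕ → Series) → Series
sumRangeS a b f = sumBelowS (suc b ∸ a) (λ j → f (a ℕ.+ j))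

binom : ℕ → ℕ → ℚ
binom n k = fromℕ (n Comb.C k)

Hlast : ℕ → Series → Series → Series
Hlast m z u =
  (u ^S (suc (suc m))) *S
    (1S -S z *S sumRangeS 0 m (λ e → fromℕ (suc m ∸ e) ·S (u ^S e)))

Hsmall : ℕ → ℕ → Series → Series → Series
Hsmall m i z u =
  (u ^S (suc i)) *S
    ( 1S
      +S sumRangeS 1 (suc i) (λ k →
           ((-S z) ^S k) *S (binom (suc i) k ·S
             sumRangeS 0 (m ∸ i) (λ e → binom (e ℕ.+ k ∸ 1) e ·S (u ^S e))))
      +S sumRangeS 1 i (λ k →
           ((-S z) ^S k) *S (binom (m ℕ.+ k ∸ i ∸ 1) (k ∸ 1) ·S
             sumRangeS 0 (i ∸ k) (λ e →
               binom (e ℕ.+ k) e ·S (u ^S (suc m ∸ k ∸ e))))) )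

H : ℕ → ℕ → Series → Series → Series
H m i z u = if i ≤ᵇ m then Hsmall m i z u else Hlast m z u

ofCounts : (ℕ → ℕ → ℕ) → Series
ofCounts c n k = fromℕ (c n k)

ofCountsT : (ℕ → ℕ) → Series
ofCountsT c n zero    = fromℕ (c n)
ofCountsT c n (suc k) = 0ℚ

{-# OPTIONS --safe #-}

-- For i ≥ 1 the lower paths counted by J̄_i are the words 1 y 0^{m+1-i} with y a path from height i-1 to 0, and every
-- larger path has the same form. Either y is empty or ends with an unmatched 0, which gives J̄_{i-1}, or y ends with a prime
-- factor P = 1 a 0. In the latter case the upper path is a path above what remains of the lower one, with a prime q ≥ P
-- inserted anywhere in its final descent that leaves at least m+1-i letters after q. Hence
--   J̄_0 = t x^m,   J̄_i = J̄_{i-1} + J̄_m (x J̄_i - x^{m+1-i} J̄_i(1)) / (x - 1),   1 ≤ i ≤ m+1,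
-- which determines all series order by order in t. With H_i = u^{i+1} G_i, the claimed series solve this system because of
--   (u-1) G_i(u) = (u-1+z) G_{i-1}(u) - u^{m+1-i} z G_{i-1}(1),
--   (u-1+z) G_m(u) = u - z (u + ... + u^{m+1}) - (1-z)^{m+2},
-- two identities that are checked on the coefficients of the powers of -z; evaluation at x = 1 is congruence modulo x - 1
-- among series with polynomial coefficients, and sends U to 1 - Z. Finally B = 1/(1-Z) satisfies B = 1 + t B^{(m+1)²}, so
-- its powers have Fuss–Catalan coefficients, and 1 + Ī(1) = (m+1) B^{m+1} - m B^{m+2}.

module Submission where

open import Defs
open import Data.Nat using (ℕ; zero; suc; _≤_; _<_; _+_; _*_; _∸_; _^_)
open import Data.Nat.Combinatorics using (_C_)
open import Data.Rational using (0ℚ)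
open import Data.Fin using (Fin)
open import Data.Product using (Σ; _×_)
open import Function.Bundles using (_↔_)
open import Relation.Binary.PropositionalEquality using (_≡_)

open import Algebra.Bundles using (CommutativeRing)
import Algebra.Solver.Ring as RingSolver
open import Algebra.Solver.Ring.AlmostCommutativeRing using (fromCommutativeRing; _-Raw-AlmostCommutative⟶_)
open import Data.Bool using (Bool; true; false; T; if_then_else_)
open import Data.Bool.Properties using (T-irrelevant)
open import Data.Empty using (⊥; ⊥-elim)
import Data.Fin.Properties as Finₚ
import Data.Integer as ℤ
import Data.Integer.Properties as ℤₚ
open import Data.Irrelevant as Irr using (Irrelevant; [_])
open import Data.List using (List; []; _∷_; _++_; reverse; length; replicate; map; concat; take)
import Data.List.Properties as Listₚ
open import Data.List.Relation.Unary.All using (All; []; _∷_)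
open import Data.Maybe using (Maybe; just; nothing)
open import Data.Nat as ℕ using (z≤n; s≤s)
open import Data.Nat.Combinatorics using (nCk+nC[k+1]≡[n+1]C[k+1]; nCk≡nC[n∸k]; k>n⇒nCk≡0; nCn≡1; nC1≡n)
open import Data.Nat.Induction using (<-rec)
import Data.Nat.Properties as ℕₚ
import Data.Nat.Solver as ℕSolver
open import Data.Product using (_,_; proj₁; proj₂; ∃)
open import Data.Product.Function.NonDependent.Propositional using (_×-↔_)
open import Data.Rational as ℚ using (ℚ; 1ℚ)
import Data.Rational.Properties as ℚₚ
import Data.Rational.Unnormalised as ℚᵘ
import Data.Rational.Unnormalised.Properties as ℚᵘₚ
open import Data.Sum using (_⊎_; inj₁; inj₂)
open import Data.Sum.Function.Propositional using (_⊎-↔_)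
open import Data.Unit using (tt)
open import Function.Bundles using (Inverse; mk↔ₛ′)
open import Function.Properties.Inverse using (↔-trans)
open import Level using (0ℓ)
open import Relation.Binary.Construct.Closure.ReflexiveTransitive using (Star; ε; _◅_; _◅◅_; gmap)
open import Relation.Binary.Definitions using (Tri; tri<; tri≈; tri>)
open import Relation.Binary.PropositionalEquality as ≡ using (_≢_; refl; sym; trans; cong; cong₂; subst; subst₂)
open import Relation.Nullary using (¬_; yes; no; recompute)

-- Among all power series x - 1 is a unit, so congruence modulo x - 1 would be vacuous; it has
-- content only because both sides and the quotient are required to have finite degree in x at every
-- order in t. A value at x = 1 is therefore not a substitution but a second unknown, a series
-- constant in x. It is determined, since a polynomial multiple of x - 1 that is constant in x is
-- zero.
--
-- The point x = 1 fits the recurrence of the G_i because U = 1 - Z is the root of its kernel u - 1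
-- + z: there the recurrence links the next G_i at 1 - Z with the previous one at 1 alone, and this
-- supplies the boundary term with J_i(1).
--
-- An interval stores the order relation as an irrelevant field, so no function can inspect how its
-- upper path lies above its lower one. The bijection therefore goes from the parts to the interval,
-- as a computation on bare words; that it is injective and surjective is known only irrelevantly,
-- which suffices to compare cardinalities, because equality and search in `Fin` are decidable.

-- Ring solver with integer coefficients, and certificates for equations

module RingKit (R : CommutativeRing 0ℓ 0ℓ) where

  open CommutativeRing R public
    using (Carrier; _≈_; 0#; 1#; setoid)
    renaming ( _+_ to infixl 6 _⊕_ ; _*_ to infixl 7 _⊗_ ; -_ to infix 8 ⊝_ ; _-_ to infixl 6 _⊖_
             ; refl to ≈-refl ; sym to ≈-sym ; trans to ≈-trans ; reflexive to ≈-reflexive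
             ; +-cong to ⊕-cong ; *-cong to ⊗-cong ; -‿cong to ⊝-cong
             ; +-comm to ⊕-comm ; *-comm to ⊗-comm ; +-assoc to ⊕-assoc ; *-assoc to ⊗-assoc
             ; +-identityˡ to ⊕-idˡ ; +-identityʳ to ⊕-idʳ ; *-identityˡ to ⊗-idˡ ; *-identityʳ to ⊗-idʳ
             ; zeroˡ to ⊗-zeroˡ ; zeroʳ to ⊗-zeroʳ ; distribˡ to ⊗-distribˡ ; distribʳ to ⊗-distribʳ
             ; -‿inverseʳ to ⊕-invʳ)
  open import Relation.Binary.Reasoning.Setoid setoid public
  open import Algebra.Properties.Semiring.Mult.TCOptimised (CommutativeRing.semiring R)
    using (×1-homo-*; ×-homo-+; 1+×) renaming (_×_ to _×ᴿ_)
  open import Algebra.Properties.Ring (CommutativeRing.ring R)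
    using (-‿distribˡ-*; -‿distribʳ-*; -0#≈0#; -‿involutive)
  open import Algebra.Properties.AbelianGroup (CommutativeRing.+-abelianGroup R)
    using (⁻¹-∙-comm)

  open ℤ using (ℤ; +_; -[1+_])

  -- The optimised multiple makes `ι 0` and `ι 1` reduce to `0#` and `1#`; later computations rely
  -- on this where a binomial coefficient evaluates to 1.
  ι : ℕ → Carrier
  ι n = n ×ᴿ 1#

  ι-+ : ∀ a b → ι (a + b) ≈ ι a ⊕ ι b
  ι-+ a b = ×-homo-+ 1# a b

  ι-* : ∀ a b → ι (a * b) ≈ ι a ⊗ ι b
  ι-* a b = ×1-homo-* a b

  ι-suc : ∀ a → ι (suc a) ≈ 1# ⊕ ι a
  ι-suc a = 1+× a 1#

  private
    ⟦_⟧ᶻ : ℤ → Carrier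
    ⟦ + n ⟧ᶻ = ι n
    ⟦ -[1+ n ] ⟧ᶻ = ⊝ ι (suc n)

    shift : ∀ a b → a ⊕ ⊝ b ≈ (1# ⊕ a) ⊕ ⊝ (1# ⊕ b)
    shift a b = begin
      a ⊕ ⊝ b ≈⟨ ⊕-idˡ _ ⟨
      0# ⊕ (a ⊕ ⊝ b) ≈⟨ ⊕-cong (⊕-invʳ 1#) ≈-refl ⟨
      1# ⊕ ⊝ 1# ⊕ (a ⊕ ⊝ b) ≈⟨ ⊕-assoc _ _ _ ⟩
      1# ⊕ (⊝ 1# ⊕ (a ⊕ ⊝ b)) ≈⟨ ⊕-cong ≈-refl (⊕-assoc _ _ _) ⟨
      1# ⊕ (⊝ 1# ⊕ a ⊕ ⊝ b) ≈⟨ ⊕-cong ≈-refl (⊕-cong (⊕-comm _ _) ≈-refl) ⟩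
      1# ⊕ (a ⊕ ⊝ 1# ⊕ ⊝ b) ≈⟨ ⊕-cong ≈-refl (⊕-assoc _ _ _) ⟩
      1# ⊕ (a ⊕ (⊝ 1# ⊕ ⊝ b)) ≈⟨ ⊕-assoc _ _ _ ⟨
      1# ⊕ a ⊕ (⊝ 1# ⊕ ⊝ b) ≈⟨ ⊕-cong ≈-refl (⁻¹-∙-comm _ _) ⟩
      1# ⊕ a ⊕ ⊝ (1# ⊕ b) ∎

    ⟦⟧-⊖ : ∀ m n → ⟦ m ℤ.⊖ n ⟧ᶻ ≈ ι m ⊕ ⊝ ι n
    ⟦⟧-⊖ zero zero = ≈-sym (⊕-invʳ 0#)
    ⟦⟧-⊖ zero (suc n) = ≈-sym (⊕-idˡ _)
    ⟦⟧-⊖ (suc m) zero = ≈-sym (≈-trans (⊕-cong ≈-refl -0#≈0#) (⊕-idʳ _))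
    ⟦⟧-⊖ (suc m) (suc n) = begin
      ⟦ suc m ℤ.⊖ suc n ⟧ᶻ ≡⟨ cong ⟦_⟧ᶻ (ℤₚ.[1+m]⊖[1+n]≡m⊖n m n) ⟩
      ⟦ m ℤ.⊖ n ⟧ᶻ ≈⟨ ⟦⟧-⊖ m n ⟩
      ι m ⊕ ⊝ ι n ≈⟨ shift (ι m) (ι n) ⟩
      (1# ⊕ ι m) ⊕ ⊝ (1# ⊕ ι n) ≈⟨ ⊕-cong (ι-suc m) (⊝-cong (ι-suc n)) ⟨
      ι (suc m) ⊕ ⊝ ι (suc n) ∎

    ⟦⟧-neg : ∀ a → ⟦ ℤ.- a ⟧ᶻ ≈ ⊝ ⟦ a ⟧ᶻ
    ⟦⟧-neg (+ zero) = ≈-sym -0#≈0#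
    ⟦⟧-neg (+ suc n) = ≈-refl
    ⟦⟧-neg -[1+ n ] = ≈-sym (-‿involutive _)

    ⟦⟧-+ : ∀ a b → ⟦ a ℤ.+ b ⟧ᶻ ≈ ⟦ a ⟧ᶻ ⊕ ⟦ b ⟧ᶻ
    ⟦⟧-+ (+ m) (+ n) = ι-+ m n
    ⟦⟧-+ (+ m) -[1+ n ] = ⟦⟧-⊖ m (suc n)
    ⟦⟧-+ -[1+ m ] (+ n) = ≈-trans (⟦⟧-⊖ n (suc m)) (⊕-comm _ _)
    ⟦⟧-+ -[1+ m ] -[1+ n ] = begin
      ⊝ ι (suc (suc (m + n))) ≡⟨ cong (λ k → ⊝ ι k) (sym (ℕₚ.+-suc (suc m) n)) ⟩
      ⊝ ι (suc m + suc n) ≈⟨ ⊝-cong (ι-+ (suc m) (suc n)) ⟩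
      ⊝ (ι (suc m) ⊕ ι (suc n)) ≈⟨ ⁻¹-∙-comm _ _ ⟨
      ⊝ ι (suc m) ⊕ ⊝ ι (suc n) ∎

    ⟦⟧-*⁺ : ∀ m b → ⟦ + m ℤ.* b ⟧ᶻ ≈ ι m ⊗ ⟦ b ⟧ᶻ
    ⟦⟧-*⁺ m (+ n) = ≈-trans (≈-reflexive (cong ⟦_⟧ᶻ (sym (ℤₚ.pos-* m n)))) (ι-* m n)
    ⟦⟧-*⁺ m -[1+ n ] = begin
      ⟦ + m ℤ.* (ℤ.- (+ suc n)) ⟧ᶻ ≡⟨ cong ⟦_⟧ᶻ (sym (ℤₚ.neg-distribʳ-* (+ m) (+ suc n))) ⟩
      ⟦ ℤ.- (+ m ℤ.* + suc n) ⟧ᶻ ≈⟨ ⟦⟧-neg (+ m ℤ.* + suc n) ⟩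
      ⊝ ⟦ + m ℤ.* + suc n ⟧ᶻ ≈⟨ ⊝-cong (⟦⟧-*⁺ m (+ suc n)) ⟩
      ⊝ (ι m ⊗ ι (suc n)) ≈⟨ -‿distribʳ-* _ _ ⟩
      ι m ⊗ ⊝ ι (suc n) ∎

    ⟦⟧-* : ∀ a b → ⟦ a ℤ.* b ⟧ᶻ ≈ ⟦ a ⟧ᶻ ⊗ ⟦ b ⟧ᶻ
    ⟦⟧-* (+ m) b = ⟦⟧-*⁺ m b
    ⟦⟧-* -[1+ m ] b = begin
      ⟦ (ℤ.- (+ suc m)) ℤ.* b ⟧ᶻ ≡⟨ cong ⟦_⟧ᶻ (sym (ℤₚ.neg-distribˡ-* (+ suc m) b)) ⟩
      ⟦ ℤ.- (+ suc m ℤ.* b) ⟧ᶻ ≈⟨ ⟦⟧-neg (+ suc m ℤ.* b) ⟩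
      ⊝ ⟦ + suc m ℤ.* b ⟧ᶻ ≈⟨ ⊝-cong (⟦⟧-*⁺ (suc m) b) ⟩
      ⊝ (ι (suc m) ⊗ ⟦ b ⟧ᶻ) ≈⟨ -‿distribˡ-* _ _ ⟩
      ⊝ ι (suc m) ⊗ ⟦ b ⟧ᶻ ∎

    ℤ⟶R : ℤ.+-*-rawRing -Raw-AlmostCommutative⟶ fromCommutativeRing R
    ℤ⟶R = record
      { ⟦_⟧ = ⟦_⟧ᶻ ; +-homo = ⟦⟧-+ ; *-homo = ⟦⟧-* ; -‿homo = ⟦⟧-neg
      ; 0-homo = ≈-refl ; 1-homo = ≈-refl }

    _≟ᶻ_ : ∀ a b → Maybe (⟦ a ⟧ᶻ ≈ ⟦ b ⟧ᶻ)
    a ≟ᶻ b with a ℤ.≟ b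
    ... | yes a≡b = just (≈-reflexive (cong ⟦_⟧ᶻ a≡b))
    ... | no _ = nothing

  open RingSolver ℤ.+-*-rawRing (fromCommutativeRing R) ℤ⟶R _≟ᶻ_ public
    using (Polynomial; con; solve; _:+_; _:*_; _:-_; :-_; _:=_)

  :0 :1 : ∀ {n} → Polynomial n
  :0 = con (+ 0)
  :1 = con (+ 1)

  ⊕-cancelʳ : ∀ {a b} c → a ⊕ c ≈ b ⊕ c → a ≈ b
  ⊕-cancelʳ {a} {b} c h = begin
    a ≈⟨ solve 2 (λ a c → a := (a :+ c) :- c) ≈-refl a c ⟩
    (a ⊕ c) ⊖ c ≈⟨ ⊕-cong h ≈-refl ⟩
    (b ⊕ c) ⊖ c ≈⟨ solve 2 (λ b c → (b :+ c) :- c := b) ≈-refl b c ⟩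
    b ∎

  ⊗-congˡ : ∀ a {b c} → b ≈ c → a ⊗ b ≈ a ⊗ c
  ⊗-congˡ a = ⊗-cong ≈-refl

  ⊗-congʳ : ∀ c {a b} → a ≈ b → a ⊗ c ≈ b ⊗ c
  ⊗-congʳ c h = ⊗-cong h ≈-refl

  -- A certificate rule: the last premise states x - y = q (a - b) without subtraction and is an
  -- identity for the ring solver; `q` is the multiple with which the known equation enters.
  by₁ : ∀ {a b x y} q → a ≈ b → x ⊕ q ⊗ b ≈ y ⊕ q ⊗ a → x ≈ y
  by₁ {a} {b} q h e = ⊕-cancelʳ (q ⊗ b) (≈-trans e (⊕-cong ≈-refl (⊗-congˡ q h)))

  by₂ : ∀ {a b a′ b′ x y} q q′ → a ≈ b → a′ ≈ b′ →
        x ⊕ q ⊗ b ⊕ q′ ⊗ b′ ≈ y ⊕ q ⊗ a ⊕ q′ ⊗ a′ → x ≈ y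
  by₂ q q′ h h′ e = by₁ q h (by₁ q′ h′ e)

  by₃ : ∀ {a b a′ b′ a″ b″ x y} q q′ q″ → a ≈ b → a′ ≈ b′ → a″ ≈ b″ →
        x ⊕ q ⊗ b ⊕ q′ ⊗ b′ ⊕ q″ ⊗ b″ ≈ y ⊕ q ⊗ a ⊕ q′ ⊗ a′ ⊕ q″ ⊗ a″ → x ≈ y
  by₃ q q′ q″ h h′ h″ e = by₂ q q′ h h′ (by₁ q″ h″ e)

≤ᵇ-true : ∀ {i m} → i ≤ m → (i ℕ.≤ᵇ m) ≡ true
≤ᵇ-true {i} {m} i≤m with i ℕ.≤ᵇ m in e
... | true = refl
... | false = ⊥-elim (subst T e (ℕₚ.≤⇒≤ᵇ i≤m))

≤ᵇ-false : ∀ {i m} → m < i → (i ℕ.≤ᵇ m) ≡ false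
≤ᵇ-false {i} {m} m<i with i ℕ.≤ᵇ m in e
... | false = refl
... | true = ⊥-elim (ℕₚ.<⇒≱ m<i (ℕₚ.≤ᵇ⇒≤ i m (subst T (sym e) _)))

pascal : ∀ n k → suc n C suc k ≡ n C k + n C suc k
pascal n k = sym (nCk+nC[k+1]≡[n+1]C[k+1] n k)

C-symmetric : ∀ a b → (a + b) C a ≡ (a + b) C b
C-symmetric a b = trans (nCk≡nC[n∸k] (ℕₚ.m≤m+n a b)) (cong ((a + b) C_) (ℕₚ.m+n∸m≡n a b))

-- Powers, finite sums, geometric sums and the binomial theorem

module Sums (R : CommutativeRing 0ℓ 0ℓ) where

  open RingKit R

  infixr 8 _↑_

  _↑_ : Carrier → ℕ → Carrier
  x ↑ zero = 1#
  x ↑ suc e = x ⊗ x ↑ e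

  ∑ : ℕ → (ℕ → Carrier) → Carrier
  ∑ zero f = 0#
  ∑ (suc n) f = ∑ n f ⊕ f n

  ↑-cong : ∀ {x y} e → x ≈ y → x ↑ e ≈ y ↑ e
  ↑-cong zero h = ≈-refl
  ↑-cong (suc e) h = ⊗-cong h (↑-cong e h)

  ↑-+ : ∀ x a b → x ↑ (a + b) ≈ x ↑ a ⊗ x ↑ b
  ↑-+ x zero b = ≈-sym (⊗-idˡ _)
  ↑-+ x (suc a) b = ≈-trans (⊗-congˡ x (↑-+ x a b)) (≈-sym (⊗-assoc _ _ _))

  ↑-⊗ : ∀ x y e → (x ⊗ y) ↑ e ≈ x ↑ e ⊗ y ↑ e
  ↑-⊗ x y zero = ≈-sym (⊗-idˡ _)
  ↑-⊗ x y (suc e) = ≈-trans (⊗-congˡ (x ⊗ y) (↑-⊗ x y e))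
    (solve 4 (λ x y a b → x :* y :* (a :* b) := x :* a :* (y :* b)) ≈-refl x y (x ↑ e) (y ↑ e))

  ↑-* : ∀ x a b → x ↑ (a * b) ≈ (x ↑ b) ↑ a
  ↑-* x zero b = ≈-refl
  ↑-* x (suc a) b = ≈-trans (↑-+ x b (a * b)) (⊗-congˡ (x ↑ b) (↑-* x a b))

  1↑ : ∀ e → 1# ↑ e ≈ 1#
  1↑ zero = ≈-refl
  1↑ (suc e) = ≈-trans (⊗-idˡ _) (1↑ e)

  ∑-cong : ∀ n {f g} → (∀ i → i < n → f i ≈ g i) → ∑ n f ≈ ∑ n g
  ∑-cong zero h = ≈-refl
  ∑-cong (suc n) h = ⊕-cong (∑-cong n (λ i i<n → h i (ℕₚ.m≤n⇒m≤1+n i<n))) (h n ℕₚ.≤-refl)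

  ∑-⊗ : ∀ n q f → ∑ n (λ i → q ⊗ f i) ≈ q ⊗ ∑ n f
  ∑-⊗ zero q f = ≈-sym (⊗-zeroʳ q)
  ∑-⊗ (suc n) q f = ≈-trans (⊕-cong (∑-⊗ n q f) ≈-refl) (≈-sym (⊗-distribˡ q _ _))

  ∑-⊕ : ∀ n f g → ∑ n (λ i → f i ⊕ g i) ≈ ∑ n f ⊕ ∑ n g
  ∑-⊕ zero f g = ≈-sym (⊕-idˡ _)
  ∑-⊕ (suc n) f g = ≈-trans (⊕-cong (∑-⊕ n f g) ≈-refl)
    (solve 4 (λ a b c d → (a :+ b) :+ (c :+ d) := (a :+ c) :+ (b :+ d)) ≈-refl (∑ n f) (∑ n g) (f n) (g n))

  ∑-head : ∀ n f → ∑ (suc n) f ≈ f 0 ⊕ ∑ n (λ i → f (suc i))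
  ∑-head zero f = ⊕-comm _ _
  ∑-head (suc n) f = ≈-trans (⊕-cong (∑-head n f) ≈-refl) (⊕-assoc _ _ _)

  geometric : ∀ u n → (u ⊖ 1#) ⊗ ∑ n (u ↑_) ≈ u ↑ n ⊖ 1#
  geometric u zero = solve 1 (λ u → (u :- :1) :* :0 := :1 :- :1) ≈-refl u
  geometric u (suc n) = by₁ 1# (geometric u n)
    (solve 3 (λ u s p → (u :- :1) :* (s :+ p) :+ :1 :* (p :- :1)
                     := (u :* p :- :1) :+ :1 :* ((u :- :1) :* s)) ≈-refl u (∑ n (u ↑_)) (u ↑ n))

  binomial-theorem : ∀ z n → ∑ (suc n) (λ k → (⊝ z) ↑ k ⊗ ι (n C k)) ≈ (1# ⊖ z) ↑ n
  binomial-theorem z zero = solve 0 (:0 :+ :1 :* :1 := :1) ≈-refl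
  binomial-theorem z (suc n) = begin
    E (suc n) (suc (suc n)) ≈⟨ E-step (suc n) ⟩
    E n (suc (suc n)) ⊕ ⊝ z ⊗ E n (suc n)
      ≈⟨ ⊕-cong (⊕-cong ≈-refl (⊗-congˡ _ (≈-reflexive (cong ι (k>n⇒nCk≡0 (ℕₚ.n<1+n n)))))) ≈-refl ⟩
    (E n (suc n) ⊕ (⊝ z) ↑ suc n ⊗ 0#) ⊕ ⊝ z ⊗ E n (suc n)
      ≈⟨ solve 3 (λ e p z → (e :+ p :* :0) :+ :- z :* e := (:1 :- z) :* e) ≈-refl (E n (suc n)) ((⊝ z) ↑ suc n) z ⟩
    (1# ⊖ z) ⊗ E n (suc n) ≈⟨ ⊗-congˡ _ (binomial-theorem z n) ⟩
    (1# ⊖ z) ⊗ (1# ⊖ z) ↑ n ∎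
    where
    E : ℕ → ℕ → Carrier
    E n L = ∑ L (λ k → (⊝ z) ↑ k ⊗ ι (n C k))
    -- Pascal's rule summed over k. The length of the sum is independent of n because the two halves
    -- of the rule end at different k.
    E-step : ∀ L → E (suc n) (suc L) ≈ E n (suc L) ⊕ ⊝ z ⊗ E n L
    E-step zero = solve 1 (λ z → :0 :+ :1 :* :1 := (:0 :+ :1 :* :1) :+ :- z :* :0) ≈-refl z
    E-step (suc L) = by₂ 1# ((⊝ z) ↑ suc L) (E-step L)
      (≈-trans (≈-reflexive (cong ι (pascal n L))) (ι-+ (n C L) (n C suc L)))
      (solve 8 (λ e e′ e₀ p z a b c →
          (e :+ :- z :* p :* c) :+ :1 :* (e′ :+ :- z :* e₀) :+ (:- z :* p) :* (a :+ b)
          := ((e′ :+ :- z :* p :* b) :+ :- z :* (e₀ :+ p :* a)) :+ :1 :* e :+ (:- z :* p) :* c) ≈-refl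
        (E (suc n) (suc L)) (E n (suc L)) (E n L) ((⊝ z) ↑ L) z (ι (n C L)) (ι (n C suc L)) (ι (suc n C suc L)))

-- The polynomials H_i

module HPolynomials (R : CommutativeRing 0ℓ 0ℓ) where

  open RingKit R
  open Sums R

  -- The terms below u^n of 1/(1-u)^k. For k = 0 the truncated subtraction leaves only the term e =
  -- 0, as it should.
  S : Carrier → ℕ → ℕ → Carrier
  S u k n = ∑ n (λ e → ι ((e + k ∸ 1) C e) ⊗ u ↑ e)

  -- Q u k c p = ∑_{e<c} C(e+k,e) u^{p+c-1-e}
  Q : Carrier → ℕ → ℕ → ℕ → Carrier
  Q u k zero p = 0#
  Q u k (suc c) p = Q u k c (suc p) ⊕ ι ((c + k) C c) ⊗ u ↑ p

  -- The coefficient of (-z)^k in H_i(z;u) / u^{i+1}, where n = m - i.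
  g : Carrier → ℕ → ℕ → ℕ → Carrier
  g u i n zero = 1#
  g u i n (suc k) = ι (suc i C suc k) ⊗ S u (suc k) (suc n) ⊕ ι ((n + k) C k) ⊗ Q u (suc k) (i ∸ k) (suc n)

  ιC-pascal : ∀ n k → ι (suc n C suc k) ≈ ι (n C k) ⊕ ι (n C suc k)
  ιC-pascal n k = ≈-trans (≈-reflexive (cong ι (pascal n k))) (ι-+ (n C k) (n C suc k))

  ιC-zero : ∀ {n k} → n < k → ι (n C k) ≈ 0#
  ιC-zero lt = ≈-reflexive (cong ι (k>n⇒nCk≡0 lt))

  -- Multiplying the truncation of 1/(1-u)^{k+1} by 1 - u gives that of 1/(1-u)^k, up to the term
  -- cut off at u^{n+1}; Pascal's rule is the induction step.
  S-recurrence : ∀ u k n → (u ⊖ 1#) ⊗ S u (suc k) (suc n) ≈ ι ((n + k) C n) ⊗ u ↑ suc n ⊖ S u k (suc n)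
  S-recurrence u k zero =
    solve 1 (λ u → (u :- :1) :* (:0 :+ :1 :* :1) := :1 :* (u :* :1) :- (:0 :+ :1 :* :1)) ≈-refl u
  S-recurrence u k (suc n) =
    by₃ {a″ = ι (suc (n + k) C suc n)} {b″ = ι ((n + k) C n) ⊕ ι ((n + k) C suc n)}
      1# ((u ⊖ 1#) ⊗ u ↑ suc n) (⊝ (u ↑ suc (suc n))) (S-recurrence u k n) split (ιC-pascal (n + k) n)
      (solve 8 (λ u s s′ p c d a b →
          ((u :- :1) :* (s :+ c :* p)) :+ :1 :* (a :* p :- s′) :+ ((u :- :1) :* p) :* (a :+ b) :+ (:- (u :* p)) :* (a :+ b)
          := (d :* (u :* p) :- (s′ :+ b :* p)) :+ :1 :* ((u :- :1) :* s) :+ ((u :- :1) :* p) :* c :+ (:- (u :* p)) :* d)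
        ≈-refl u (S u (suc k) (suc n)) (S u k (suc n)) (u ↑ suc n) (ι ((n + suc k) C suc n))
        (ι (suc (n + k) C suc n)) (ι ((n + k) C n)) (ι ((n + k) C suc n)))
    where
    split : ι ((n + suc k) C suc n) ≈ ι ((n + k) C n) ⊕ ι ((n + k) C suc n)
    split = ≈-trans (≈-reflexive (cong (λ j → ι (j C suc n)) (ℕₚ.+-suc n k))) (ιC-pascal (n + k) n)

  -- The same telescoping for the reversed sum: exponents fall as the binomials grow, so the
  -- boundary term sits at the lowest power u^p.
  Q-recurrence : ∀ u k c p → (u ⊖ 1#) ⊗ Q u (suc k) c p ≈ Q u k (suc c) p ⊖ ι ((c + suc k) C c) ⊗ u ↑ p
  Q-recurrence u k zero p =
    solve 2 (λ u p → (u :- :1) :* :0 := (:0 :+ :1 :* p) :- :1 :* p) ≈-refl u (u ↑ p)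
  Q-recurrence u k (suc c) p =
    by₂ 1# (u ↑ p) (Q-recurrence u k c (suc p))
      (≈-trans (ιC-pascal (c + suc k) c)
        (⊕-cong ≈-refl (≈-reflexive (cong (λ j → ι (j C suc c)) (ℕₚ.+-suc c k)))))
      (solve 7 (λ u r r′ p c a b →
          ((u :- :1) :* (r :+ a :* p)) :+ :1 :* (r′ :- a :* (u :* p)) :+ p :* (a :+ b)
          := ((r′ :+ b :* p) :- c :* p) :+ :1 :* ((u :- :1) :* r) :+ p :* c)
        ≈-refl u (Q u (suc k) c (suc p)) (Q u k (suc c) (suc p)) (u ↑ p)
        (ι (suc (c + suc k) C suc c)) (ι ((c + suc k) C c)) (ι (suc (c + k) C suc c)))

  Q₀-geometric : ∀ u c p → Q u 0 c p ≈ u ↑ p ⊗ ∑ c (u ↑_)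
  Q₀-geometric u zero p = ≈-sym (⊗-zeroʳ _)
  Q₀-geometric u (suc c) p = begin
    Q u 0 c (suc p) ⊕ ι ((c + 0) C c) ⊗ u ↑ p
      ≈⟨ ⊕-cong (Q₀-geometric u c (suc p)) (⊗-congʳ _ (≈-reflexive (cong ι c+0Cc≡1))) ⟩
    u ⊗ u ↑ p ⊗ ∑ c (u ↑_) ⊕ 1# ⊗ u ↑ p
      ≈⟨ by₁ (u ↑ p) (geometric u c) (solve 4 (λ u p s q →
           (u :* p :* s :+ :1 :* p) :+ p :* (q :- :1) := p :* (s :+ q) :+ p :* ((u :- :1) :* s))
           ≈-refl u (u ↑ p) (∑ c (u ↑_)) (u ↑ c)) ⟩
    u ↑ p ⊗ ∑ (suc c) (u ↑_) ∎
    where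
    c+0Cc≡1 : (c + 0) C c ≡ 1
    c+0Cc≡1 = trans (cong (_C c) (ℕₚ.+-identityʳ c)) (nCn≡1 c)

  -- For k ≤ i this unfolds the last summand, whose binomial is read from the other side. For k > i
  -- both sums are empty and C(i+1,k+1) vanishes, so the truncated subtractions do no harm.
  Q-extend : ∀ u i k p → Q u (suc k) (suc i ∸ k) p ≈ Q u (suc k) (i ∸ k) (suc p) ⊕ ι (suc i C suc k) ⊗ u ↑ p
  Q-extend u i k p with k ℕ.≤? i
  ... | yes k≤i = begin
    Q u (suc k) (suc i ∸ k) p ≡⟨ cong (λ c → Q u (suc k) c p) (ℕₚ.+-∸-assoc 1 k≤i) ⟩
    Q u (suc k) (i ∸ k) (suc p) ⊕ ι ((i ∸ k + suc k) C (i ∸ k)) ⊗ u ↑ p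
      ≡⟨ cong (λ b → Q u (suc k) (i ∸ k) (suc p) ⊕ ι b ⊗ u ↑ p) eq ⟩
    Q u (suc k) (i ∸ k) (suc p) ⊕ ι (suc i C suc k) ⊗ u ↑ p ∎
    where
    eq : (i ∸ k + suc k) C (i ∸ k) ≡ suc i C suc k
    eq = trans (C-symmetric (i ∸ k) (suc k))
           (cong (_C suc k) (trans (ℕₚ.+-suc (i ∸ k) k) (cong suc (ℕₚ.m∸n+n≡m k≤i))))
  ... | no k≰i = begin
    Q u (suc k) (suc i ∸ k) p ≡⟨ cong (λ c → Q u (suc k) c p) (ℕₚ.m≤n⇒m∸n≡0 (ℕₚ.≰⇒> k≰i)) ⟩
    0# ≈⟨ solve 1 (λ p → :0 := :0 :+ :0 :* p) ≈-refl (u ↑ p) ⟩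
    0# ⊕ 0# ⊗ u ↑ p ≈⟨ ⊕-cong (≈-reflexive (cong (λ c → Q u (suc k) c (suc p)) (ℕₚ.m≤n⇒m∸n≡0 (ℕₚ.<⇒≤ (ℕₚ.≰⇒> k≰i)))))
                                            (⊗-congʳ _ (ιC-zero (s≤s (ℕₚ.≰⇒> k≰i)))) ⟨
    Q u (suc k) (i ∸ k) (suc p) ⊕ ι (suc i C suc k) ⊗ u ↑ p ∎

  -- `Q-recurrence` at the lengths that occur in `g`; it extends to k ≥ i because there the sums are
  -- empty and C(i+1,k+2) = 0.
  Q-lower : ∀ u i k p → (u ⊖ 1#) ⊗ Q u (suc (suc k)) (i ∸ suc k) p
                        ≈ Q u (suc k) (i ∸ k) p ⊖ ι (suc i C suc (suc k)) ⊗ u ↑ p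
  Q-lower u i k p with suc k ℕ.≤? i
  ... | yes k<i = begin
    (u ⊖ 1#) ⊗ Q u (suc (suc k)) (i ∸ suc k) p ≈⟨ Q-recurrence u (suc k) (i ∸ suc k) p ⟩
    Q u (suc k) (suc (i ∸ suc k)) p ⊖ ι ((i ∸ suc k + suc (suc k)) C (i ∸ suc k)) ⊗ u ↑ p
      ≡⟨ cong₂ (λ c b → Q u (suc k) c p ⊖ ι b ⊗ u ↑ p) (sym (ℕₚ.+-∸-assoc 1 k<i)) eq ⟩
    Q u (suc k) (i ∸ k) p ⊖ ι (suc i C suc (suc k)) ⊗ u ↑ p ∎
    where
    eq : (i ∸ suc k + suc (suc k)) C (i ∸ suc k) ≡ suc i C suc (suc k)
    eq = trans (C-symmetric (i ∸ suc k) (suc (suc k)))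
           (cong (_C suc (suc k)) (trans (ℕₚ.+-suc (i ∸ suc k) (suc k)) (cong suc (ℕₚ.m∸n+n≡m k<i))))
  ... | no k≮i = begin
    (u ⊖ 1#) ⊗ Q u (suc (suc k)) (i ∸ suc k) p
      ≡⟨ cong (λ c → (u ⊖ 1#) ⊗ Q u (suc (suc k)) c p) (ℕₚ.m≤n⇒m∸n≡0 (ℕₚ.<⇒≤ (ℕₚ.≰⇒> k≮i))) ⟩
    (u ⊖ 1#) ⊗ 0# ≈⟨ solve 2 (λ u p → (u :- :1) :* :0 := :0 :- :0 :* p) ≈-refl u (u ↑ p) ⟩
    0# ⊖ 0# ⊗ u ↑ p
      ≈⟨ ⊕-cong (≈-reflexive (cong (λ c → Q u (suc k) c p) (ℕₚ.m≤n⇒m∸n≡0 (ℕ.s≤s⁻¹ (ℕₚ.≰⇒> k≮i)))))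
                (⊝-cong (⊗-congʳ _ (ιC-zero (s≤s (ℕₚ.≰⇒> k≮i))))) ⟨
    Q u (suc k) (i ∸ k) p ⊖ ι (suc i C suc (suc k)) ⊗ u ↑ p ∎

  -- At u = 1 the recurrence one level up loses its left side, and what remains of it is this value.
  S-at-1 : ∀ k n → S 1# k (suc n) ≈ ι ((n + k) C n)
  S-at-1 k n = by₂ 1# c (S-recurrence 1# k n) (1↑ (suc n))
    (solve 4 (λ s s′ c p → s :+ :1 :* (c :* p :- s) :+ c :* :1 := c :+ :1 :* ((:1 :- :1) :* s′) :+ c :* p)
      ≈-refl (S 1# k (suc n)) (S 1# (suc k) (suc n)) c (1# ↑ suc n))
    where
    c = ι ((n + k) C n)

  Q-at-1 : ∀ i k p → Q 1# (suc k) (i ∸ k) p ≈ ι (suc i C suc (suc k))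
  Q-at-1 i k p = by₂ (⊝ 1#) c (Q-lower 1# i k p) (1↑ p)
    (solve 4 (λ s s′ c p → s :+ (:- :1) :* (s :- c :* p) :+ c :* :1 := c :+ (:- :1) :* ((:1 :- :1) :* s′) :+ c :* p)
      ≈-refl (Q 1# (suc k) (i ∸ k) p) (Q 1# (suc (suc k)) (i ∸ suc k) p) c (1# ↑ p))
    where
    c = ι (suc i C suc (suc k))

  S₀ : ∀ u n → S u 0 (suc n) ≈ 1#
  S₀ u zero = solve 0 (:0 :+ :1 :* :1 := :1) ≈-refl
  S₀ u (suc n) = begin
    S u 0 (suc n) ⊕ ι ((n + 0) C suc n) ⊗ u ↑ suc n
      ≈⟨ ⊕-cong (S₀ u n) (⊗-congʳ _ (ιC-zero (s≤s (ℕₚ.≤-reflexive (ℕₚ.+-identityʳ n))))) ⟩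
    1# ⊕ 0# ⊗ u ↑ suc n ≈⟨ solve 1 (λ p → :1 :+ :0 :* p := :1) ≈-refl (u ↑ suc n) ⟩
    1# ∎

  ι-cong : ∀ {a b} → a ≡ b → ι a ≈ ι b
  ι-cong h = ≈-reflexive (cong ι h)

  n+0Cn≡1 : ∀ n → (n + 0) C n ≡ 1
  n+0Cn≡1 n = trans (cong (_C n) (ℕₚ.+-identityʳ n)) (nCn≡1 n)

  -- The coefficient of (-z)^{k+1} in `G-step`. The sum i + n = m is constant, so n falls when i
  -- rises.
  g-step : ∀ u i n k → (u ⊖ 1#) ⊗ (g u (suc i) n (suc k) ⊖ g u i (suc n) (suc k))
                       ≈ u ↑ suc n ⊗ g 1# i (suc n) k ⊖ g u i (suc n) k
  g-step u i n zero = begin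
    (u ⊖ 1#) ⊗ (g u (suc i) n 1 ⊖ g u i (suc n) 1)
      ≈⟨ ⊗-congˡ _ (⊕-cong
           (⊕-cong (⊗-congʳ s (ιC-pascal (suc i) 0)) (⊗-congˡ 1# (Q-extend u i 0 (suc n))))
           (⊝-cong (⊕-cong (⊗-congˡ b (⊕-cong ≈-refl (⊗-congʳ p (ι-cong n+1Cn+1)))) ≈-refl))) ⟩
    (u ⊖ 1#) ⊗ ((1# ⊕ b) ⊗ s ⊕ 1# ⊗ (q ⊕ b ⊗ p) ⊖ (b ⊗ (s ⊕ 1# ⊗ p) ⊕ 1# ⊗ q))
      ≈⟨ solve 5 (λ u s b q p → (u :- :1) :* ((:1 :+ b) :* s :+ :1 :* (q :+ b :* p) :- (b :* (s :+ :1 :* p) :+ :1 :* q))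
                             := (u :- :1) :* s) ≈-refl u s b q p ⟩
    (u ⊖ 1#) ⊗ s ≈⟨ S-recurrence u 0 n ⟩
    ι ((n + 0) C n) ⊗ p ⊖ S u 0 (suc n) ≈⟨ ⊕-cong (⊗-congʳ p (ι-cong (n+0Cn≡1 n))) (⊝-cong (S₀ u n)) ⟩
    1# ⊗ p ⊖ 1# ≈⟨ ⊕-cong (⊗-comm 1# p) ≈-refl ⟩
    p ⊗ 1# ⊖ 1# ∎
    where
    s = S u 1 (suc n)
    b = ι (suc i C 1)
    q = Q u 1 i (suc (suc n))
    p = u ↑ suc n
    n+1Cn+1 : (n + 1) C suc n ≡ 1
    n+1Cn+1 = trans (cong (_C suc n) (ℕₚ.+-comm n 1)) (nCn≡1 (suc n))
  g-step u i n (suc k) = begin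
    (u ⊖ 1#) ⊗ (g u (suc i) n (suc (suc k)) ⊖ g u i (suc n) (suc (suc k)))
      ≈⟨ ⊗-congˡ _ (⊕-cong
           (⊕-cong (⊗-congʳ s (ιC-pascal (suc i) (suc k))) (⊗-congˡ c (Q-extend u i (suc k) (suc n))))
           (⊝-cong (⊕-cong (⊗-congˡ b (⊕-cong ≈-refl (⊗-congʳ p c₁))) (⊗-congʳ q c₂)))) ⟩
    (u ⊖ 1#) ⊗ ((a ⊕ b) ⊗ s ⊕ c ⊗ (q ⊕ b ⊗ p) ⊖ (b ⊗ (s ⊕ (c ⊕ d) ⊗ p) ⊕ (c ⊕ d) ⊗ q))
      -- After Pascal's rule in every binomial the bracket equals a s - d q - b d p, so only (u - 1)
      -- s and (u - 1) q have to be known.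
      ≈⟨ by₂ a (⊝ d) s-rec (Q-lower u i k (suc (suc n)))
           (solve 10 (λ u s a b c d q p s′ q′ →
             (u :- :1) :* ((a :+ b) :* s :+ c :* (q :+ b :* p) :- (b :* (s :+ (c :+ d) :* p) :+ (c :+ d) :* q))
             :+ a :* (c :* p :- s′) :+ (:- d) :* (q′ :- b :* (u :* p))
             := (p :* (a :* (c :+ d) :+ d :* b) :- (a :* (s′ :+ d :* p) :+ d :* q′))
             :+ a :* ((u :- :1) :* s) :+ (:- d) :* ((u :- :1) :* q)) ≈-refl u s a b c d q p s′ q′) ⟩
    p ⊗ (a ⊗ (c ⊕ d) ⊕ d ⊗ b) ⊖ (a ⊗ (s′ ⊕ d ⊗ p) ⊕ d ⊗ q′)
      ≈⟨ ⊕-cong (⊗-congˡ p (⊕-cong (⊗-congˡ a (≈-trans (S-at-1 (suc k) (suc n)) c₃)) (⊗-congˡ d (Q-at-1 i k (suc (suc n))))))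
                (⊝-cong (⊕-cong (⊗-congˡ a (⊕-cong ≈-refl (⊗-congʳ p c₄))) ≈-refl)) ⟨
    p ⊗ g 1# i (suc n) (suc k) ⊖ g u i (suc n) (suc k) ∎
    where
    s = S u (suc (suc k)) (suc n)
    s′ = S u (suc k) (suc n)
    q = Q u (suc (suc k)) (i ∸ suc k) (suc (suc n))
    q′ = Q u (suc k) (i ∸ k) (suc (suc n))
    p = u ↑ suc n
    a = ι (suc i C suc k)
    b = ι (suc i C suc (suc k))
    c = ι ((n + suc k) C suc k)
    d = ι ((suc n + k) C k)
    s-rec : (u ⊖ 1#) ⊗ s ≈ c ⊗ p ⊖ s′
    s-rec = ≈-trans (S-recurrence u (suc k) n) (⊕-cong (⊗-congʳ p (ι-cong (C-symmetric n (suc k)))) ≈-refl)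
    c₂ : ι ((suc n + suc k) C suc k) ≈ c ⊕ d
    c₂ = ≈-trans (ιC-pascal (n + suc k) k)
           (≈-trans (⊕-cong (ι-cong (cong (_C k) (ℕₚ.+-suc n k))) ≈-refl) (⊕-comm d c))
    c₃ : ι ((suc n + suc k) C suc n) ≈ c ⊕ d
    c₃ = ≈-trans (ι-cong (C-symmetric (suc n) (suc k))) c₂
    c₁ : ι ((n + suc (suc k)) C suc n) ≈ c ⊕ d
    c₁ = ≈-trans (ι-cong (cong (_C suc n) (ℕₚ.+-suc n (suc k)))) c₃
    c₄ : ι ((n + suc k) C suc n) ≈ d
    c₄ = ι-cong (trans (cong (_C suc n) (ℕₚ.+-suc n k)) (C-symmetric (suc n) k))

  -- A factor z in a recurrence shifts the coefficients by one; with the length L free, this shift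
  -- is handled by induction on L.
  partialG : ℕ → Carrier → Carrier → ℕ → ℕ → Carrier
  partialG L z u i n = ∑ L (λ k → (⊝ z) ↑ k ⊗ g u i n k)

  G : Carrier → Carrier → ℕ → ℕ → Carrier
  G z u i n = partialG (suc (suc i)) z u i n

  partialG-step : ∀ L z u i n →
    (u ⊖ 1#) ⊗ (partialG (suc L) z u (suc i) n ⊖ partialG (suc L) z u i (suc n))
    ≈ z ⊗ (partialG L z u i (suc n) ⊖ u ↑ suc n ⊗ partialG L z 1# i (suc n))
  partialG-step zero z u i n =
    solve 3 (λ u z p → (u :- :1) :* ((:0 :+ :1 :* :1) :- (:0 :+ :1 :* :1)) := z :* (:0 :- p :* :0)) ≈-refl u z (u ↑ suc n)
  partialG-step (suc L) z u i n =
    by₂ 1# ((⊝ z) ↑ suc L) (partialG-step L z u i n) (g-step u i n L)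
      (solve 12 (λ u z p x a b a′ b′ e c d f →
        ((u :- :1) :* ((a :+ :- z :* x :* b) :- (a′ :+ :- z :* x :* b′)))
          :+ :1 :* (z :* (e :- p :* c)) :+ (:- z :* x) :* (p :* d :- f)
        := (z :* ((e :+ x :* f) :- p :* (c :+ x :* d)))
          :+ :1 :* ((u :- :1) :* (a :- a′)) :+ (:- z :* x) :* ((u :- :1) :* (b :- b′))) ≈-refl
        u z (u ↑ suc n) ((⊝ z) ↑ L)
        (partialG (suc L) z u (suc i) n) (g u (suc i) n (suc L))
        (partialG (suc L) z u i (suc n)) (g u i (suc n) (suc L))
        (partialG L z u i (suc n)) (partialG L z 1# i (suc n)) (g 1# i (suc n) L) (g u i (suc n) L))

  g-degree : ∀ u i n → g u i n (suc (suc i)) ≈ 0#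
  g-degree u i n = ≈-trans
    (⊕-cong (⊗-congʳ s (ιC-zero {suc i} ℕₚ.≤-refl))
            (⊗-congˡ c (≈-reflexive (cong (λ l → Q u (suc (suc i)) l (suc n)) (ℕₚ.m≤n⇒m∸n≡0 (ℕₚ.n≤1+n i))))))
    (solve 2 (λ s c → :0 :* s :+ c :* :0 := :0) ≈-refl s c)
    where
    s = S u (suc (suc i)) (suc n)
    c = ι ((n + suc i) C suc i)

  -- In the recurrence i grows by one, hence so does the length of the sum on one side only; the
  -- coefficient missing on the other side is zero.
  G-extend : ∀ z u i n → partialG (suc (suc (suc i))) z u i n ≈ G z u i n
  G-extend z u i n = ≈-trans (⊕-cong ≈-refl (≈-trans (⊗-congˡ _ (g-degree u i n)) (⊗-zeroʳ _))) (⊕-idʳ _)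

  G-step : ∀ z u i n →
    (u ⊖ 1#) ⊗ G z u (suc i) n ≈ (u ⊖ 1# ⊕ z) ⊗ G z u i (suc n) ⊖ u ↑ suc n ⊗ z ⊗ G z 1# i (suc n)
  G-step z u i n = by₂ 1# (u ⊖ 1#) (partialG-step (suc (suc i)) z u i n) (G-extend z u i (suc n))
    (solve 7 (λ u z a b e p f →
      ((u :- :1) :* a) :+ :1 :* (z :* (e :- p :* f)) :+ (u :- :1) :* e
      := ((u :- :1 :+ z) :* e :- p :* z :* f) :+ :1 :* ((u :- :1) :* (a :- b)) :+ (u :- :1) :* b) ≈-refl
      u z (G z u (suc i) n) (partialG (suc (suc (suc i))) z u i (suc n)) (G z u i (suc n)) (u ↑ suc n) (G z 1# i (suc n)))

  S-one-term : ∀ u k → S u k 1 ≈ 1#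
  S-one-term u k = solve 0 (:0 :+ :1 :* :1 := :1) ≈-refl

  -- From order 2 in -z on, (u - 1) g_k - g_{k-1} = - C(m+2,k), because `Q-lower` at p = 1 removes
  -- both reversed sums. Orders 0 and 1 produce the extra u and the geometric sum.
  partialG-top : ∀ L z u m →
    (u ⊖ 1#) ⊗ partialG (suc (suc L)) z u m 0 ⊕ z ⊗ partialG (suc L) z u m 0
    ≈ u ⊖ z ⊗ (u ⊗ ∑ (suc m) (u ↑_)) ⊖ ∑ (suc (suc L)) (λ k → (⊝ z) ↑ k ⊗ ι (suc (suc m) C k))
  partialG-top zero z u m = begin
    (u ⊖ 1#) ⊗ partialG 2 z u m 0 ⊕ z ⊗ partialG 1 z u m 0
      ≈⟨ ⊕-cong (⊗-congˡ _ (⊕-cong ≈-refl (⊗-congˡ _ (⊕-cong (⊗-congˡ b (S-one-term u 1)) ≈-refl)))) ≈-refl ⟩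
    (u ⊖ 1#) ⊗ (0# ⊕ 1# ⊗ 1# ⊕ ⊝ z ⊗ 1# ⊗ (b ⊗ 1# ⊕ 1# ⊗ q)) ⊕ z ⊗ (0# ⊕ 1# ⊗ 1#)
      ≈⟨ by₃ (⊝ z) (⊝ z) (z ⊗ u) (Q-recurrence u 0 m 1) (Q₀-geometric u (suc m) 1)
           (ι-cong (trans (C-symmetric m 1) (cong (_C 1) (ℕₚ.+-comm m 1))))
           (solve 7 (λ u z b q q₀ s c →
             ((u :- :1) :* (:0 :+ :1 :* :1 :+ :- z :* :1 :* (b :* :1 :+ :1 :* q)) :+ z :* (:0 :+ :1 :* :1))
               :+ (:- z) :* (q₀ :- c :* (u :* :1)) :+ (:- z) :* (u :* :1 :* s) :+ (z :* u) :* b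
             := (u :- z :* (u :* s) :- (:0 :+ :1 :* :1 :+ :- z :* :1 :* (:1 :+ b)))
               :+ (:- z) :* ((u :- :1) :* q) :+ (:- z) :* q₀ :+ (z :* u) :* c) ≈-refl
             u z b q (Q u 0 (suc m) 1) (∑ (suc m) (u ↑_)) (ι ((m + 1) C m))) ⟩
    u ⊖ z ⊗ (u ⊗ ∑ (suc m) (u ↑_)) ⊖ (0# ⊕ 1# ⊗ 1# ⊕ ⊝ z ⊗ 1# ⊗ (1# ⊕ b))
      ≈⟨ ⊕-cong ≈-refl (⊝-cong (⊕-cong ≈-refl (⊗-congˡ _ (ιC-pascal (suc m) 0)))) ⟨
    u ⊖ z ⊗ (u ⊗ ∑ (suc m) (u ↑_)) ⊖ ∑ 2 (λ k → (⊝ z) ↑ k ⊗ ι (suc (suc m) C k)) ∎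
    where
    b = ι (suc m C 1)
    q = Q u 1 m 1
  partialG-top (suc L) z u m = begin
    (u ⊖ 1#) ⊗ (p ⊕ x ⊗ g u m 0 (suc (suc L))) ⊕ z ⊗ (p′ ⊕ y ⊗ g u m 0 (suc L))
      ≈⟨ ⊕-cong (⊗-congˡ _ (⊕-cong ≈-refl (⊗-congˡ x (coeff (suc L)))))
                (⊗-congˡ z (⊕-cong ≈-refl (⊗-congˡ y (coeff L)))) ⟩
    (u ⊖ 1#) ⊗ (p ⊕ x ⊗ (b ⊗ 1# ⊕ 1# ⊗ q)) ⊕ z ⊗ (p′ ⊕ y ⊗ (a ⊗ 1# ⊕ 1# ⊗ q′))
      ≈⟨ by₃ 1# x x (partialG-top L z u m) (Q-lower u m L 1) (ιC-pascal (suc m) (suc L))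
           (solve 12 (λ u z p p′ y a b q q′ r e c →
             ((u :- :1) :* (p :+ :- z :* y :* (b :* :1 :+ :1 :* q)) :+ z :* (p′ :+ y :* (a :* :1 :+ :1 :* q′)))
              :+ :1 :* (r :- e) :+ (:- z :* y) :* (q′ :- b :* (u :* :1)) :+ (:- z :* y) :* (a :+ b)
             := (r :- (e :+ :- z :* y :* c))
              :+ :1 :* ((u :- :1) :* p :+ z :* p′) :+ (:- z :* y) :* ((u :- :1) :* q) :+ (:- z :* y) :* c) ≈-refl
             u z p p′ y a b q q′ (u ⊖ z ⊗ (u ⊗ ∑ (suc m) (u ↑_)))
             (∑ (suc (suc L)) (λ k → (⊝ z) ↑ k ⊗ ι (suc (suc m) C k))) (ι (suc (suc m) C suc (suc L)))) ⟩
    u ⊖ z ⊗ (u ⊗ ∑ (suc m) (u ↑_)) ⊖ ∑ (suc (suc (suc L))) (λ k → (⊝ z) ↑ k ⊗ ι (suc (suc m) C k)) ∎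
    where
    p = partialG (suc (suc L)) z u m 0
    p′ = partialG (suc L) z u m 0
    x = (⊝ z) ↑ suc (suc L)
    y = (⊝ z) ↑ suc L
    a = ι (suc m C suc L)
    b = ι (suc m C suc (suc L))
    q = Q u (suc (suc L)) (m ∸ suc L) 1
    q′ = Q u (suc L) (m ∸ L) 1
    coeff : ∀ k → g u m 0 (suc k) ≈ ι (suc m C suc k) ⊗ 1# ⊕ 1# ⊗ Q u (suc k) (m ∸ k) 1
    coeff k = ⊕-cong (⊗-congˡ _ (S-one-term u (suc k))) (⊗-congʳ _ (ι-cong (nCn≡1 k)))

  G-top : ∀ z u m → (u ⊖ 1# ⊕ z) ⊗ G z u m 0 ≈ u ⊖ z ⊗ (u ⊗ ∑ (suc m) (u ↑_)) ⊖ (1# ⊖ z) ↑ (2 + m)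
  G-top z u m = by₃ 1# (u ⊖ 1#) (⊝ 1#) (partialG-top (suc m) z u m) (≈-sym (G-extend z u m 0)) (binomial-theorem z (2 + m))
    (solve 7 (λ u z e e′ r s t →
      ((u :- :1 :+ z) :* e) :+ :1 :* (r :- s) :+ (u :- :1) :* e′ :+ (:- :1) :* t
      := (r :- t) :+ :1 :* ((u :- :1) :* e′ :+ z :* e) :+ (u :- :1) :* e :+ (:- :1) :* s) ≈-refl
      u z (G z u m 0) (partialG (suc (suc (suc m))) z u m 0) (u ⊖ z ⊗ (u ⊗ ∑ (suc m) (u ↑_)))
      (∑ (suc (2 + m)) (λ k → (⊝ z) ↑ k ⊗ ι ((2 + m) C k))) ((1# ⊖ z) ↑ (2 + m)))

  G-last : Carrier → Carrier → ℕ → Carrier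
  G-last z u m = 1# ⊖ z ⊗ ∑ (suc m) (λ e → ι (suc m ∸ e) ⊗ u ↑ e)

  -- From n to n + 1 every weight n - e rises by one, which adds a full geometric sum.
  weighted-geometric : ∀ u n → (u ⊖ 1#) ⊗ ∑ n (λ e → ι (n ∸ e) ⊗ u ↑ e) ≈ u ⊗ ∑ n (u ↑_) ⊖ ι n
  weighted-geometric u zero = solve 1 (λ u → (u :- :1) :* :0 := u :* :0 :- :0) ≈-refl u
  weighted-geometric u (suc n) = begin
    (u ⊖ 1#) ⊗ (∑ n (λ e → ι (suc n ∸ e) ⊗ u ↑ e) ⊕ ι (suc n ∸ n) ⊗ p)
      ≈⟨ ⊗-congˡ _ (⊕-cong (∑-cong n (λ e e<n → ≈-trans (⊗-congʳ _ (≈-trans (ι-cong (ℕₚ.+-∸-assoc 1 (ℕₚ.<⇒≤ e<n))) (ι-suc (n ∸ e))))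
                                            (≈-trans (⊗-distribʳ _ _ _) (⊕-cong (⊗-idˡ _) ≈-refl))))
                            (⊗-congʳ p (ι-cong (ℕₚ.m+n∸n≡m 1 n)))) ⟩
    (u ⊖ 1#) ⊗ (∑ n (λ e → u ↑ e ⊕ ι (n ∸ e) ⊗ u ↑ e) ⊕ 1# ⊗ p)
      ≈⟨ ⊗-congˡ _ (⊕-cong (∑-⊕ n _ _) ≈-refl) ⟩
    (u ⊖ 1#) ⊗ (s ⊕ w ⊕ 1# ⊗ p)
      ≈⟨ by₃ 1# 1# 1# (geometric u n) (weighted-geometric u n) (ι-suc n)
           (solve 6 (λ u s w p i j →
             (u :- :1) :* (s :+ w :+ :1 :* p) :+ :1 :* (p :- :1) :+ :1 :* (u :* s :- i) :+ :1 :* (:1 :+ i)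
             := (u :* (s :+ p) :- j) :+ :1 :* ((u :- :1) :* s) :+ :1 :* ((u :- :1) :* w) :+ :1 :* j) ≈-refl
             u s w p (ι n) (ι (suc n))) ⟩
    u ⊗ (s ⊕ p) ⊖ ι (suc n) ∎
    where
    p = u ↑ n
    s = ∑ n (u ↑_)
    w = ∑ n (λ e → ι (n ∸ e) ⊗ u ↑ e)
  
  ∑-ones : ∀ n → ∑ n (1# ↑_) ≈ ι n
  ∑-ones zero = ≈-refl
  ∑-ones (suc n) = ≈-trans (⊕-cong (∑-ones n) (1↑ n)) (≈-trans (⊕-comm _ _) (≈-sym (ι-suc n)))

  G-top-at-1 : ∀ z m → z ⊗ G z 1# m 0 ≈ 1# ⊖ z ⊗ ι (suc m) ⊖ (1# ⊖ z) ↑ (2 + m)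
  G-top-at-1 z m = by₂ 1# (⊝ z) (G-top z 1# m) (∑-ones (suc m))
    (solve 5 (λ z e s i t →
      (z :* e) :+ :1 :* (:1 :- z :* (:1 :* s) :- t) :+ (:- z) :* i
      := (:1 :- z :* i :- t) :+ :1 :* ((:1 :- :1 :+ z) :* e) :+ (:- z) :* s) ≈-refl
      z (G z 1# m 0) (∑ (suc m) (1# ↑_)) (ι (suc m)) ((1# ⊖ z) ↑ (2 + m)))

  -- The separate formula for i = m + 1 continues the recurrence: subtracting `G-top-at-1` from
  -- `G-top` cancels (1-z)^{m+2} and leaves (u - 1)(1 - z w), with w the weighted geometric sum.
  G-last-step : ∀ z u m → (u ⊖ 1#) ⊗ G-last z u m ≈ (u ⊖ 1# ⊕ z) ⊗ G z u m 0 ⊖ z ⊗ G z 1# m 0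
  G-last-step z u m = by₃ (⊝ 1#) 1# (⊝ z) (G-top z u m) (G-top-at-1 z m) (weighted-geometric u (suc m))
    (solve 8 (λ u z w e e₁ s t i →
      (u :- :1) :* (:1 :- z :* w) :+ (:- :1) :* (u :- z :* (u :* s) :- t) :+ :1 :* (:1 :- z :* i :- t) :+ (:- z) :* (u :* s :- i)
      := ((u :- :1 :+ z) :* e :- z :* e₁) :+ (:- :1) :* ((u :- :1 :+ z) :* e) :+ :1 :* (z :* e₁) :+ (:- z) :* ((u :- :1) :* w)) ≈-refl
      u z (∑ (suc m) (λ e → ι (suc m ∸ e) ⊗ u ↑ e)) (G z u m 0) (G z 1# m 0) (∑ (suc m) (u ↑_)) ((1# ⊖ z) ↑ (2 + m)) (ι (suc m)))

  Gᵢ : ℕ → Carrier → Carrier → ℕ → Carrier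
  Gᵢ m z u i = if i ℕ.≤ᵇ m then G z u i (m ∸ i) else G-last z u m

  Gᵢ-small : ∀ {m i} z u → i ≤ m → Gᵢ m z u i ≡ G z u i (m ∸ i)
  Gᵢ-small {m} {i} z u i≤m = cong (λ b → if b then G z u i (m ∸ i) else G-last z u m) (≤ᵇ-true i≤m)

  Gᵢ-last : ∀ m z u → Gᵢ m z u (suc m) ≡ G-last z u m
  Gᵢ-last m z u = cong (λ b → if b then G z u (suc m) (m ∸ suc m) else G-last z u m) (≤ᵇ-false (ℕₚ.n<1+n m))

  Gᵢ-step : ∀ m z u i → i ≤ m →
    (u ⊖ 1#) ⊗ Gᵢ m z u (suc i) ≈ (u ⊖ 1# ⊕ z) ⊗ Gᵢ m z u i ⊖ u ↑ (m ∸ i) ⊗ z ⊗ Gᵢ m z 1# i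
  Gᵢ-step m z u i i≤m with ℕₚ.m≤n⇒m<n∨m≡n i≤m
  ... | inj₂ refl = begin
    (u ⊖ 1#) ⊗ Gᵢ m z u (suc m) ≡⟨ cong ((u ⊖ 1#) ⊗_) (Gᵢ-last m z u) ⟩
    (u ⊖ 1#) ⊗ G-last z u m ≈⟨ G-last-step z u m ⟩
    (u ⊖ 1# ⊕ z) ⊗ G z u m 0 ⊖ z ⊗ G z 1# m 0 ≈⟨ ⊕-cong ≈-refl (⊝-cong (⊗-congʳ _ (⊗-idˡ z))) ⟨
    (u ⊖ 1# ⊕ z) ⊗ G z u m 0 ⊖ 1# ⊗ z ⊗ G z 1# m 0
      ≡⟨ cong (λ d → (u ⊖ 1# ⊕ z) ⊗ G z u m d ⊖ u ↑ d ⊗ z ⊗ G z 1# m d) (ℕₚ.n∸n≡0 m) ⟨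
    (u ⊖ 1# ⊕ z) ⊗ G z u m (m ∸ m) ⊖ u ↑ (m ∸ m) ⊗ z ⊗ G z 1# m (m ∸ m)
      ≡⟨ cong₂ (λ a b → (u ⊖ 1# ⊕ z) ⊗ a ⊖ u ↑ (m ∸ m) ⊗ z ⊗ b) (Gᵢ-small z u i≤m) (Gᵢ-small z 1# i≤m) ⟨
    (u ⊖ 1# ⊕ z) ⊗ Gᵢ m z u m ⊖ u ↑ (m ∸ m) ⊗ z ⊗ Gᵢ m z 1# m ∎
  ... | inj₁ i<m = begin
    (u ⊖ 1#) ⊗ Gᵢ m z u (suc i) ≡⟨ cong ((u ⊖ 1#) ⊗_) (Gᵢ-small z u i<m) ⟩
    (u ⊖ 1#) ⊗ G z u (suc i) n ≈⟨ G-step z u i n ⟩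
    (u ⊖ 1# ⊕ z) ⊗ G z u i (suc n) ⊖ u ↑ suc n ⊗ z ⊗ G z 1# i (suc n)
      ≡⟨ cong (λ d → (u ⊖ 1# ⊕ z) ⊗ G z u i d ⊖ u ↑ d ⊗ z ⊗ G z 1# i d) (sym (ℕₚ.+-∸-assoc 1 i<m)) ⟩
    (u ⊖ 1# ⊕ z) ⊗ G z u i (m ∸ i) ⊖ u ↑ (m ∸ i) ⊗ z ⊗ G z 1# i (m ∸ i)
      ≡⟨ cong₂ (λ a b → (u ⊖ 1# ⊕ z) ⊗ a ⊖ u ↑ (m ∸ i) ⊗ z ⊗ b) (Gᵢ-small z u i≤m) (Gᵢ-small z 1# i≤m) ⟨
    (u ⊖ 1# ⊕ z) ⊗ Gᵢ m z u i ⊖ u ↑ (m ∸ i) ⊗ z ⊗ Gᵢ m z 1# i ∎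
    where
    n = m ∸ suc i

-- With m = a + i, this balances the powers of 1 - Z against those of its inverse when a value at x
-- = 1 is rewritten in `cĈ`.
exponent-identity : ∀ a i → suc (a + i) * (a + i + 2) + a ≡ a * (a + i + 2) + (2 + i) * suc (a + i)
exponent-identity = solve 2 (λ a i →
  (con 1 :+ (a :+ i)) :* (a :+ i :+ con 2) :+ a := a :* (a :+ i :+ con 2) :+ (con 2 :+ i) :* (con 1 :+ (a :+ i))) refl
  where open ℕSolver.+-*-Solver

-- Both sides are the maximum of a and b. This treats the exponent m - i - 1 of either sign at once.
∸-+-swap : ∀ a b → (a ∸ b) + b ≡ (b ∸ a) + a
∸-+-swap zero b = trans (cong (_+ b) (ℕₚ.0∸n≡0 b)) (sym (ℕₚ.+-identityʳ b))
∸-+-swap (suc a) zero = cong suc (ℕₚ.+-identityʳ a)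
∸-+-swap (suc a) (suc b) = trans (ℕₚ.+-suc (a ∸ b) b) (trans (cong suc (∸-+-swap a b)) (sym (ℕₚ.+-suc (b ∸ a) a)))

-- Congruence modulo an element, with quotients in a subring

-- Two instances matter: series of finite degree in x at each order in t, and series constant in x.
record Subring (R : CommutativeRing 0ℓ 0ℓ) : Set₁ where
  open RingKit R
  field
    P : Carrier → Set
    P-resp : ∀ {a b} → a ≈ b → P a → P b
    P-⊕ : ∀ {a b} → P a → P b → P (a ⊕ b)
    P-⊗ : ∀ {a b} → P a → P b → P (a ⊗ b)
    P-⊝ : ∀ {a} → P a → P (⊝ a)
    P-0 : P 0#
    P-1 : P 1#

module Congruence (R : CommutativeRing 0ℓ 0ℓ) (SR : Subring R) (d : RingKit.Carrier R) where

  open RingKit R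
  open Sums R
  open HPolynomials R
  open Subring SR

  infix 4 _~_

  record _~_ (f g : Carrier) : Set where
    constructor congruent
    field
      Pˡ : P f
      Pʳ : P g
      quotient : Carrier
      Pq : P quotient
      eq : f ⊖ g ≈ d ⊗ quotient
  open _~_ public

  ~-refl : ∀ {f} → P f → f ~ f
  ~-refl {f} p = congruent p p 0# P-0 (solve 2 (λ f d → f :- f := d :* :0) ≈-refl f d)

  ~-⊕ : ∀ {f g f′ g′} → f ~ g → f′ ~ g′ → f ⊕ f′ ~ g ⊕ g′
  ~-⊕ {f} {g} {f′} {g′} (congruent p q r s e) (congruent p′ q′ r′ s′ e′) =
    congruent (P-⊕ p p′) (P-⊕ q q′) (r ⊕ r′) (P-⊕ s s′)
      (by₂ 1# 1# e e′ (solve 7 (λ f g f′ g′ d r r′ →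
        (f :+ f′ :- (g :+ g′)) :+ :1 :* (d :* r) :+ :1 :* (d :* r′)
        := d :* (r :+ r′) :+ :1 :* (f :- g) :+ :1 :* (f′ :- g′)) ≈-refl f g f′ g′ d r r′))

  ~-⊗ : ∀ {f g f′ g′} → f ~ g → f′ ~ g′ → f ⊗ f′ ~ g ⊗ g′
  ~-⊗ {f} {g} {f′} {g′} (congruent p q r s e) (congruent p′ q′ r′ s′ e′) =
    congruent (P-⊗ p p′) (P-⊗ q q′) (r ⊗ f′ ⊕ g ⊗ r′) (P-⊕ (P-⊗ s p′) (P-⊗ q s′))
      (by₂ f′ g e e′ (solve 7 (λ f g f′ g′ d r r′ →
        (f :* f′ :- g :* g′) :+ f′ :* (d :* r) :+ g :* (d :* r′)
        := d :* (r :* f′ :+ g :* r′) :+ f′ :* (f :- g) :+ g :* (f′ :- g′)) ≈-refl f g f′ g′ d r r′))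

  ~-⊝ : ∀ {f g} → f ~ g → ⊝ f ~ ⊝ g
  ~-⊝ {f} {g} (congruent p q r s e) =
    congruent (P-⊝ p) (P-⊝ q) (⊝ r) (P-⊝ s)
      (by₁ (⊝ 1#) e (solve 4 (λ f g d r →
        (:- f :- :- g) :+ (:- :1) :* (d :* r) := d :* :- r :+ (:- :1) :* (f :- g)) ≈-refl f g d r))

  ~-↑ : ∀ {f g} e → f ~ g → f ↑ e ~ g ↑ e
  ~-↑ zero h = ~-refl P-1
  ~-↑ (suc e) h = ~-⊗ h (~-↑ e h)

  ~-∑ : ∀ n {f g} → (∀ i → f i ~ g i) → ∑ n f ~ ∑ n g
  ~-∑ zero h = ~-refl P-0
  ~-∑ (suc n) h = ~-⊕ (~-∑ n h) (h n)

  P-ι : ∀ n → P (ι n)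
  P-ι zero = P-0
  P-ι (suc n) = P-resp (≈-sym (ι-suc n)) (P-⊕ P-1 (P-ι n))

  ~-ι : ∀ n → ι n ~ ι n
  ~-ι n = ~-refl (P-ι n)

  ~-Q : ∀ {u w} k c p → u ~ w → Q u k c p ~ Q w k c p
  ~-Q k zero p h = ~-refl P-0
  ~-Q k (suc c) p h = ~-⊕ (~-Q k c (suc p) h) (~-⊗ (~-ι ((c + k) C c)) (~-↑ p h))

  ~-g : ∀ {u w} i n k → u ~ w → g u i n k ~ g w i n k
  ~-g i n zero h = ~-refl P-1
  ~-g i n (suc k) h =
    ~-⊕ (~-⊗ (~-ι (suc i C suc k)) (~-∑ (suc n) (λ e → ~-⊗ (~-ι ((e + suc k ∸ 1) C e)) (~-↑ e h))))
        (~-⊗ (~-ι ((n + k) C k)) (~-Q (suc k) (i ∸ k) (suc n) h))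

  ~-Gᵢ : ∀ {z u w} m i → P z → u ~ w → Gᵢ m z u i ~ Gᵢ m z w i
  ~-Gᵢ m i p h with i ℕ.≤ᵇ m
  ... | true = ~-∑ (suc (suc i)) (λ k → ~-⊗ (~-↑ k (~-⊝ (~-refl p))) (~-g i (m ∸ i) k h))
  ... | false = ~-⊕ (~-refl P-1) (~-⊝ (~-⊗ (~-refl p) (~-∑ (suc m) (λ e → ~-⊗ (~-ι (suc m ∸ e)) (~-↑ e h)))))

-- The claimed series solve the recurrences

module Solution
  (R : CommutativeRing 0ℓ 0ℓ) (SR : Subring R) (m : ℕ) (x Z U : RingKit.Carrier R)
  (Px : Subring.P SR x) (PZ : Subring.P SR Z) (PU : Subring.P SR U)
  -- The abstract form of Z having no constant term in t: only elements 1 - Z r are ever inverted.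
  (invert : ∀ r → Subring.P SR r → ∃ λ v → Subring.P SR v ×
            RingKit._≈_ R (RingKit._⊗_ R (RingKit._⊖_ R (RingKit.1# R) (RingKit._⊗_ R Z r)) v) (RingKit.1# R))
  (U-equation : RingKit._≈_ R (RingKit._⊗_ R x (Sums._↑_ R (RingKit._⊖_ R (RingKit.1# R) Z) (m + 2)))
                  (RingKit._⊗_ R U (RingKit._⊖_ R (RingKit.1# R) (RingKit._⊗_ R Z (Sums.∑ R (suc m) (Sums._↑_ R U))))))
  where

  open RingKit R
  open Sums R
  open HPolynomials R
  open Subring SR

  -- The equation of U reads y = U N, so K = 1/N is U/y. In terms of y and K no division by x is
  -- left.
  W c y N K B : Carrier
  W = 1# ⊖ Z
  c = W ↑ (m + 2)
  y = x ⊗ c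
  N = 1# ⊖ Z ⊗ ∑ (suc m) (U ↑_)

  P-↑ : ∀ {f} e → P f → P (f ↑ e)
  P-↑ zero p = P-1
  P-↑ (suc e) p = P-⊗ p (P-↑ e p)

  P-∑ : ∀ n {f} → (∀ i → P (f i)) → P (∑ n f)
  P-∑ zero p = P-0
  P-∑ (suc n) p = P-⊕ (P-∑ n p) (p n)

  PW : P W
  PW = P-⊕ P-1 (P-⊝ PZ)

  Pc : P c
  Pc = P-↑ (m + 2) PW

  K-inverse = invert (∑ (suc m) (U ↑_)) (P-∑ (suc m) (λ e → P-↑ e PU))
  K = proj₁ K-inverse

  PK : P K
  PK = proj₁ (proj₂ K-inverse)

  NK≈1 : N ⊗ K ≈ 1#
  NK≈1 = proj₂ (proj₂ K-inverse)

  B-inverse = invert 1# P-1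
  B = proj₁ B-inverse

  PB : P B
  PB = proj₁ (proj₂ B-inverse)

  WB≈1 : W ⊗ B ≈ 1#
  WB≈1 = ≈-trans (⊗-congʳ B (⊕-cong ≈-refl (⊝-cong (≈-sym (CommutativeRing.*-identityʳ R Z))))) (proj₂ (proj₂ B-inverse))

  WB↑ : ∀ e → W ↑ e ⊗ B ↑ e ≈ 1#
  WB↑ e = ≈-trans (≈-sym (↑-⊗ W B e)) (≈-trans (↑-cong e WB≈1) (1↑ e))

  W↑B↑ : ∀ p q → W ↑ (p + q) ⊗ B ↑ q ≈ W ↑ p
  W↑B↑ p q = ≈-trans (⊗-congʳ _ (↑-+ W p q))
    (by₁ (W ↑ p) (WB↑ q) (solve 3 (λ a b d → (a :* b :* d) :+ a :* :1 := a :+ a :* (b :* d)) ≈-refl (W ↑ p) (W ↑ q) (B ↑ q)))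

  cB≈1 : c ⊗ B ↑ (m + 2) ≈ 1#
  cB≈1 = WB↑ (m + 2)

  c≈ : W ↑ (2 + m) ≈ c
  c≈ = ≈-reflexive (cong (W ↑_) (ℕₚ.+-comm 2 m))

  U≈yK : U ≈ y ⊗ K
  U≈yK = by₂ (⊝ K) (⊝ U) U-equation NK≈1
    (solve 4 (λ u y k n → u :+ (:- k) :* (u :* n) :+ (:- u) :* :1 := y :* k :+ (:- k) :* y :+ (:- u) :* (n :* k))
      ≈-refl U y K N)

  U↑≈ : ∀ e → U ↑ e ≈ y ↑ e ⊗ K ↑ e
  U↑≈ e = ≈-trans (↑-cong e U≈yK) (↑-⊗ y K e)

  -- As H_i(z;u) = u^{i+1} Gᵢ and U = y K, this is the claimed J̄_i with its powers of x and 1 - Z cancelled.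
  -- Ĉ i is its value at x = 1, where U = 1 - Z and K = B^{m+1}.
  Ĵ Ĉ : ℕ → Carrier
  Ĵ i = Z ⊗ y ↑ m ⊗ K ↑ suc i ⊗ Gᵢ m Z U i
  Ĉ i = Z ⊗ c ↑ m ⊗ (B ↑ suc m) ↑ suc i ⊗ Gᵢ m Z W i

  [U-1]N : (U ⊖ 1#) ⊗ N ≈ U ⊖ 1# ⊕ Z ⊖ Z ⊗ U ↑ suc m
  [U-1]N = by₁ (⊝ Z) (geometric U (suc m))
    (solve 4 (λ u z s p → ((u :- :1) :* (:1 :- z :* s)) :+ (:- z) :* (p :- :1)
       := (u :- :1 :+ z :- z :* p) :+ (:- z) :* ((u :- :1) :* s)) ≈-refl U Z (∑ (suc m) (U ↑_)) (U ↑ suc m))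

  -- The polynomial part of `G-top` at u = U is the right side of the equation of U, hence x c; the
  -- kernel thereby turns into a multiple of x - 1.
  [U-W]Gₘ : (U ⊖ 1# ⊕ Z) ⊗ Gᵢ m Z U m ≈ c ⊗ (x ⊖ 1#)
  [U-W]Gₘ = begin
    (U ⊖ 1# ⊕ Z) ⊗ Gᵢ m Z U m ≡⟨ cong ((U ⊖ 1# ⊕ Z) ⊗_) (Gᵢ-small Z U (ℕₚ.≤-refl {m})) ⟩
    (U ⊖ 1# ⊕ Z) ⊗ G Z U m (m ∸ m) ≡⟨ cong (λ n → (U ⊖ 1# ⊕ Z) ⊗ G Z U m n) (ℕₚ.n∸n≡0 m) ⟩
    (U ⊖ 1# ⊕ Z) ⊗ G Z U m 0 ≈⟨ G-top Z U m ⟩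
    U ⊖ Z ⊗ (U ⊗ ∑ (suc m) (U ↑_)) ⊖ W ↑ (2 + m)
      ≈⟨ by₂ (⊝ 1#) (⊝ 1#) U-equation c≈
           (solve 6 (λ u z s c x w → (u :- z :* (u :* s) :- w) :+ (:- :1) :* (u :* (:1 :- z :* s)) :+ (:- :1) :* c
              := (c :* (x :- :1)) :+ (:- :1) :* (x :* c) :+ (:- :1) :* w) ≈-refl
              U Z (∑ (suc m) (U ↑_)) c x (W ↑ (2 + m))) ⟩
    c ⊗ (x ⊖ 1#) ∎

  -- At u = W the factor u - 1 + Z vanishes, so `Gᵢ-step` expresses the next `Gᵢ` at W by the
  -- previous one at 1. The rest counts powers of W and of its inverse B.
  cĈ : ∀ i → i ≤ m → c ⊗ Ĉ (suc i) ≈ c ↑ (m ∸ i) ⊗ (Z ⊗ Gᵢ m Z 1# i)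
  cĈ i i≤m = begin
    c ⊗ (Z ⊗ c ↑ m ⊗ (B ↑ suc m) ↑ (2 + i) ⊗ Gᵢ m Z W (suc i))
      ≈⟨ by₁ (⊝ (c ⊗ c ↑ m ⊗ b)) (Gᵢ-step m Z W i i≤m)
           (solve 7 (λ z c q b g g₀ r →
             (c :* (z :* q :* b :* g)) :+ (:- (c :* q :* b)) :* ((:1 :- z :- :1 :+ z) :* g₀ :- r)
             := (c :* q :* b :* r) :+ (:- (c :* q :* b)) :* ((:1 :- z :- :1) :* g)) ≈-refl
             Z c (c ↑ m) b (Gᵢ m Z W (suc i)) (Gᵢ m Z W i) (W ↑ a ⊗ Z ⊗ Gᵢ m Z 1# i)) ⟩
    c ⊗ c ↑ m ⊗ b ⊗ (W ↑ a ⊗ Z ⊗ Gᵢ m Z 1# i)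
      ≈⟨ solve 5 (λ p b w z g → p :* b :* (w :* z :* g) := p :* w :* b :* (z :* g)) ≈-refl (c ⊗ c ↑ m) b (W ↑ a) Z (Gᵢ m Z 1# i) ⟩
    c ↑ suc m ⊗ W ↑ a ⊗ b ⊗ (Z ⊗ Gᵢ m Z 1# i)
      ≈⟨ ⊗-congʳ _ (⊗-cong (≈-trans (⊗-congʳ _ (≈-sym (↑-* W (suc m) (m + 2)))) (≈-sym (↑-+ W (suc m * (m + 2)) a)))
                           (≈-sym (↑-* B (2 + i) (suc m)))) ⟩
    W ↑ (suc m * (m + 2) + a) ⊗ B ↑ ((2 + i) * suc m) ⊗ (Z ⊗ Gᵢ m Z 1# i)
      ≡⟨ cong (λ e → W ↑ e ⊗ B ↑ ((2 + i) * suc m) ⊗ (Z ⊗ Gᵢ m Z 1# i)) exponents ⟩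
    W ↑ (a * (m + 2) + (2 + i) * suc m) ⊗ B ↑ ((2 + i) * suc m) ⊗ (Z ⊗ Gᵢ m Z 1# i)
      ≈⟨ ⊗-congʳ _ (≈-trans (W↑B↑ (a * (m + 2)) ((2 + i) * suc m)) (↑-* W a (m + 2))) ⟩
    c ↑ a ⊗ (Z ⊗ Gᵢ m Z 1# i) ∎
    where
    a = m ∸ i
    b = (B ↑ suc m) ↑ (2 + i)
    exponents : suc m * (m + 2) + a ≡ a * (m + 2) + (2 + i) * suc m
    exponents = subst (λ k → suc k * (k + 2) + a ≡ a * (k + 2) + (2 + i) * suc k) (ℕₚ.m∸n+n≡m i≤m) (exponent-identity a i)

  -- `Gᵢ-step` times Z y^m K^{i+1}: writing 1 as N K turns (U - 1) N into U - 1 + Z - Z U^{m+1},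
  -- whose last term yields the product with `Ĵ (suc i)`, while `cĈ` turns the value at u = 1 into
  -- `Ĉ (suc i)`.
  recurrence-cleared : ∀ i → i ≤ m → (U ⊖ 1# ⊕ Z) ⊗ (Ĵ (suc i) ⊖ Ĵ i)
    ≈ Z ⊗ y ↑ m ⊗ K ↑ suc m ⊗ (y ⊗ Ĵ (suc i) ⊖ x ↑ (m ∸ i) ⊗ (c ⊗ Ĉ (suc i)))
  recurrence-cleared i i≤m =
    by₃ (⊝ Ĵ (suc i)) ((U ⊖ 1#) ⊗ (q ⊗ k ⊗ G₁)) (q ⊗ k) [U-1]N NK≈1 (Gᵢ-step m Z U i i≤m)
      (by₂ (Z ⊗ Ĵ (suc i)) q (U↑≈ (suc m)) KxĈ
        (solve 15 (λ u z ym k′ k K N y xa cC G₁ G₀ g₁ Ua P →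
          let q = z :* ym ; J₁ = z :* ym :* (K :* k) :* G₁ ; J₀ = z :* ym :* k :* G₀ ; X = u :- :1 :+ z in
          (X :* (J₁ :- J₀)) :+ (:- J₁) :* (X :- z :* P) :+ ((u :- :1) :* (q :* k :* G₁)) :* :1
            :+ (q :* k) :* (X :* G₀ :- Ua :* z :* g₁)
            :+ (z :* J₁) :* (y :* ym :* k′) :+ q :* (k :* (Ua :* (z :* g₁)))
          := (z :* ym :* k′ :* (y :* J₁ :- xa :* cC)) :+ (:- J₁) :* ((u :- :1) :* N) :+ ((u :- :1) :* (q :* k :* G₁)) :* (N :* K)
            :+ (q :* k) :* ((u :- :1) :* G₁)
            :+ (z :* J₁) :* P :+ q :* (k′ :* (xa :* cC))) ≈-refl
          U Z (y ↑ m) (K ↑ suc m) k K N y (x ↑ a) (c ⊗ Ĉ (suc i)) G₁ (Gᵢ m Z U i) (Gᵢ m Z 1# i) (U ↑ a) (U ↑ suc m)))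
    where
    a = m ∸ i
    q = Z ⊗ y ↑ m
    k = K ↑ suc i
    G₁ = Gᵢ m Z U (suc i)
    KxĈ : K ↑ suc m ⊗ (x ↑ a ⊗ (c ⊗ Ĉ (suc i))) ≈ k ⊗ (U ↑ a ⊗ (Z ⊗ Gᵢ m Z 1# i))
    KxĈ = begin
      K ↑ suc m ⊗ (x ↑ a ⊗ (c ⊗ Ĉ (suc i)))
        ≈⟨ ⊗-cong (≈-reflexive (cong (K ↑_) (sym (trans (ℕₚ.+-suc a i) (cong suc (ℕₚ.m∸n+n≡m i≤m))))))
                  (⊗-congˡ _ (cĈ i i≤m)) ⟩
      K ↑ (a + suc i) ⊗ (x ↑ a ⊗ (c ↑ a ⊗ (Z ⊗ Gᵢ m Z 1# i)))
        ≈⟨ ⊗-cong (↑-+ K a (suc i)) (≈-trans (≈-sym (⊗-assoc _ _ _)) (⊗-congʳ _ (≈-sym (↑-⊗ x c a)))) ⟩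
      K ↑ a ⊗ k ⊗ (y ↑ a ⊗ (Z ⊗ Gᵢ m Z 1# i))
        ≈⟨ solve 4 (λ b k d e → b :* k :* (d :* e) := k :* (d :* b :* e)) ≈-refl (K ↑ a) k (y ↑ a) (Z ⊗ Gᵢ m Z 1# i) ⟩
      k ⊗ (y ↑ a ⊗ K ↑ a ⊗ (Z ⊗ Gᵢ m Z 1# i))
        ≈⟨ ⊗-congˡ k (⊗-congʳ _ (U↑≈ a)) ⟨
      k ⊗ (U ↑ a ⊗ (Z ⊗ Gᵢ m Z 1# i)) ∎

  -- Multiplication by `Gₘ` trades the kernel U - 1 + Z for c (x - 1) and completes the prefactor to
  -- `Ĵ m`; then c is cancelled by its inverse.
  recurrence : ∀ i → i ≤ m → (x ⊖ 1#) ⊗ (Ĵ (suc i) ⊖ Ĵ i) ≈ Ĵ m ⊗ (x ⊗ Ĵ (suc i) ⊖ x ↑ (m ∸ i) ⊗ Ĉ (suc i))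
  recurrence i i≤m =
    by₃ (⊝ (v ⊗ (J₁ ⊖ J₀))) (v ⊗ Gₘ) (⊝ ((x ⊖ 1#) ⊗ (J₁ ⊖ J₀) ⊖ Ĵ m ⊗ (x ⊗ J₁ ⊖ x ↑ a ⊗ C₁)))
      [U-W]Gₘ (recurrence-cleared i i≤m) cB≈1
      (solve 12 (λ x c z ym k′ J₁ J₀ Gm v xa C₁ X →
        let D = J₁ :- J₀ ; l = (x :- :1) :* D ; r = z :* ym :* k′ :* Gm :* (x :* J₁ :- xa :* C₁) in
        l :+ (:- (v :* D)) :* (c :* (x :- :1)) :+ (v :* Gm) :* (z :* ym :* k′ :* (x :* c :* J₁ :- xa :* (c :* C₁)))
          :+ (:- (l :- r)) :* :1
        := r :+ (:- (v :* D)) :* (X :* Gm) :+ (v :* Gm) :* (X :* D) :+ (:- (l :- r)) :* (c :* v)) ≈-refl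
        x c Z (y ↑ m) (K ↑ suc m) J₁ J₀ Gₘ v (x ↑ a) C₁ (U ⊖ 1# ⊕ Z))
    where
    a = m ∸ i
    J₁ = Ĵ (suc i)
    J₀ = Ĵ i
    C₁ = Ĉ (suc i)
    Gₘ = Gᵢ m Z U m
    v = B ↑ (m + 2)

  Ĵₘ-formula : x ⊗ (U ⊖ 1# ⊕ Z) ⊗ Ĵ m ≈ (x ⊖ 1#) ⊗ Z ⊗ U ↑ suc m
  Ĵₘ-formula =
    by₂ (x ⊗ (Z ⊗ y ↑ m ⊗ K ↑ suc m)) (⊝ ((x ⊖ 1#) ⊗ Z)) [U-W]Gₘ (U↑≈ (suc m))
      (solve 8 (λ x c z ym k′ Gm X P →
        (x :* X :* (z :* ym :* k′ :* Gm)) :+ (x :* (z :* ym :* k′)) :* (c :* (x :- :1)) :+ (:- ((x :- :1) :* z)) :* (x :* c :* ym :* k′)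
        := ((x :- :1) :* z :* P) :+ (x :* (z :* ym :* k′)) :* (X :* Gm) :+ (:- ((x :- :1) :* z)) :* P) ≈-refl
        x c Z (y ↑ m) (K ↑ suc m) (Gᵢ m Z U m) (U ⊖ 1# ⊕ Z) (U ↑ suc m))

  y↑≈ : ∀ e → x ↑ e ⊗ W ↑ ((m + 2) * e) ≈ y ↑ e
  y↑≈ e = ≈-trans (⊗-congˡ _ (≈-trans (≈-reflexive (cong (W ↑_) (ℕₚ.*-comm (m + 2) e))) (↑-* W e (m + 2))))
                  (≈-sym (↑-⊗ x c e))

  -- `m ∸ suc i` and `suc i ∸ m` are the positive and negative parts of the exponent m - i - 1; each
  -- stands on its own side instead of a division.
  Ĵ-formula : ∀ i → x ↑ (suc i ∸ m) ⊗ W ↑ ((m + 2) * (suc i ∸ m)) ⊗ Ĵ i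
                    ≈ x ↑ (m ∸ suc i) ⊗ W ↑ ((m + 2) * (m ∸ suc i)) ⊗ Z ⊗ (U ↑ suc i ⊗ Gᵢ m Z U i)
  Ĵ-formula i = begin
    x ↑ (suc i ∸ m) ⊗ W ↑ ((m + 2) * (suc i ∸ m)) ⊗ Ĵ i ≈⟨ ⊗-congʳ _ (y↑≈ (suc i ∸ m)) ⟩
    y ↑ (suc i ∸ m) ⊗ (Z ⊗ y ↑ m ⊗ K ↑ suc i ⊗ g₀)
      ≈⟨ solve 5 (λ a b z k g → a :* (z :* b :* k :* g) := a :* b :* (z :* k :* g)) ≈-refl
           (y ↑ (suc i ∸ m)) (y ↑ m) Z (K ↑ suc i) g₀ ⟩
    y ↑ (suc i ∸ m) ⊗ y ↑ m ⊗ (Z ⊗ K ↑ suc i ⊗ g₀)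
      ≈⟨ ⊗-congʳ _ (≈-trans (≈-sym (↑-+ y (suc i ∸ m) m)) (≈-trans (≈-reflexive (cong (y ↑_) (∸-+-swap (suc i) m))) (↑-+ y (m ∸ suc i) (suc i)))) ⟩
    y ↑ (m ∸ suc i) ⊗ y ↑ suc i ⊗ (Z ⊗ K ↑ suc i ⊗ g₀)
      ≈⟨ solve 5 (λ a b z k g → a :* b :* (z :* k :* g) := a :* z :* (b :* k :* g)) ≈-refl
           (y ↑ (m ∸ suc i)) (y ↑ suc i) Z (K ↑ suc i) g₀ ⟩
    y ↑ (m ∸ suc i) ⊗ Z ⊗ (y ↑ suc i ⊗ K ↑ suc i ⊗ g₀)
      ≈⟨ ⊗-cong (⊗-congʳ Z (y↑≈ (m ∸ suc i))) (⊗-congʳ g₀ (U↑≈ (suc i))) ⟨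
    x ↑ (m ∸ suc i) ⊗ W ↑ ((m + 2) * (m ∸ suc i)) ⊗ Z ⊗ (U ↑ suc i ⊗ g₀) ∎
    where
    g₀ = Gᵢ m Z U i

  Ĉ-last : (1# ⊕ Ĉ (suc m)) ⊗ c ≈ 1# ⊖ ι (suc m) ⊗ Z
  Ĉ-last = by₃ 1# 1# (⊝ 1#) cĈₘ (G-top-at-1 Z m) c≈
    (solve 6 (λ c C z g i w → ((:1 :+ C) :* c) :+ :1 :* (z :* g) :+ :1 :* (:1 :- z :* i :- w) :+ (:- :1) :* c
      := (:1 :- i :* z) :+ :1 :* (c :* C) :+ :1 :* (z :* g) :+ (:- :1) :* w) ≈-refl
      c (Ĉ (suc m)) Z (G Z 1# m 0) (ι (suc m)) (W ↑ (2 + m)))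
    where
    cĈₘ : c ⊗ Ĉ (suc m) ≈ Z ⊗ G Z 1# m 0
    cĈₘ = ≈-trans (cĈ m ℕₚ.≤-refl) (≈-trans (⊗-cong (≈-reflexive (cong (c ↑_) (ℕₚ.n∸n≡0 m)))
      (⊗-congˡ Z (≈-reflexive (trans (Gᵢ-small Z 1# (ℕₚ.≤-refl {m})) (cong (G Z 1# m) (ℕₚ.n∸n≡0 m)))))) (⊗-idˡ _))

  -- This is `Ĉ-last` divided by c = W^{m+2}, with Z written as 1 - W and W B = 1.
  Ĉ-last-B : 1# ⊕ Ĉ (suc m) ≈ ι (suc m) ⊗ B ↑ suc m ⊖ ι m ⊗ B ↑ (2 + m)
  Ĉ-last-B =
    by₃ (⊝ X) (B ⊗ s) (i ⊗ s) cBs≈1 Ĉ-last WB≈1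
      (by₁ (⊝ (B ⊗ s)) (ι-suc m)
        (solve 7 (λ X c z b s i j →
          X :+ (:- X) :* :1 :+ (b :* s) :* (:1 :- i :* z) :+ (i :* s) :* :1 :+ (:- (b :* s)) :* (:1 :+ j)
          := (i :* s :- j :* (b :* s)) :+ (:- X) :* (c :* (b :* s)) :+ (b :* s) :* (X :* c) :+ (i :* s) :* ((:1 :- z) :* b)
             :+ (:- (b :* s)) :* i) ≈-refl X c Z B s i (ι m)))
    where
    X = 1# ⊕ Ĉ (suc m)
    s = B ↑ suc m
    i = ι (suc m)
    cBs≈1 : c ⊗ (B ⊗ s) ≈ 1#
    cBs≈1 = ≈-trans (⊗-congˡ c (≈-reflexive (cong (B ↑_) (ℕₚ.+-comm 2 m)))) cB≈1

  -- For i = 0 the polynomial `Gᵢ` is N itself, the inverse of K.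
  Ĵ₀ : Ĵ 0 ≈ Z ⊗ y ↑ m
  Ĵ₀ = begin
    Z ⊗ y ↑ m ⊗ (K ⊗ 1#) ⊗ Gᵢ m Z U 0 ≈⟨ ⊗-congˡ _ (≈-reflexive (Gᵢ-small {m} Z U z≤n)) ⟩
    Z ⊗ y ↑ m ⊗ (K ⊗ 1#) ⊗ (0# ⊕ 1# ⊗ 1# ⊕ ⊝ Z ⊗ 1# ⊗ (1# ⊗ S U 1 (suc m) ⊕ 1# ⊗ 0#))
      ≈⟨ by₂ (⊝ (Z ⊗ y ↑ m ⊗ K ⊗ Z)) (Z ⊗ y ↑ m) (S₁ (suc m)) NK≈1
           (solve 5 (λ z ym k s s′ →
             (z :* ym :* (k :* :1) :* (:0 :+ :1 :* :1 :+ :- z :* :1 :* (:1 :* s :+ :1 :* :0)))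
               :+ (:- (z :* ym :* k :* z)) :* s′ :+ (z :* ym) :* :1
             := z :* ym :+ (:- (z :* ym :* k :* z)) :* s :+ (z :* ym) :* ((:1 :- z :* s′) :* k)) ≈-refl
             Z (y ↑ m) K (S U 1 (suc m)) (∑ (suc m) (U ↑_))) ⟩
    Z ⊗ y ↑ m ∎
    where
    S₁ : ∀ n → S U 1 n ≈ ∑ n (U ↑_)
    S₁ n = ∑-cong n (λ e _ → ≈-trans (⊗-congʳ _ (ι-cong (trans (cong (_C e) (ℕₚ.m+n∸n≡m e 1)) (nCn≡1 e)))) (⊗-idˡ _))

  open Congruence R SR (x ⊖ 1#) using (_~_; congruent; ~-refl; ~-⊕; ~-⊝; ~-⊗; ~-↑; ~-∑; ~-Gᵢ; quotient; Pq; eq)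

  -- Let F(u) = u (1 - Z (1 + ... + u^m)). Then F(U) = x c and F(W) = c, while F(U) - F(W) = (U -
  -- W)(1 - Z r); with v inverse to 1 - Z r this gives U - W = (x - 1) c v.
  U~W : U ~ W
  U~W = congruent PU PW (c ⊗ v) (P-⊗ Pc (proj₁ (proj₂ v-inverse)))
    (by₃ (⊝ (U ⊖ W)) (Z ⊗ v) (⊝ v) (proj₂ (proj₂ v-inverse)) (eq′ F~) U-equation
      (by₁ v c-expanded
        (solve 9 (λ x c z v u w s s′ r →
          (u :- w) :+ (:- (u :- w)) :* :1 :+ (z :* v) :* ((u :- w) :* r) :+ (:- v) :* (u :* (:1 :- z :* s)) :+ v :* (w :- z :* (w :* s′))
          := ((x :- :1) :* (c :* v)) :+ (:- (u :- w)) :* ((:1 :- z :* r) :* v) :+ (z :* v) :* (u :* s :- w :* s′)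
             :+ (:- v) :* (x :* c) :+ v :* c) ≈-refl x c Z v U W (∑ (suc m) (U ↑_)) (∑ (suc m) (W ↑_)) (quotient′ F~))))
    where
    -- Congruence modulo U - W supplies the divided difference r together with its membership in the
    -- subring.
    open Congruence R SR (U ⊖ W) using () renaming
      (_~_ to _~′_; congruent to congruent′; ~-⊗ to ~′-⊗; ~-↑ to ~′-↑; ~-∑ to ~′-∑; quotient to quotient′; Pq to Pq′; eq to eq′)
    U~′W : U ~′ W
    U~′W = congruent′ PU PW 1# P-1 (≈-sym (CommutativeRing.*-identityʳ R (U ⊖ W)))
    F~ : U ⊗ ∑ (suc m) (U ↑_) ~′ W ⊗ ∑ (suc m) (W ↑_)
    F~ = ~′-⊗ U~′W (~′-∑ (suc m) (λ e → ~′-↑ e U~′W))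
    v-inverse = invert (quotient′ F~) (Pq′ F~)
    v = proj₁ v-inverse
    c-expanded : c ≈ W ⊖ Z ⊗ (W ⊗ ∑ (suc m) (W ↑_))
    c-expanded = by₂ (⊝ 1#) (⊝ W) c≈ (geometric W (suc m))
      (solve 4 (λ c z s p → let w = :1 :- z in
        c :+ (:- :1) :* c :+ (:- w) :* (p :- :1) := (w :- z :* (w :* s)) :+ (:- :1) :* (w :* p) :+ (:- w) :* ((w :- :1) :* s))
        ≈-refl c Z (∑ (suc m) (W ↑_)) (W ↑ suc m))

  -- With W in place of U the geometric sum turns N into W^{m+1}, whose inverse is B^{m+1}; the
  -- difference of two inverses is a multiple of the difference of the elements.
  K~B : K ~ B ↑ suc m
  K~B = congruent PK (P-↑ (suc m) PB) (⊝ (K ⊗ s ⊗ quotient N~)) (P-⊝ (P-⊗ (P-⊗ PK (P-↑ (suc m) PB)) (Pq N~)))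
    (by₂ (⊝ (K ⊗ s)) s (eq N~) NK≈1
      (by₂ (⊝ (K ⊗ s)) (⊝ K) (geometric W (suc m)) (WB↑ (suc m))
        (solve 8 (λ x k s z n σ r p →
          (k :- s) :+ (:- (k :* s)) :* ((x :- :1) :* r) :+ s :* :1 :+ (:- (k :* s)) :* (p :- :1) :+ (:- k) :* :1
          := ((x :- :1) :* (:- (k :* s :* r))) :+ (:- (k :* s)) :* (n :- (:1 :- z :* σ)) :+ s :* (n :* k)
             :+ (:- (k :* s)) :* ((:1 :- z :- :1) :* σ) :+ (:- k) :* (p :* s)) ≈-refl
          x K s Z N (∑ (suc m) (W ↑_)) (quotient N~) (W ↑ suc m))))
    where
    s = B ↑ suc m
    N~ : N ~ 1# ⊖ Z ⊗ ∑ (suc m) (W ↑_)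
    N~ = ~-⊕ (~-refl P-1) (~-⊝ (~-⊗ (~-refl PZ) (~-∑ (suc m) (λ e → ~-↑ e U~W))))

  y~c : y ~ c
  y~c = congruent (P-⊗ Px Pc) Pc c Pc (solve 2 (λ x c → x :* c :- c := (x :- :1) :* c) ≈-refl x c)

  Ĵ~Ĉ : ∀ i → Ĵ i ~ Ĉ i
  Ĵ~Ĉ i = ~-⊗ (~-⊗ (~-⊗ (~-refl PZ) (~-↑ m y~c)) (~-↑ (suc i) K~B)) (~-Gᵢ m i PZ U~W)

-- Formal power series

module PowerSeries (R : CommutativeRing 0ℓ 0ℓ) where

  open RingKit R
  open Sums R

  conv : (ℕ → Carrier) → (ℕ → Carrier) → ℕ → Carrier
  conv f g n = ∑ (suc n) (λ a → f a ⊗ g (n ∸ a))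

  tail : (ℕ → Carrier) → ℕ → Carrier
  tail f n = f (suc n)

  one : ℕ → Carrier
  one zero = 1#
  one (suc n) = 0#

  conv-head : ∀ f g n → conv f g (suc n) ≈ f 0 ⊗ g (suc n) ⊕ conv (tail f) g n
  conv-head f g n = ∑-head (suc n) (λ a → f a ⊗ g (suc n ∸ a))

  conv-last : ∀ f g n → conv f g (suc n) ≈ conv f (tail g) n ⊕ f (suc n) ⊗ g 0
  conv-last f g n = ⊕-cong
    (∑-cong (suc n) (λ a a<1+n → ⊗-congˡ (f a) (≈-reflexive (cong g (ℕₚ.+-∸-assoc 1 (ℕ.s≤s⁻¹ a<1+n))))))
    (⊗-congˡ _ (≈-reflexive (cong g (ℕₚ.n∸n≡0 n))))

  conv-cong : ∀ {f f′ g g′} → (∀ n → f n ≈ f′ n) → (∀ n → g n ≈ g′ n) → ∀ n → conv f g n ≈ conv f′ g′ n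
  conv-cong hf hg n = ∑-cong (suc n) (λ a _ → ⊗-cong (hf a) (hg (n ∸ a)))

  conv-comm : ∀ f g n → conv f g n ≈ conv g f n
  conv-comm f g zero = ⊕-cong ≈-refl (⊗-comm _ _)
  conv-comm f g (suc n) = begin
    conv f g (suc n) ≈⟨ conv-head f g n ⟩
    f 0 ⊗ g (suc n) ⊕ conv (tail f) g n ≈⟨ ⊕-cong (⊗-comm _ _) (conv-comm (tail f) g n) ⟩
    g (suc n) ⊗ f 0 ⊕ conv g (tail f) n ≈⟨ ⊕-comm _ _ ⟩
    conv g (tail f) n ⊕ g (suc n) ⊗ f 0 ≈⟨ conv-last g f n ⟨
    conv g f (suc n) ∎

  conv-distribʳ : ∀ h f g n → conv (λ j → f j ⊕ g j) h n ≈ conv f h n ⊕ conv g h n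
  conv-distribʳ h f g n = ≈-trans (∑-cong (suc n) (λ a _ → ⊗-distribʳ _ _ _)) (∑-⊕ (suc n) _ _)

  conv-scale : ∀ c f g n → conv (λ j → c ⊗ f j) g n ≈ c ⊗ conv f g n
  conv-scale c f g n = ≈-trans (∑-cong (suc n) (λ a _ → ⊗-assoc _ _ _)) (∑-⊗ (suc n) c _)

  conv-zero : ∀ g n → conv (λ _ → 0#) g n ≈ 0#
  conv-zero g n = ≈-trans (∑-cong (suc n) (λ a _ → ≈-trans (⊗-zeroˡ _) (≈-sym (⊗-zeroˡ 0#))))
    (≈-trans (∑-⊗ (suc n) 0# (λ _ → 0#)) (⊗-zeroˡ _))

  conv-one : ∀ f n → conv one f n ≈ f n
  conv-one f zero = ≈-trans (⊕-idˡ _) (⊗-idˡ _)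
  conv-one f (suc n) = ≈-trans (conv-head one f n)
    (≈-trans (⊕-cong (⊗-idˡ _) (conv-zero f n)) (⊕-idʳ _))

  -- Induction on the order by splitting off heads: the tail of a product is the head of f times the
  -- tail of g, plus the tail of f times g.
  conv-assoc : ∀ f g h n → conv (conv f g) h n ≈ conv f (conv g h) n
  conv-assoc f g h zero =
    solve 3 (λ f g h → :0 :+ (:0 :+ f :* g) :* h := :0 :+ f :* (:0 :+ g :* h)) ≈-refl (f 0) (g 0) (h 0)
  conv-assoc f g h (suc n) = begin
    conv (conv f g) h (suc n) ≈⟨ conv-head (conv f g) h n ⟩
    (0# ⊕ f 0 ⊗ g 0) ⊗ h (suc n) ⊕ conv (tail (conv f g)) h n
      ≈⟨ ⊕-cong ≈-refl (≈-trans (conv-cong {g = h} (conv-head f g) (λ _ → ≈-refl) n) (conv-distribʳ h _ _ n)) ⟩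
    (0# ⊕ f 0 ⊗ g 0) ⊗ h (suc n) ⊕ (conv (λ j → f 0 ⊗ tail g j) h n ⊕ conv (conv (tail f) g) h n)
      ≈⟨ ⊕-cong ≈-refl (⊕-cong (conv-scale (f 0) (tail g) h n) (conv-assoc (tail f) g h n)) ⟩
    (0# ⊕ f 0 ⊗ g 0) ⊗ h (suc n) ⊕ (f 0 ⊗ conv (tail g) h n ⊕ conv (tail f) (conv g h) n)
      ≈⟨ solve 5 (λ f g h p q → (:0 :+ f :* g) :* h :+ (f :* p :+ q) := f :* (g :* h :+ p) :+ q) ≈-refl
           (f 0) (g 0) (h (suc n)) (conv (tail g) h n) (conv (tail f) (conv g h) n) ⟩
    f 0 ⊗ (g 0 ⊗ h (suc n) ⊕ conv (tail g) h n) ⊕ conv (tail f) (conv g h) n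
      ≈⟨ ⊕-cong (⊗-congˡ (f 0) (conv-head g h n)) ≈-refl ⟨
    f 0 ⊗ conv g h (suc n) ⊕ conv (tail f) (conv g h) n ≈⟨ conv-head f (conv g h) n ⟨
    conv f (conv g h) (suc n) ∎

  conv-distribˡ : ∀ h f g n → conv h (λ j → f j ⊕ g j) n ≈ conv h f n ⊕ conv h g n
  conv-distribˡ h f g n = ≈-trans (∑-cong (suc n) (λ a _ → ⊗-distribˡ _ _ _)) (∑-⊕ (suc n) _ _)

  powerSeriesRing : CommutativeRing 0ℓ 0ℓ
  powerSeriesRing = record
    { Carrier = ℕ → Carrier
    ; _≈_ = λ f g → ∀ n → f n ≈ g n
    ; _+_ = λ f g n → f n ⊕ g n
    ; _*_ = conv
    ; -_ = λ f n → ⊝ f n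
    ; 0# = λ _ → 0#
    ; 1# = one
    ; isCommutativeRing = record
      { isRing = record
        { +-isAbelianGroup = record
          { isGroup = record
            { isMonoid = record
              { isSemigroup = record
                { isMagma = record
                  { isEquivalence = record
                    { refl = λ _ → ≈-refl ; sym = λ h n → ≈-sym (h n) ; trans = λ h h′ n → ≈-trans (h n) (h′ n) }
                  ; ∙-cong = λ h h′ n → ⊕-cong (h n) (h′ n) }
                ; assoc = λ f g h n → ⊕-assoc _ _ _ }
              ; identity = (λ f n → ⊕-idˡ _) , (λ f n → ⊕-idʳ _) }
            ; inverse = (λ f n → CommutativeRing.-‿inverseˡ R _) , (λ f n → CommutativeRing.-‿inverseʳ R _)
            ; ⁻¹-cong = λ h n → ⊝-cong (h n) }
          ; comm = λ f g n → ⊕-comm _ _ }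
        ; *-cong = conv-cong
        ; *-assoc = conv-assoc
        ; *-identity = conv-one , (λ f n → ≈-trans (conv-comm f one n) (conv-one f n))
        ; distrib = conv-distribˡ , conv-distribʳ }
      ; *-comm = conv-comm } }

private
  module Qx = PowerSeries ℚₚ.+-*-commutativeRing
  module Qxt = PowerSeries Qx.powerSeriesRing
  module ∑ℚ = Sums ℚₚ.+-*-commutativeRing
  module ∑x = Sums Qx.powerSeriesRing

  ∑≡sumBelow : ∀ n {f g : ℕ → ℚ} → (∀ i → f i ≡ g i) → ∑ℚ.∑ n f ≡ sumBelow n g
  ∑≡sumBelow zero h = refl
  ∑≡sumBelow (suc n) h = cong₂ ℚ._+_ (∑≡sumBelow n h) (h n)

  ∑x≡ : ∀ n (f : ℕ → ℕ → ℚ) k → ∑x.∑ n f k ≡ ∑ℚ.∑ n (λ a → f a k)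
  ∑x≡ zero f k = refl
  ∑x≡ (suc n) f k = cong (ℚ._+ f n k) (∑x≡ n f k)

  -- The double sum is the product of power series in t over power series in x, so the ring axioms
  -- can be carried over from the iterated construction.
  conv≈*S : ∀ f g → Qxt.conv f g ≈S f *S g
  conv≈*S f g n k = trans (∑x≡ (suc n) (λ a → Qx.conv (f a) (g (n ∸ a))) k)
    (∑≡sumBelow (suc n) (λ a → ∑≡sumBelow (suc k) (λ b → refl)))

  one≈1S : Qxt.one ≈S 1S
  one≈1S zero zero = refl
  one≈1S zero (suc k) = refl
  one≈1S (suc n) zero = refl
  one≈1S (suc n) (suc k) = refl

infix 4 _≋_

-- A record, so that both series can be inferred from the type of a proof; `_≈S_` unfolds to
-- equations between coefficients.
record _≋_ (f g : Series) : Set where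
  constructor ≋-mk
  field coeff : f ≈S g
open _≋_ public

seriesRing : CommutativeRing 0ℓ 0ℓ
seriesRing = record
  { Carrier = Series
  ; _≈_ = _≋_
  ; _+_ = _+S_
  ; _*_ = _*S_
  ; -_ = -S_
  ; 0# = 0S
  ; 1# = 1S
  ; isCommutativeRing = record
    { isRing = record
      { +-isAbelianGroup = record
        { isGroup = record
          { isMonoid = record
            { isSemigroup = record
              { isMagma = record
                { isEquivalence = record
                  { refl = ≋-mk λ n k → refl
                  ; sym = λ h → ≋-mk λ n k → sym (coeff h n k)
                  ; trans = λ h h′ → ≋-mk λ n k → trans (coeff h n k) (coeff h′ n k) }
                ; ∙-cong = λ h h′ → ≋-mk λ n k → cong₂ ℚ._+_ (coeff h n k) (coeff h′ n k) }
              ; assoc = λ f g h → ≋-mk λ n k → ℚₚ.+-assoc (f n k) (g n k) (h n k) }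
            ; identity = (λ f → ≋-mk λ n k → ℚₚ.+-identityˡ (f n k)) , (λ f → ≋-mk λ n k → ℚₚ.+-identityʳ (f n k)) }
          ; inverse = (λ f → ≋-mk λ n k → ℚₚ.+-inverseˡ (f n k)) , (λ f → ≋-mk λ n k → ℚₚ.+-inverseʳ (f n k))
          ; ⁻¹-cong = λ h → ≋-mk λ n k → cong ℚ.-_ (coeff h n k) }
        ; comm = λ f g → ≋-mk λ n k → ℚₚ.+-comm (f n k) (g n k) }
      ; *-cong = λ {f} {f′} {g} {g′} h h′ → cong′ h h′
      ; *-assoc = λ f g h → ≋-mk λ n k → begin
          ((f *S g) *S h) n k ≡⟨ conv≈*S (f *S g) h n k ⟨
          P.conv (f *S g) h n k ≡⟨ P.conv-cong {f *S g} {P.conv f g} {h} {h} (λ i j → sym (conv≈*S f g i j)) (λ i j → refl) n k ⟩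
          P.conv (P.conv f g) h n k ≡⟨ P.conv-assoc f g h n k ⟩
          P.conv f (P.conv g h) n k ≡⟨ P.conv-cong {f} {f} {P.conv g h} {g *S h} (λ i j → refl) (conv≈*S g h) n k ⟩
          P.conv f (g *S h) n k ≡⟨ conv≈*S f (g *S h) n k ⟩
          (f *S (g *S h)) n k ∎
      ; *-identity = idˡ , (λ f → ≋-mk λ n k → trans (coeff (comm′ f 1S) n k) (coeff (idˡ f) n k))
      ; distrib = (λ f g h → ≋-mk λ n k → begin
            (f *S (g +S h)) n k ≡⟨ conv≈*S f (g +S h) n k ⟨
            P.conv f (g +S h) n k ≡⟨ P.conv-distribˡ f g h n k ⟩
            P.conv f g n k ℚ.+ P.conv f h n k ≡⟨ cong₂ ℚ._+_ (conv≈*S f g n k) (conv≈*S f h n k) ⟩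
            (f *S g +S f *S h) n k ∎)
        , (λ f g h → ≋-mk λ n k → begin
            ((g +S h) *S f) n k ≡⟨ conv≈*S (g +S h) f n k ⟨
            P.conv (g +S h) f n k ≡⟨ P.conv-distribʳ f g h n k ⟩
            P.conv g f n k ℚ.+ P.conv h f n k ≡⟨ cong₂ ℚ._+_ (conv≈*S g f n k) (conv≈*S h f n k) ⟩
            (g *S f +S h *S f) n k ∎) }
    ; *-comm = comm′ } }
  where
  open ≡.≡-Reasoning
  module P = PowerSeries Qx.powerSeriesRing
  cong′ : ∀ {f f′ g g′} → f ≋ f′ → g ≋ g′ → f *S g ≋ f′ *S g′
  cong′ {f} {f′} {g} {g′} h h′ = ≋-mk λ n k → begin
    (f *S g) n k ≡⟨ conv≈*S f g n k ⟨
    P.conv f g n k ≡⟨ P.conv-cong {f} {f′} {g} {g′} (coeff h) (coeff h′) n k ⟩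
    P.conv f′ g′ n k ≡⟨ conv≈*S f′ g′ n k ⟩
    (f′ *S g′) n k ∎
  comm′ : ∀ f g → f *S g ≋ g *S f
  comm′ f g = ≋-mk λ n k → trans (sym (conv≈*S f g n k)) (trans (P.conv-comm f g n k) (conv≈*S g f n k))
  idˡ : ∀ f → 1S *S f ≋ f
  idˡ f = ≋-mk λ n k → begin
    (1S *S f) n k ≡⟨ conv≈*S 1S f n k ⟨
    P.conv 1S f n k ≡⟨ P.conv-cong {1S} {P.one} {f} {f} (λ i j → sym (one≈1S i j)) (λ i j → refl) n k ⟩
    P.conv P.one f n k ≡⟨ P.conv-one f n k ⟩
    f n k ∎

*-zero₁ : ∀ p q → p ≡ 0ℚ → p ℚ.* q ≡ 0ℚ
*-zero₁ p q h = trans (cong (ℚ._* q) h) (ℚₚ.*-zeroˡ q)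

*-zero₂ : ∀ p q → q ≡ 0ℚ → p ℚ.* q ≡ 0ℚ
*-zero₂ p q h = trans (cong (p ℚ.*_) h) (ℚₚ.*-zeroʳ p)

sumBelow-cong : ∀ n {f g} → (∀ i → i < n → f i ≡ g i) → sumBelow n f ≡ sumBelow n g
sumBelow-cong zero h = refl
sumBelow-cong (suc n) h = cong₂ ℚ._+_ (sumBelow-cong n (λ i i<n → h i (ℕₚ.m≤n⇒m≤1+n i<n))) (h n ℕₚ.≤-refl)

sumBelow-zero : ∀ n {f} → (∀ i → i < n → f i ≡ 0ℚ) → sumBelow n f ≡ 0ℚ
sumBelow-zero zero h = refl
sumBelow-zero (suc n) h = cong₂ ℚ._+_ (sumBelow-zero n (λ i i<n → h i (ℕₚ.m≤n⇒m≤1+n i<n))) (h n ℕₚ.≤-refl)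

sumBelow-head : ∀ n f → sumBelow (suc n) f ≡ f 0 ℚ.+ sumBelow n (λ i → f (suc i))
sumBelow-head zero f = ℚₚ.+-comm 0ℚ (f 0)
sumBelow-head (suc n) f = trans (cong (ℚ._+ f (suc n)) (sumBelow-head n f)) (ℚₚ.+-assoc (f 0) _ _)

module 𝕊 = RingKit seriesRing
module 𝕊∑ = Sums seriesRing
open 𝕊∑ using (_↑_) public

x-shift₀ : ∀ f n → (xS *S f) n 0 ≡ 0ℚ
x-shift₀ f n = sumBelow-zero (suc n) λ { zero _ → cong (0ℚ ℚ.+_) (ℚₚ.*-zeroˡ (f n 0))
                                       ; (suc a) _ → cong (0ℚ ℚ.+_) (ℚₚ.*-zeroˡ (f (n ∸ suc a) 0)) }

x-shift : ∀ f n k → (xS *S f) n (suc k) ≡ f n k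
x-shift f n k = begin
  sumTo n (λ a → row a) ≡⟨ sumBelow-head n row ⟩
  row 0 ℚ.+ sumBelow n (λ a → row (suc a)) ≡⟨ cong₂ ℚ._+_ row₀ (sumBelow-zero n (λ a _ →
                                                      sumBelow-zero (suc (suc k)) (λ b _ → ℚₚ.*-zeroˡ (f (n ∸ suc a) (suc k ∸ b))))) ⟩
  f n k ℚ.+ 0ℚ ≡⟨ ℚₚ.+-identityʳ _ ⟩
  f n k ∎
  where
  open ≡.≡-Reasoning
  row : ℕ → ℚ
  row a = sumTo (suc k) (λ b → xS a b ℚ.* f (n ∸ a) (suc k ∸ b))
  row₀ : row 0 ≡ f n k
  row₀ = begin
    sumBelow (suc (suc k)) (λ b → xS 0 b ℚ.* f n (suc k ∸ b))
      ≡⟨ sumBelow-head (suc k) (λ b → xS 0 b ℚ.* f n (suc k ∸ b)) ⟩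
    0ℚ ℚ.* f n (suc k) ℚ.+ sumBelow (suc k) (λ b → xS 0 (suc b) ℚ.* f n (k ∸ b))
      ≡⟨ cong₂ ℚ._+_ (ℚₚ.*-zeroˡ (f n (suc k))) (sumBelow-head k (λ b → xS 0 (suc b) ℚ.* f n (k ∸ b))) ⟩
    0ℚ ℚ.+ (1ℚ ℚ.* f n k ℚ.+ sumBelow k (λ b → 0ℚ ℚ.* f n (k ∸ suc b)))
      ≡⟨ ℚₚ.+-identityˡ _ ⟩
    1ℚ ℚ.* f n k ℚ.+ sumBelow k (λ b → 0ℚ ℚ.* f n (k ∸ suc b))
      ≡⟨ cong₂ ℚ._+_ (ℚₚ.*-identityˡ (f n k)) (sumBelow-zero k (λ b _ → ℚₚ.*-zeroˡ (f n (k ∸ suc b)))) ⟩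
    f n k ℚ.+ 0ℚ ≡⟨ ℚₚ.+-identityʳ _ ⟩
    f n k ∎

t-shift₀ : ∀ f k → (tS *S f) 0 k ≡ 0ℚ
t-shift₀ f k = cong (0ℚ ℚ.+_) (sumBelow-zero (suc k) (λ b _ → ℚₚ.*-zeroˡ (f 0 (k ∸ b))))

t-shift : ∀ f n k → (tS *S f) (suc n) k ≡ f n k
t-shift f n k = begin
  sumBelow (suc (suc n)) row ≡⟨ sumBelow-head (suc n) row ⟩
  row 0 ℚ.+ sumBelow (suc n) (λ a → row (suc a))
    ≡⟨ cong₂ ℚ._+_ (sumBelow-zero (suc k) (λ b _ → ℚₚ.*-zeroˡ (f (suc n) (k ∸ b)))) (sumBelow-head n (λ a → row (suc a))) ⟩
  0ℚ ℚ.+ (row 1 ℚ.+ sumBelow n (λ a → row (suc (suc a)))) ≡⟨ ℚₚ.+-identityˡ _ ⟩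
  row 1 ℚ.+ sumBelow n (λ a → row (suc (suc a)))
    ≡⟨ cong₂ ℚ._+_ row₁ (sumBelow-zero n (λ a _ → sumBelow-zero (suc k) (λ b _ → ℚₚ.*-zeroˡ (f (n ∸ suc a) (k ∸ b))))) ⟩
  f n k ℚ.+ 0ℚ ≡⟨ ℚₚ.+-identityʳ _ ⟩
  f n k ∎
  where
  open ≡.≡-Reasoning
  row : ℕ → ℚ
  row a = sumTo k (λ b → tS a b ℚ.* f (suc n ∸ a) (k ∸ b))
  row₁ : row 1 ≡ f n k
  row₁ = begin
    sumBelow (suc k) (λ b → tS 1 b ℚ.* f n (k ∸ b)) ≡⟨ sumBelow-head k (λ b → tS 1 b ℚ.* f n (k ∸ b)) ⟩
    1ℚ ℚ.* f n k ℚ.+ sumBelow k (λ b → 0ℚ ℚ.* f n (k ∸ suc b))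
      ≡⟨ cong₂ ℚ._+_ (ℚₚ.*-identityˡ (f n k)) (sumBelow-zero k (λ b _ → ℚₚ.*-zeroˡ (f n (k ∸ suc b)))) ⟩
    f n k ℚ.+ 0ℚ ≡⟨ ℚₚ.+-identityʳ _ ⟩
    f n k ∎

infix 4 _≈[<_]_

_≈[<_]_ : Series → ℕ → Series → Set
f ≈[< n ] g = ∀ j → j < n → ∀ k → f j k ≡ g j k

*S-agree : ∀ {n f f′ g g′} → f ≈[< n ] f′ → g ≈[< n ] g′ → f *S g ≈[< n ] f′ *S g′
*S-agree h h′ j j<n k = sumBelow-cong (suc j) λ a a≤j → sumBelow-cong (suc k) λ b _ →
  cong₂ ℚ._*_ (h a (ℕₚ.≤-<-trans (ℕ.s≤s⁻¹ a≤j) j<n) b) (h′ (j ∸ a) (ℕₚ.≤-<-trans (ℕₚ.m∸n≤m j a) j<n) (k ∸ b))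

-- The coefficients of order n of the factors only meet the vanishing constant terms.
*S-agree-next : ∀ {n f f′ g g′} → (∀ k → f 0 k ≡ 0ℚ) → (∀ k → f′ 0 k ≡ 0ℚ) → (∀ k → g 0 k ≡ 0ℚ) → (∀ k → g′ 0 k ≡ 0ℚ) →
  f ≈[< n ] f′ → g ≈[< n ] g′ → ∀ k → (f *S g) n k ≡ (f′ *S g′) n k
*S-agree-next {n} {f} {f′} {g} {g′} f₀ f₀′ g₀ g₀′ h h′ k = sumBelow-cong (suc n) λ a a≤n → sumBelow-cong (suc k) λ b _ → term a b (ℕ.s≤s⁻¹ a≤n)
  where
  open ≡.≡-Reasoning
  term : ∀ a b → a ≤ n → f a b ℚ.* g (n ∸ a) (k ∸ b) ≡ f′ a b ℚ.* g′ (n ∸ a) (k ∸ b)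
  term zero b _ = trans (*-zero₁ (f 0 b) (g n (k ∸ b)) (f₀ b)) (sym (*-zero₁ (f′ 0 b) (g′ n (k ∸ b)) (f₀′ b)))
  term (suc a) b a<n with ℕₚ.m≤n⇒m<n∨m≡n a<n
  ... | inj₁ lt = cong₂ ℚ._*_ (h (suc a) lt b) (h′ (n ∸ suc a) (ℕₚ.∸-monoʳ-< (s≤s z≤n) a<n) (k ∸ b))
  ... | inj₂ refl = trans (vanish f g g₀) (sym (vanish f′ g′ g₀′))
    where
    vanish : ∀ (p q : Series) → (∀ k → q 0 k ≡ 0ℚ) → p (suc a) b ℚ.* q (a ∸ a) (k ∸ b) ≡ 0ℚ
    vanish p q q₀ = *-zero₂ (p (suc a) b) (q (a ∸ a) (k ∸ b)) (trans (cong (λ j → q j (k ∸ b)) (ℕₚ.n∸n≡0 a)) (q₀ (k ∸ b)))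

*S-order₀ : ∀ {f} g → (∀ k → f 0 k ≡ 0ℚ) → ∀ k → (f *S g) 0 k ≡ 0ℚ
*S-order₀ {f} g f₀ k = cong (0ℚ ℚ.+_) (sumBelow-zero (suc k) (λ b _ → *-zero₁ (f 0 b) (g 0 (k ∸ b)) (f₀ b)))

FiniteDegree : Series → Set
FiniteDegree f = ∀ n → Σ ℕ λ d → ∀ k → d < k → f n k ≡ 0ℚ

-- A product at order n meets all orders up to n of its factors and needs one bound for all of them.
uniformDegree : ∀ {f} → FiniteDegree f → ∀ n → Σ ℕ λ d → ∀ j → j ≤ n → ∀ k → d < k → f j k ≡ 0ℚ
uniformDegree F zero = proj₁ (F 0) , λ { zero _ → proj₂ (F 0) }
uniformDegree {f} F (suc n) = d ℕ.⊔ e , go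
  where
  d = proj₁ (uniformDegree F n)
  e = proj₁ (F (suc n))
  go : ∀ j → j ≤ suc n → ∀ k → d ℕ.⊔ e < k → f j k ≡ 0ℚ
  go j j≤ k lt with ℕₚ.m≤n⇒m<n∨m≡n j≤
  ... | inj₁ j<1+n = proj₂ (uniformDegree F n) j (ℕ.s≤s⁻¹ j<1+n) k (ℕₚ.≤-<-trans (ℕₚ.m≤m⊔n d e) lt)
  ... | inj₂ refl = proj₂ (F (suc n)) k (ℕₚ.≤-<-trans (ℕₚ.m≤n⊔m d e) lt)

finiteDegree : Subring seriesRing
finiteDegree = record
  { P = FiniteDegree
  ; P-resp = λ h F n → proj₁ (F n) , λ k lt → trans (sym (coeff h n k)) (proj₂ (F n) k lt)
  ; P-⊕ = λ F F′ n → proj₁ (F n) ℕ.⊔ proj₁ (F′ n) , λ k lt →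
      cong₂ ℚ._+_ (proj₂ (F n) k (ℕₚ.≤-<-trans (ℕₚ.m≤m⊔n _ _) lt)) (proj₂ (F′ n) k (ℕₚ.≤-<-trans (ℕₚ.m≤n⊔m _ _) lt))
  ; P-⊗ = product
  ; P-⊝ = λ F n → proj₁ (F n) , λ k lt → cong ℚ.-_ (proj₂ (F n) k lt)
  ; P-0 = λ n → 0 , λ k _ → refl
  ; P-1 = λ { zero → 0 , λ { (suc k) _ → refl } ; (suc n) → 0 , λ { (suc k) _ → refl } } }
  where
  product : ∀ {f g} → FiniteDegree f → FiniteDegree g → FiniteDegree (f *S g)
  product {f} {g} F F′ n = d + e , λ k lt → sumBelow-zero (suc n) λ a a≤n → sumBelow-zero (suc k) λ b _ → term k lt a b a≤n
    where
    d = proj₁ (uniformDegree F n)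
    e = proj₁ (uniformDegree F′ n)
    term : ∀ k → d + e < k → ∀ a b → a < suc n → f a b ℚ.* g (n ∸ a) (k ∸ b) ≡ 0ℚ
    term k lt a b a≤n with b ℕ.≤? d
    ... | no b≰d = *-zero₁ (f a b) (g (n ∸ a) (k ∸ b)) (proj₂ (uniformDegree F n) a (ℕ.s≤s⁻¹ a≤n) b (ℕₚ.≰⇒> b≰d))
    ... | yes b≤d = *-zero₂ (f a b) (g (n ∸ a) (k ∸ b)) (proj₂ (uniformDegree F′ n) (n ∸ a) (ℕₚ.m∸n≤m n a) (k ∸ b)
        (ℕₚ.m+n≤o⇒m≤o∸n (suc e) (ℕₚ.≤-trans (s≤s (ℕₚ.≤-trans (ℕₚ.+-monoʳ-≤ e b≤d) (ℕₚ.≤-reflexive (ℕₚ.+-comm e d)))) lt)))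

ConstantInX : Series → Set
ConstantInX f = ∀ n k → f n (suc k) ≡ 0ℚ

constantInX : Subring seriesRing
constantInX = record
  { P = ConstantInX
  ; P-resp = λ h F n k → trans (sym (coeff h n (suc k))) (F n k)
  ; P-⊕ = λ F F′ n k → cong₂ ℚ._+_ (F n k) (F′ n k)
  ; P-⊗ = λ {f} {g} F F′ n k → sumBelow-zero (suc n) λ a _ → sumBelow-zero (suc (suc k)) λ
      { zero _ → *-zero₂ (f a 0) (g (n ∸ a) (suc k)) (F′ (n ∸ a) k)
      ; (suc b) _ → *-zero₁ (f a (suc b)) (g (n ∸ a) (k ∸ b)) (F a b) }
  ; P-⊝ = λ F n k → cong ℚ.-_ (F n k)
  ; P-0 = λ n k → refl
  ; P-1 = λ { zero k → refl ; (suc n) k → refl } }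

-- The inverse of 1 - A, for A without constant term in t.
geometricSeries : Series → Series
geometricSeries A n k = 𝕊∑.∑ (suc n) (A ↑_) n k

module _ {A : Series} (A₀ : ∀ k → A 0 k ≡ 0ℚ) where

  ↑-low-order : ∀ j n → n < j → ∀ k → (A ↑ j) n k ≡ 0ℚ
  ↑-low-order (suc j) n n<1+j k = sumBelow-zero (suc n) λ a a≤n → sumBelow-zero (suc k) λ b _ → term a b (ℕ.s≤s⁻¹ a≤n)
    where
    term : ∀ a b → a ≤ n → A a b ℚ.* (A ↑ j) (n ∸ a) (k ∸ b) ≡ 0ℚ
    term zero b _ = *-zero₁ (A 0 b) ((A ↑ j) n (k ∸ b)) (A₀ b)
    term (suc a) b a<n = *-zero₂ (A (suc a) b) ((A ↑ j) (n ∸ suc a) (k ∸ b)) (↑-low-order j (n ∸ suc a)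
      (ℕₚ.<-≤-trans (ℕₚ.∸-monoʳ-< (s≤s z≤n) a<n) (ℕ.s≤s⁻¹ n<1+j)) (k ∸ b))

  geometricSeries-agree : ∀ N → geometricSeries A ≈[< suc N ] 𝕊∑.∑ (suc N) (A ↑_)
  geometricSeries-agree N j j≤N k = sym (trans
    (cong (λ l → 𝕊∑.∑ (suc l) (A ↑_) j k) (sym (ℕₚ.m∸n+n≡m (ℕ.s≤s⁻¹ j≤N)))) (extend (N ∸ j)))
    where
    extend : ∀ l → 𝕊∑.∑ (suc (l + j)) (A ↑_) j k ≡ 𝕊∑.∑ (suc j) (A ↑_) j k
    extend zero = refl
    extend (suc l) = trans (cong₂ ℚ._+_ (extend l) (↑-low-order (suc (l + j)) j (s≤s (ℕₚ.m≤n+m j l)) k)) (ℚₚ.+-identityʳ _)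

  -- At order n the series may be replaced by its terms up to A^n, and the remainder A^{n+1} of the
  -- finite geometric sum has no coefficient there.
  geometricSeries-inverse : (1S -S A) *S geometricSeries A ≋ 1S
  geometricSeries-inverse = ≋-mk λ n k → begin
    ((1S -S A) *S geometricSeries A) n k
      ≡⟨ *S-agree {suc n} {1S -S A} {1S -S A} (λ _ _ _ → refl) (geometricSeries-agree n) n ℕₚ.≤-refl k ⟩
    ((1S -S A) *S 𝕊∑.∑ (suc n) (A ↑_)) n k ≡⟨ coeff (finite n) n k ⟩
    1S n k ℚ.- (A ↑ suc n) n k ≡⟨ cong (λ q → 1S n k ℚ.- q) (↑-low-order (suc n) n ℕₚ.≤-refl k) ⟩
    1S n k ℚ.- 0ℚ ≡⟨ ℚₚ.+-identityʳ _ ⟩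
    1S n k ∎
    where
    open ≡.≡-Reasoning
    finite : ∀ n → (1S -S A) *S 𝕊∑.∑ (suc n) (A ↑_) ≋ 1S -S A ↑ suc n
    finite n = by₁ (⊝ 1#) (𝕊∑.geometric A (suc n))
      (solve 3 (λ a s p → ((:1 :- a) :* s) :+ (:- :1) :* (p :- :1) := (:1 :- p) :+ (:- :1) :* ((a :- :1) :* s))
        ≈-refl A (𝕊∑.∑ (suc n) (A ↑_)) (A ↑ suc n))
      where open 𝕊

module _ (SR : Subring seriesRing) where

  open Subring SR

  P-powerSum : ∀ {A} → P A → ∀ n → P (𝕊∑.∑ n (A ↑_))
  P-powerSum PA zero = P-0
  P-powerSum {A} PA (suc n) = P-⊕ (P-powerSum PA n) (P-power n)
    where
    P-power : ∀ e → P (A ↑ e)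
    P-power zero = P-1
    P-power (suc e) = P-⊗ PA (P-power e)

geometricSeries-finiteDegree : ∀ {A} → FiniteDegree A → FiniteDegree (geometricSeries A)
geometricSeries-finiteDegree F n = P-powerSum finiteDegree F (suc n) n

geometricSeries-constantInX : ∀ {A} → ConstantInX A → ConstantInX (geometricSeries A)
geometricSeries-constantInX F n k = P-powerSum constantInX F (suc n) n k

module ℚR = RingKit ℚₚ.+-*-commutativeRing

x-1₀ : ∀ f n → ((xS -S 1S) *S f) n 0 ≡ ℚ.- f n 0
x-1-suc : ∀ f n k → ((xS -S 1S) *S f) n (suc k) ≡ f n k ℚ.- f n (suc k)

private
  x-1-expand : ∀ f → (xS -S 1S) *S f ≋ xS *S f -S f
  x-1-expand f = 𝕊.solve 2 (λ x f → (x 𝕊.:- 𝕊.:1) 𝕊.:* f 𝕊.:= x 𝕊.:* f 𝕊.:- f) 𝕊.≈-refl xS f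

x-1₀ f n = trans (coeff (x-1-expand f) n 0) (trans (cong (λ q → q ℚ.- f n 0) (x-shift₀ f n)) (ℚₚ.+-identityˡ _))
x-1-suc f n k = trans (coeff (x-1-expand f) n (suc k)) (cong (λ q → q ℚ.- f n (suc k)) (x-shift f n k))

ℚ-difference-zero : ∀ p q → p ℚ.- q ≡ 0ℚ → p ≡ q
ℚ-difference-zero p q h = ℚR.⊕-cancelʳ {p} {q} (ℚ.- q) (trans h (sym (ℚₚ.+-inverseʳ q)))

ℚ-cancelˡ : ∀ p {q r} → p ℚ.+ q ≡ p ℚ.+ r → q ≡ r
ℚ-cancelˡ p {q} {r} h = ℚR.⊕-cancelʳ {q} {r} p (trans (ℚₚ.+-comm q p) (trans h (ℚₚ.+-comm p r)))

-- The coefficients of f are recovered one after the other from those of (x - 1) f.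
x-1-injective : ∀ f g n → (∀ k → ((xS -S 1S) *S f) n k ≡ ((xS -S 1S) *S g) n k) → ∀ k → f n k ≡ g n k
x-1-injective f g n h zero = ℚₚ.neg-injective (trans (sym (x-1₀ f n)) (trans (h 0) (x-1₀ g n)))
x-1-injective f g n h (suc k) = ℚₚ.neg-injective (ℚ-cancelˡ (f n k)
  (trans (sym (x-1-suc f n k)) (trans (h (suc k)) (trans (x-1-suc g n k)
    (cong (λ q → q ℚ.- g n (suc k)) (sym (x-1-injective f g n h k)))))))

-- All x-coefficients of f are then equal, and those beyond its degree are zero. The bound d
-- excludes multiples of 1/(1-x).
x-1-constant : ∀ f n d → (∀ k → d < k → f n k ≡ 0ℚ) → (∀ k → ((xS -S 1S) *S f) n (suc k) ≡ 0ℚ) →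
  ((xS -S 1S) *S f) n 0 ≡ 0ℚ
x-1-constant f n d F h = trans (x-1₀ f n) (cong ℚ.-_ (trans (all-equal (suc d)) (F (suc d) ℕₚ.≤-refl)))
  where
  all-equal : ∀ k → f n 0 ≡ f n k
  all-equal zero = refl
  all-equal (suc k) = trans (all-equal k) (ℚ-difference-zero _ _ (trans (sym (x-1-suc f n k)) (h k)))

open 𝕊 using (_⊕_; _⊗_; _⊖_) public

module EvaluationAt1 = Congruence seriesRing finiteDegree (xS ⊖ 1S)
open EvaluationAt1 using (_~_; congruent; quotient; Pq; eq) public

-- At order n the difference of the values is x - 1 times the difference of the quotients, and it is
-- constant in x; hence it is zero by `x-1-constant`.
value-determined : ∀ {f f′ c c′} n → f ~ c → f′ ~ c′ → ConstantInX c → ConstantInX c′ →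
  (∀ k → f n k ≡ f′ n k) → ∀ k → c n k ≡ c′ n k
value-determined n _ _ V V′ h (suc k) = trans (V n k) (sym (V′ n k))
value-determined {f} {f′} {c} {c′} n s s′ V V′ h zero = sym (ℚ-difference-zero _ _ (trans (sym (diff 0))
  (x-1-constant q n (proj₁ (Fq n)) (proj₂ (Fq n)) (λ k → trans (diff (suc k)) (cong₂ ℚ._-_ (V′ n k) (V n k))))))
  where
  open ≡.≡-Reasoning
  q = quotient s ⊖ quotient s′
  Fq : FiniteDegree q
  Fq = Subring.P-⊕ finiteDegree {quotient s} (Pq s) (Subring.P-⊝ finiteDegree {quotient s′} (Pq s′))
  expand : (xS -S 1S) *S q ≋ (f ⊖ c) ⊖ (f′ ⊖ c′)
  expand = 𝕊.≈-trans (𝕊.solve 3 (λ x a b → (x 𝕊.:- 𝕊.:1) 𝕊.:* (a 𝕊.:- b) 𝕊.:= (x 𝕊.:- 𝕊.:1) 𝕊.:* a 𝕊.:- (x 𝕊.:- 𝕊.:1) 𝕊.:* b)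
    𝕊.≈-refl xS (quotient s) (quotient s′)) (𝕊.≈-sym (𝕊.⊕-cong (eq s) (𝕊.⊝-cong (eq s′))))
  diff : ∀ k → ((xS -S 1S) *S q) n k ≡ c′ n k ℚ.- c n k
  diff k = begin
    ((xS -S 1S) *S q) n k ≡⟨ coeff expand n k ⟩
    (f n k ℚ.- c n k) ℚ.- (f′ n k ℚ.- c′ n k) ≡⟨ cong (λ p → (p ℚ.- c n k) ℚ.- (f′ n k ℚ.- c′ n k)) (h k) ⟩
    (f′ n k ℚ.- c n k) ℚ.- (f′ n k ℚ.- c′ n k)
      ≡⟨ ℚR.solve 3 (λ f c d → (f ℚR.:- c) ℚR.:- (f ℚR.:- d) ℚR.:= d ℚR.:- c) refl (f′ n k) (c n k) (c′ n k) ⟩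
    c′ n k ℚ.- c n k ∎

-- The system of recurrences has only one solution

record System (m : ℕ) (J V : ℕ → Series) : Set where
  field
    order₀ : ∀ i → i ≤ suc m → ∀ k → J i 0 k ≡ 0ℚ
    recurrence : ∀ i → i ≤ m → (xS ⊖ 1S) ⊗ (J (suc i) ⊖ J i) ≋ J m ⊗ (xS ⊗ J (suc i) ⊖ xS ↑ (m ∸ i) ⊗ V (suc i))
    value-constant : ∀ i → i ≤ suc m → ConstantInX (V i)
    value-at-1 : ∀ i → i ≤ suc m → J i ~ V i

  value-order₀ : ∀ i → i ≤ suc m → ∀ k → V i 0 k ≡ 0ℚ
  value-order₀ i i≤ k = value-determined {J i} {0S} {V i} {0S} 0 (value-at-1 i i≤) (EvaluationAt1.~-refl (Subring.P-0 finiteDegree))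
    (value-constant i i≤) (λ _ _ → refl) (order₀ i i≤) k

-- Both factors on the right of the recurrence have no constant term in t, so at order n it involves
-- smaller orders only. Cancelling x - 1 then yields `J (suc i)` from `J i`, and the values at order
-- n follow afterwards: an induction on n with an inner one on i.
system-unique : ∀ {m J J′ V V′} → System m J V → System m J′ V′ → J 0 ≋ J′ 0 →
  ∀ n i → i ≤ suc m → (∀ k → J i n k ≡ J′ i n k) × (∀ k → V i n k ≡ V′ i n k)
system-unique {m} {J} {J′} {V} {V′} s s′ J₀ = <-rec _ λ n ih i i≤ →
  let h = J-equal n (λ {j} lt → ih {j} lt) i i≤ in
  h , value-determined n (S.value-at-1 i i≤) (S′.value-at-1 i i≤) (S.value-constant i i≤) (S′.value-constant i i≤) h
  where
  module S = System s
  module S′ = System s′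
  Claim : ℕ → Set
  Claim n = ∀ i → i ≤ suc m → (∀ k → J i n k ≡ J′ i n k) × (∀ k → V i n k ≡ V′ i n k)
  J-equal : ∀ n → (∀ {j} → j < n → Claim j) → ∀ i → i ≤ suc m → ∀ k → J i n k ≡ J′ i n k
  J-equal n ih zero i≤ k = coeff J₀ n k
  J-equal n ih (suc i) (s≤s i≤m) k = begin
    J (suc i) n k ≡⟨ restore (J (suc i)) (J i) k ⟩
    (J (suc i) ⊖ J i) n k ℚ.+ J i n k ≡⟨ cong₂ ℚ._+_ (x-1-injective (J (suc i) ⊖ J i) (J′ (suc i) ⊖ J′ i) n step k) (J-equal n ih i (ℕₚ.m≤n⇒m≤1+n i≤m) k) ⟩
    (J′ (suc i) ⊖ J′ i) n k ℚ.+ J′ i n k ≡⟨ restore (J′ (suc i)) (J′ i) k ⟨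
    J′ (suc i) n k ∎
    where
    open ≡.≡-Reasoning
    restore : ∀ f g k → f n k ≡ (f ⊖ g) n k ℚ.+ g n k
    restore f g k = sym (trans (ℚₚ.+-assoc (f n k) (ℚ.- g n k) (g n k))
      (trans (cong (f n k ℚ.+_) (ℚₚ.+-inverseˡ (g n k))) (ℚₚ.+-identityʳ (f n k))))
    factor : (ℕ → Series) → (ℕ → Series) → Series
    factor J V = xS ⊗ J (suc i) ⊖ xS ↑ (m ∸ i) ⊗ V (suc i)
    factor-order₀ : ∀ {J V} → System m J V → ∀ k → factor J V 0 k ≡ 0ℚ
    factor-order₀ {J} {V} t k = cong₂ ℚ._-_
      (trans (coeff (𝕊.⊗-comm xS (J (suc i))) 0 k) (*S-order₀ {J (suc i)} xS (System.order₀ t (suc i) (s≤s i≤m)) k))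
      (trans (coeff (𝕊.⊗-comm (xS ↑ (m ∸ i)) (V (suc i))) 0 k) (*S-order₀ {V (suc i)} (xS ↑ (m ∸ i)) (System.value-order₀ t (suc i) (s≤s i≤m)) k))
    factor-agree : factor J V ≈[< n ] factor J′ V′
    factor-agree j lt k = cong₂ ℚ._-_
      (*S-agree {n} {xS} {xS} (λ _ _ _ → refl) (λ a a<n → proj₁ (ih a<n (suc i) (s≤s i≤m))) j lt k)
      (*S-agree {n} {xS ↑ (m ∸ i)} {xS ↑ (m ∸ i)} (λ _ _ _ → refl) (λ a a<n → proj₂ (ih a<n (suc i) (s≤s i≤m))) j lt k)
    step : ∀ k → ((xS -S 1S) *S (J (suc i) ⊖ J i)) n k ≡ ((xS -S 1S) *S (J′ (suc i) ⊖ J′ i)) n k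
    step k = begin
      ((xS -S 1S) *S (J (suc i) ⊖ J i)) n k ≡⟨ coeff (S.recurrence i i≤m) n k ⟩
      (J m ⊗ factor J V) n k
        ≡⟨ *S-agree-next (S.order₀ m (ℕₚ.n≤1+n m)) (S′.order₀ m (ℕₚ.n≤1+n m)) (factor-order₀ s) (factor-order₀ s′)
             (λ a a<n → proj₁ (ih a<n m (ℕₚ.n≤1+n m))) factor-agree k ⟩
      (J′ m ⊗ factor J′ V′) n k ≡⟨ coeff (S′.recurrence i i≤m) n k ⟨
      ((xS -S 1S) *S (J′ (suc i) ⊖ J′ i)) n k ∎

-- Paths and the Tamari order

zeros : ℕ → Word
zeros n = replicate n false

zeros-+ : ∀ a b → zeros (a + b) ≡ zeros a ++ zeros b
zeros-+ zero b = refl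
zeros-+ (suc a) b = cong (false ∷_) (zeros-+ a b)

++-split : ∀ (x : Word) {s} w {r} → x ++ false ∷ s ≡ w ++ r →
  (∃ λ y → x ≡ w ++ y × r ≡ y ++ false ∷ s) ⊎ (∃ λ y → w ≡ x ++ false ∷ y × s ≡ y ++ r)
++-split x [] h = inj₁ (x , refl , sym h)
++-split [] (a ∷ w) h with Listₚ.∷-injective h
... | refl , h′ = inj₂ (w , refl , h′)
++-split (a ∷ x) (b ∷ w) h with Listₚ.∷-injective h
... | refl , h′ with ++-split x w h′
... | inj₁ (y , e , e′) = inj₁ (y , cong (a ∷_) e , e′)
... | inj₂ (y , e , e′) = inj₂ (y , cong (a ∷_) e , e′)

module Paths (m′ : ℕ) where

  m : ℕ
  m = suc m′

  -- Free end heights make prefixes and factors of a Dyck path into paths as well; a down step from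
  -- height 0 has no constructor.
  data Path : ℕ → Word → ℕ → Set where
    [] : ∀ {h} → Path h [] h
    up : ∀ {h w k} → Path (h + m) w k → Path h (true ∷ w) k
    dn : ∀ {h w k} → Path h w k → Path (suc h) (false ∷ w) k

  path-++ : ∀ {h a k b l} → Path h a k → Path k b l → Path h (a ++ b) l
  path-++ [] q = q
  path-++ (up p) q = up (path-++ p q)
  path-++ (dn p) q = dn (path-++ p q)

  path-split : ∀ a {h b l} → Path h (a ++ b) l → ∃ λ k → Path h a k × Path k b l
  path-split [] p = _ , [] , p
  path-split (true ∷ a) (up p) = let k , q , r = path-split a p in k , up q , r
  path-split (false ∷ a) (dn p) = let k , q , r = path-split a p in k , dn q , r

  path-raise : ∀ c {h w k} → Path h w k → Path (c + h) w (c + k)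
  path-raise zero p = p
  path-raise (suc c) p = raise₁ (path-raise c p)
    where
    raise₁ : ∀ {h w k} → Path h w k → Path (suc h) w (suc k)
    raise₁ [] = []
    raise₁ (up p) = up (raise₁ p)
    raise₁ (dn p) = dn (raise₁ p)

  path-end-unique : ∀ {h w k l} → Path h w k → Path h w l → k ≡ l
  path-end-unique [] [] = refl
  path-end-unique (up p) (up q) = path-end-unique p q
  path-end-unique (dn p) (dn q) = path-end-unique p q

  path-higher-start : ∀ {h w k} → Path h w k → ¬ Path (suc h) w 0
  path-higher-start p q with path-end-unique (path-raise 1 p) q
  ... | ()

  path-zeros : ∀ e {h} → Path (e + h) (zeros e) h
  path-zeros zero = []
  path-zeros (suc e) = dn (path-zeros e)

  -- The 0 after x is the first step below the axis, while y never goes below it, so y ends no later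
  -- than x.
  first-passage-prefix : ∀ {a x y e} {r z : Word} → Path a x 0 → Path a y e → x ++ false ∷ r ≡ y ++ z →
    ∃ λ y′ → x ≡ y ++ y′ × z ≡ y′ ++ false ∷ r × Path e y′ 0
  first-passage-prefix {x = x} p [] h = x , refl , sym h , p
  first-passage-prefix (up p) (up q) h =
    let y′ , e , e′ , p′ = first-passage-prefix p q (Listₚ.∷-injectiveʳ h) in y′ , cong (true ∷_) e , e′ , p′
  first-passage-prefix (dn p) (dn q) h =
    let y′ , e , e′ , p′ = first-passage-prefix p q (Listₚ.∷-injectiveʳ h) in y′ , cong (false ∷_) e , e′ , p′
  first-passage-prefix [] (up q) ()
  first-passage-prefix (dn p) (up q) ()
  first-passage-prefix (up p) (dn q) ()

  first-passage-unique : ∀ {a x y} {r r′ : Word} → Path a x 0 → Path a y 0 → x ++ false ∷ r ≡ y ++ false ∷ r′ → x ≡ y × r ≡ r′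
  first-passage-unique {y = y} p q h with first-passage-prefix p q h
  ... | [] , e , e′ , _ = trans e (Listₚ.++-identityʳ y) , sym (Listₚ.∷-injectiveʳ e′)
  ... | true ∷ y′ , e , () , _
  ... | false ∷ y′ , e , e′ , ()

  -- On the way from c + 1 + a down to 0 the level c must be reached, and this happens for the first
  -- time after x and one more 0. The height is a variable with an equation because up steps add m
  -- at its right end.
  first-passage-extends : ∀ {a x y h} {r z : Word} c → h ≡ c + suc a → Path a x 0 → Path h y 0 → x ++ false ∷ r ≡ y ++ z →
    ∃ λ y′ → y ≡ x ++ false ∷ y′ × r ≡ y′ ++ z × Path c y′ 0
  first-passage-extends c e p [] h with trans e (ℕₚ.+-suc c _)
  ... | ()
  first-passage-extends c e [] (dn {w = y} q) h =
    y , refl , Listₚ.∷-injectiveʳ h ,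
    subst (λ k → Path k y 0) (ℕₚ.suc-injective (trans e (ℕₚ.+-comm c 1))) q
  first-passage-extends {a} c e (up p) (up q) h =
    let y′ , e₁ , e₂ , p′ = first-passage-extends c (trans (cong (_+ m) e) (ℕₚ.+-assoc c (suc a) m)) p q (Listₚ.∷-injectiveʳ h)
    in y′ , cong (true ∷_) e₁ , e₂ , p′
  first-passage-extends c e (dn p) (dn q) h =
    let y′ , e₁ , e₂ , p′ = first-passage-extends c (ℕₚ.suc-injective (trans e (ℕₚ.+-suc c _))) p q (Listₚ.∷-injectiveʳ h)
    in y′ , cong (false ∷_) e₁ , e₂ , p′
  first-passage-extends c e [] (up q) ()
  first-passage-extends c e (dn p) (up q) ()
  first-passage-extends c e (up p) (dn q) ()

  first-passage : ∀ {y h} c a → h ≡ c + suc a → Path h y 0 → ∃ λ x → ∃ λ r → y ≡ x ++ false ∷ r × Path a x 0 × Path c r 0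
  first-passage c a e [] with trans e (ℕₚ.+-suc c a)
  ... | ()
  first-passage c a e (up q) =
    let x , r , e′ , p , p′ = first-passage c (a + m) (trans (cong (_+ m) e) (ℕₚ.+-assoc c (suc a) m)) q
    in true ∷ x , r , cong (true ∷_) e′ , up p , p′
  first-passage c zero e (dn {w = y} q) =
    [] , y , refl , [] , subst (λ k → Path k y 0) (ℕₚ.suc-injective (trans e (ℕₚ.+-comm c 1))) q
  first-passage c (suc a) e (dn q) =
    let x , r , e′ , p , p′ = first-passage c a (ℕₚ.suc-injective (trans e (ℕₚ.+-suc c (suc a)))) q
    in false ∷ x , r , cong (false ∷_) e′ , dn p , p′

  -- Either height 0 is met only at the end, and x read one level lower is a path from h - 1, or the
  -- part after the last earlier visit to 0 is a prime path.
  last-step : ∀ {v h} → Path h v 0 →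
    (v ≡ [] × h ≡ 0)
    ⊎ (∃ λ x → ∃ λ h′ → v ≡ x ++ false ∷ [] × h ≡ suc h′ × Path h′ x 0)
    ⊎ (∃ λ x → ∃ λ a → v ≡ x ++ true ∷ a ++ false ∷ [] × Path h x 0 × Path m′ a 0)
  last-step [] = inj₁ (refl , refl)
  last-step (dn p) with last-step p
  ... | inj₁ (refl , refl) = inj₂ (inj₁ ([] , 0 , refl , refl , []))
  ... | inj₂ (inj₁ (x , h′ , e , refl , q)) = inj₂ (inj₁ (false ∷ x , suc h′ , cong (false ∷_) e , refl , dn q))
  ... | inj₂ (inj₂ (x , a , e , q , r)) = inj₂ (inj₂ (false ∷ x , a , cong (false ∷_) e , dn q , r))
  last-step {h = h} (up p) with last-step p
  ... | inj₁ (_ , e) = ⊥-elim (ℕₚ.1+n≢0 (trans (sym (ℕₚ.+-suc h m′)) e))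
  ... | inj₂ (inj₂ (x , a , e , q , r)) = inj₂ (inj₂ (true ∷ x , a , cong (true ∷_) e , up q , r))
  -- An up step from height 0 opens the prime factor closed by the last 0; from a positive height it
  -- merely joins the part before that 0.
  last-step {h = zero} (up p) | inj₂ (inj₁ (x , h′ , e , e′ , q)) =
    inj₂ (inj₂ ([] , x , cong (true ∷_) e , [] , subst (λ k → Path k x 0) (sym (ℕₚ.suc-injective e′)) q))
  last-step {h = suc h} (up p) | inj₂ (inj₁ (x , h′ , e , e′ , q)) =
    inj₂ (inj₁ (true ∷ x , h , cong (true ∷_) e , refl , up (subst (λ k → Path k x 0) (sym (ℕₚ.suc-injective e′)) q)))

  -- The prefix y stays nonnegative when started at h, so from h + 1 it cannot end at 0.
  last-steps-disjoint : ∀ {h x y a} → Path h x 0 → Path (suc h) y 0 → x ++ false ∷ [] ≢ y ++ true ∷ a ++ false ∷ []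
  last-steps-disjoint {x = x} {y} {a} p q e
    with Listₚ.∷ʳ-injectiveˡ x (y ++ true ∷ a) (trans e (sym (Listₚ.++-assoc y (true ∷ a) (false ∷ []))))
  ... | refl = path-higher-start (proj₁ (proj₂ (path-split y p))) q

  last-prime-unique : ∀ {h x y a b} → Path h x 0 → Path h y 0 → Path m′ a 0 → Path m′ b 0 →
    x ++ true ∷ a ++ false ∷ [] ≡ y ++ true ∷ b ++ false ∷ [] → x ≡ y × a ≡ b
  last-prime-unique [] [] pa pb e = refl , proj₁ (first-passage-unique pa pb (Listₚ.∷-injectiveʳ e))
  last-prime-unique {b = b} [] (up q) pa pb e with first-passage-extends 0 refl pa q (Listₚ.∷-injectiveʳ e)
  ... | [] , _ , () , _
  ... | _ ∷ _ , _ , () , _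
  last-prime-unique (up p) [] pa pb e with first-passage-extends 0 refl pb p (sym (Listₚ.∷-injectiveʳ e))
  ... | [] , _ , () , _
  ... | _ ∷ _ , _ , () , _
  last-prime-unique (up p) (up q) pa pb e =
    let e₁ , e₂ = last-prime-unique p q pa pb (Listₚ.∷-injectiveʳ e) in cong (true ∷_) e₁ , e₂
  last-prime-unique (dn p) (dn q) pa pb e =
    let e₁ , e₂ = last-prime-unique p q pa pb (Listₚ.∷-injectiveʳ e) in cong (false ∷_) e₁ , e₂
  last-prime-unique (up p) (dn q) pa pb ()
  last-prime-unique (dn p) (up q) pa pb ()

  infix 4 _⋖_ _≼_

  -- A prime m-Dyck path is 1 x 0 with x a path from height m - 1 to 0.
  data _⋖_ : Word → Word → Set where
    here : ∀ {x s} → Path m′ x 0 → (false ∷ true ∷ x ++ false ∷ s) ⋖ (true ∷ x ++ false ∷ false ∷ s)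
    there : ∀ {b w w′} → w ⋖ w′ → (b ∷ w) ⋖ (b ∷ w′)

  _≼_ : Word → Word → Set
  _≼_ = Star _⋖_

  ⋖-prepend : ∀ p {w w′} → w ⋖ w′ → (p ++ w) ⋖ (p ++ w′)
  ⋖-prepend [] c = c
  ⋖-prepend (b ∷ p) c = there (⋖-prepend p c)

  ⋖-append : ∀ {w w′} r → w ⋖ w′ → (w ++ r) ⋖ (w′ ++ r)
  ⋖-append r (there c) = there (⋖-append r c)
  ⋖-append r (here {x} {s} p) = subst₂ (λ a b → (false ∷ true ∷ a) ⋖ (true ∷ b))
    (sym (Listₚ.++-assoc x (false ∷ s) r)) (sym (Listₚ.++-assoc x (false ∷ false ∷ s) r)) (here p)

  ≼-prepend : ∀ p {w w′} → w ≼ w′ → (p ++ w) ≼ (p ++ w′)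
  ≼-prepend p = gmap (p ++_) (⋖-prepend p)

  ≼-append : ∀ r {w w′} → w ≼ w′ → (w ++ r) ≼ (w′ ++ r)
  ≼-append r = gmap (_++ r) (⋖-append r)

  ≼-reflexive : ∀ {w w′} → w ≡ w′ → w ≼ w′
  ≼-reflexive refl = ε

  path-⋖ : ∀ {h w w′ k} → Path h w k → w ⋖ w′ → Path h w′ k
  path-⋖ (up p) (there c) = up (path-⋖ p c)
  path-⋖ (dn p) (there c) = dn (path-⋖ p c)
  path-⋖ {k = k} (dn {h} (up p)) (here {x} {s} q) with path-split x p
  ... | e , px , ps = up (path-++ (subst (λ j → Path j x (suc (suc h))) eq₂ (raised (suc (suc h)))) (dn (tail-path ps)))
    where
    raised : ∀ c → Path (c + m′) x c
    raised c = subst (Path (c + m′) x) (ℕₚ.+-identityʳ c) (path-raise c q)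
    eq₁ : suc h + m′ ≡ h + m
    eq₁ = sym (ℕₚ.+-suc h m′)
    eq₂ : suc (suc h) + m′ ≡ suc h + m
    eq₂ = cong suc eq₁
    tail-path : Path e (false ∷ s) k → Path (suc h) (false ∷ s) k
    tail-path = subst (λ j → Path j (false ∷ s) k) (path-end-unique px (subst (λ j → Path j x (suc h)) eq₁ (raised (suc h))))

  path-≼ : ∀ {h w w′ k} → Path h w k → w ≼ w′ → Path h w′ k
  path-≼ p ε = p
  path-≼ p (c ◅ cs) = path-≼ (path-⋖ p c) cs

  ups-++ : ∀ a b → ups (a ++ b) ≡ ups a + ups b
  ups-++ [] b = refl
  ups-++ (true ∷ a) b = cong suc (ups-++ a b)
  ups-++ (false ∷ a) b = ups-++ a b

  ups-⋖ : ∀ {w w′} → w ⋖ w′ → ups w ≡ ups w′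
  ups-⋖ (there {true} c) = cong suc (ups-⋖ c)
  ups-⋖ (there {false} c) = ups-⋖ c
  ups-⋖ (here {x} {s} _) = cong suc (trans (ups-++ x (false ∷ s)) (sym (ups-++ x (false ∷ false ∷ s))))

  ups-≼ : ∀ {w w′} → w ≼ w′ → ups w ≡ ups w′
  ups-≼ ε = refl
  ups-≼ (c ◅ cs) = trans (ups-⋖ c) (ups-≼ cs)

-- Paths above a path that ends with a prime factor

module Intervals (m′ : ℕ) where

  open Paths m′

  zeros-minimal : ∀ ℓ {w z} → w ⋖ z → w ≢ zeros ℓ
  zeros-minimal (suc zero) (here _) ()
  zeros-minimal (suc (suc ℓ)) (here _) ()
  zeros-minimal (suc ℓ) (there c) e = zeros-minimal ℓ c (Listₚ.∷-injectiveʳ e)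

  -- The prime factor after a valley returns to the height where it starts, and b comes back to that
  -- height on its way to 0; hence the swap does not reach the final zeros.
  ⋖-before-zeros : ∀ {h b z} ℓ → Path h b 0 → (b ++ zeros (suc ℓ)) ⋖ z → ∃ λ b′ → b ⋖ b′ × z ≡ b′ ++ zeros (suc ℓ)
  ⋖-before-zeros ℓ p c = go p c refl
    where
    go : ∀ {h b w z} → Path h b 0 → w ⋖ z → w ≡ b ++ zeros (suc ℓ) → ∃ λ b′ → b ⋖ b′ × z ≡ b′ ++ zeros (suc ℓ)
    go [] c refl = ⊥-elim (zeros-minimal (suc ℓ) c refl)
    go (up p) (there c) e with Listₚ.∷-injective e
    ... | refl , e′ = let b′ , d , e″ = go p c e′ in true ∷ b′ , there d , cong (true ∷_) e″
    go (dn p) (there c) e with Listₚ.∷-injective e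
    ... | refl , e′ = let b′ , d , e″ = go p c e′ in false ∷ b′ , there d , cong (false ∷_) e″
    go (dn []) (here q) ()
    go (dn (dn p)) (here q) ()
    go (dn {h} (up p)) (here {x} {s} q) e
      with first-passage-extends h refl q p (Listₚ.∷-injectiveʳ (Listₚ.∷-injectiveʳ e))
    ... | y , refl , refl , _ = true ∷ x ++ false ∷ false ∷ y , here q ,
          cong (true ∷_) (sym (Listₚ.++-assoc x (false ∷ false ∷ y) (zeros (suc ℓ))))

  ≼-before-zeros : ∀ {h b z} ℓ → Path h b 0 → (b ++ zeros ℓ) ≼ z → ∃ λ b′ → b ≼ b′ × z ≡ b′ ++ zeros ℓ
  ≼-before-zeros {b = b} ℓ p ε = b , ε , refl
  ≼-before-zeros {b = b} {z} zero p c = z , subst (_≼ z) (Listₚ.++-identityʳ b) c , sym (Listₚ.++-identityʳ z)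
  ≼-before-zeros (suc ℓ) p (c ◅ cs) with ⋖-before-zeros ℓ p c
  ... | b′ , d , refl = let b″ , ds , e = ≼-before-zeros (suc ℓ) (path-⋖ p d) cs in b″ , d ◅ ds , e

  path-to-0-zeros : ∀ {e} y {s} ℓ → zeros ℓ ≡ y ++ false ∷ s → Path e y 0 → ∃ λ k → y ≡ zeros e × s ≡ zeros k × ℓ ≡ e + suc k
  path-to-0-zeros [] (suc ℓ) e [] = ℓ , refl , sym (Listₚ.∷-injectiveʳ e) , refl
  path-to-0-zeros (_ ∷ y) (suc ℓ) e (dn p) =
    let k , a , b , c = path-to-0-zeros y ℓ (Listₚ.∷-injectiveʳ e) p in k , cong (false ∷_) a , b , cong suc c
  path-to-0-zeros (_ ∷ y) (suc ℓ) () (up p)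

  -- The form of a path above x 1 a 0: the last prime has grown from a to `prime` and moved left
  -- over `position` zeros, and deleting it leaves a path above x.
  record PrimeAppended (h : ℕ) (x a z : Word) : Set where
    constructor primeAppended
    field
      {front prime} : Word
      {position} : ℕ
      shape : z ≡ front ++ true ∷ prime ++ false ∷ zeros position
      front-path : Path h front position
      prime-path : Path m′ prime 0
      ≼-front : x ≼ front ++ zeros position
      ≼-prime : a ≼ prime

  zeros-snoc : ∀ w ℓ → (w ++ false ∷ []) ++ zeros ℓ ≡ w ++ zeros (suc ℓ)
  zeros-snoc w ℓ = Listₚ.++-assoc w (false ∷ []) (zeros ℓ)

  -- The swap takes place inside the prime, or at the 0 just before it, or inside w, or its factor
  -- starts in w and swallows the appended prime. In the last case deleting the prime leaves a
  -- shorter prime factor, so a cover remains.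
  prime-step : ∀ {h w b ℓ y z} → Path h w ℓ → Path m′ b 0 → y ⋖ z → y ≡ w ++ true ∷ b ++ false ∷ zeros ℓ →
    PrimeAppended h (w ++ zeros ℓ) b z
  prime-step {ℓ = ℓ} [] q (there c) e with Listₚ.∷-injective e
  ... | refl , refl with ⋖-before-zeros ℓ q c
  ... | b′ , d , refl = primeAppended refl [] (path-⋖ q d) ε (d ◅ ε)
  prime-step (up p) q (there c) e with Listₚ.∷-injective e
  ... | refl , e′ = let primeAppended s p′ q′ l l′ = prime-step p q c e′ in
        primeAppended (cong (true ∷_) s) (up p′) q′ (≼-prepend (true ∷ []) l) l′
  prime-step (dn p) q (there c) e with Listₚ.∷-injective e
  ... | refl , e′ = let primeAppended s p′ q′ l l′ = prime-step p q c e′ in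
        primeAppended (cong (false ∷_) s) (dn p′) q′ (≼-prepend (false ∷ []) l) l′
  prime-step [] q (here _) ()
  prime-step (up p) q (here _) ()
  prime-step (dn (dn p)) q (here _) ()
  prime-step (dn []) q (here px) e
    with first-passage-unique px q (Listₚ.∷-injectiveʳ (Listₚ.∷-injectiveʳ e))
  -- The prime slides over one 0; the word without the prime is unchanged, which is why `ε` is
  -- enough.
  ... | refl , refl = primeAppended {front = []} refl [] q ε ε
  prime-step {h} {ℓ = ℓ} (dn {h′} (up {w = w} p)) q (here {x} {s} px) e
    with ++-split x w (Listₚ.∷-injectiveʳ (Listₚ.∷-injectiveʳ e))
  ... | inj₂ (y , refl , refl) =
        primeAppended {front = true ∷ x ++ false ∷ false ∷ y}
          (cong (true ∷_) (sym (Listₚ.++-assoc x (false ∷ false ∷ y) _)))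
          (path-⋖ (dn (up p)) (here px)) q (⋖-append (zeros ℓ) (here px) ◅ ε) ε
  ... | inj₁ (y , refl , e₂) with path-split w px
  prime-step {h} {ℓ = ℓ} (dn {h′} (up {w = w} p)) q (here {_} {s} px) e | inj₁ ([] , refl , ()) | _
  prime-step {h} {ℓ = ℓ} (dn {h′} (up {w = w} p)) q (here {_} {s} px) e | inj₁ (false ∷ _ , refl , ()) | _
  prime-step {h} {b = b} {ℓ = ℓ} (dn {h′} (up {w = w} p)) q (here {_} {s} px) e | inj₁ (true ∷ y , refl , e₂) | k , pw , up py
    with first-passage-extends k refl q py (Listₚ.∷-injectiveʳ e₂)
  ... | y′ , refl , e₃ , py′ with path-to-0-zeros y′ ℓ e₃ py′
  -- The factor takes up k + 1 of the final zeros and l remain behind it; the swapped 0 joins them,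
  -- so the prime is then followed by one more zero than before.
  ... | l , refl , refl , refl =
        primeAppended {front = true ∷ w} {position = suc (k + suc l)}
          (cong (true ∷_) (shape-eq w b))
          (up (path-raise 1 p)) q
          (subst₂ _⋖_ (cong (λ t → false ∷ true ∷ t) (front-eq w (suc l))) (cong (true ∷_) (trans (front-eq w (suc (suc l))) (cong (λ j → w ++ zeros j) (ℕₚ.+-suc k (suc l)))))
             (here {x = w ++ zeros k} {s = zeros l} (path-++ pw (subst (λ j → Path j (zeros k) 0) (ℕₚ.+-identityʳ k) (path-zeros k)))) ◅ ε) ε
    where
    front-eq : ∀ w j → (w ++ zeros k) ++ zeros j ≡ w ++ zeros (k + j)
    front-eq w j = trans (Listₚ.++-assoc w (zeros k) (zeros j)) (cong (w ++_) (sym (zeros-+ k j)))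
    shape-eq : ∀ w b → (w ++ true ∷ b ++ false ∷ zeros k) ++ false ∷ false ∷ zeros l ≡ w ++ true ∷ b ++ false ∷ zeros (suc (k + suc l))
    shape-eq w b = trans (Listₚ.++-assoc w _ _) (cong (λ t → w ++ true ∷ t) (trans (Listₚ.++-assoc b _ _) (cong (λ t → b ++ false ∷ t)
      (trans (sym (zeros-+ k (suc (suc l)))) (cong zeros (ℕₚ.+-suc k (suc l)))))))

  prime-≼ : ∀ {h w b ℓ y z} → Path h w ℓ → Path m′ b 0 → y ≼ z → y ≡ w ++ true ∷ b ++ false ∷ zeros ℓ →
    PrimeAppended h (w ++ zeros ℓ) b z
  prime-≼ p q ε e = primeAppended e p q ε ε
  prime-≼ p q (c ◅ cs) e with prime-step p q c e
  ... | primeAppended s p′ q′ l l′ with prime-≼ p′ q′ cs s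
  ... | primeAppended t p″ q″ k k′ = primeAppended t p″ q″ (l ◅◅ k) (l′ ◅◅ k′)

  prime-remove : ∀ {h x a z} → Path h x 0 → Path m′ a 0 → (x ++ true ∷ a ++ false ∷ []) ≼ z → PrimeAppended h x a z
  prime-remove {h} {x} {a} {z} p q c = subst (λ t → PrimeAppended h t a z) (Listₚ.++-identityʳ x) (prime-≼ p q c refl)

  prime-slide : ∀ {b} ℓ r → Path m′ b 0 → (zeros ℓ ++ true ∷ b ++ false ∷ r) ≼ (true ∷ b ++ false ∷ zeros ℓ ++ r)
  prime-slide zero r q = ε
  prime-slide (suc ℓ) r q = ≼-prepend (false ∷ []) (prime-slide ℓ r q) ◅◅ (here q ◅ ε)

  -- Converse of `prime-remove`: raise the part before the prime, raise the prime, then let it slide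
  -- left through the zeros one cover at a time.
  prime-insert : ∀ {x a w b} ℓ → Path m′ a 0 → x ≼ (w ++ zeros ℓ) → a ≼ b →
    (x ++ true ∷ a ++ false ∷ []) ≼ (w ++ true ∷ b ++ false ∷ zeros ℓ)
  prime-insert {x} {a} {w} {b} ℓ q c d =
    ≼-append (true ∷ a ++ false ∷ []) c
    ◅◅ ≼-prepend (w ++ zeros ℓ) (≼-prepend (true ∷ []) (≼-append (false ∷ []) d))
    ◅◅ ≼-reflexive (Listₚ.++-assoc w (zeros ℓ) _)
    ◅◅ ≼-prepend w (prime-slide ℓ [] (path-≼ q d))
    ◅◅ ≼-reflexive (cong (λ t → w ++ true ∷ b ++ false ∷ t) (Listₚ.++-identityʳ (zeros ℓ)))

-- Final descents, and insertion before the last letters of a word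

leadingZeros-zeros : ∀ ℓ r → leadingZeros (zeros ℓ ++ r) ≡ ℓ + leadingZeros r
leadingZeros-zeros zero r = refl
leadingZeros-zeros (suc ℓ) r = cong suc (leadingZeros-zeros ℓ r)

leadingZeros-true : ∀ r s → leadingZeros (r ++ true ∷ s) ≡ leadingZeros (r ++ true ∷ [])
leadingZeros-true [] s = refl
leadingZeros-true (true ∷ r) s = refl
leadingZeros-true (false ∷ r) s = cong suc (leadingZeros-true r s)

leadingZeros-∷ʳtrue : ∀ r → leadingZeros (r ++ true ∷ []) ≡ leadingZeros r
leadingZeros-∷ʳtrue [] = refl
leadingZeros-∷ʳtrue (true ∷ r) = refl
leadingZeros-∷ʳtrue (false ∷ r) = cong suc (leadingZeros-∷ʳtrue r)

leadingZeros-split : ∀ ℓ r → ℓ ≤ leadingZeros r → ∃ λ r′ → r ≡ zeros ℓ ++ r′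
leadingZeros-split zero r le = r , refl
leadingZeros-split (suc ℓ) (false ∷ r) (s≤s le) = let r′ , e = leadingZeros-split ℓ r le in r′ , cong (false ∷_) e

reverse-zeros : ∀ ℓ → reverse (zeros ℓ) ≡ zeros ℓ
reverse-zeros zero = refl
reverse-zeros (suc ℓ) = trans (Listₚ.unfold-reverse false (zeros ℓ)) (trans (cong (_++ false ∷ []) (reverse-zeros ℓ))
  (trans (sym (zeros-+ ℓ 1)) (cong zeros (ℕₚ.+-comm ℓ 1))))

finalDescent-zeros : ∀ w ℓ → finalDescent (w ++ zeros ℓ) ≡ ℓ + finalDescent w
finalDescent-zeros w ℓ = trans (cong leadingZeros (trans (Listₚ.reverse-++ w (zeros ℓ)) (cong (_++ reverse w) (reverse-zeros ℓ))))
  (leadingZeros-zeros ℓ (reverse w))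

finalDescent-true : ∀ w b → finalDescent (w ++ true ∷ b) ≡ finalDescent b
finalDescent-true w b = begin
  leadingZeros (reverse (w ++ true ∷ b)) ≡⟨ cong leadingZeros (Listₚ.reverse-++ w (true ∷ b)) ⟩
  leadingZeros (reverse (true ∷ b) ++ reverse w) ≡⟨ cong (λ r → leadingZeros (r ++ reverse w)) (Listₚ.unfold-reverse true b) ⟩
  leadingZeros ((reverse b ++ true ∷ []) ++ reverse w) ≡⟨ cong leadingZeros (Listₚ.++-assoc (reverse b) _ _) ⟩
  leadingZeros (reverse b ++ true ∷ reverse w) ≡⟨ leadingZeros-true (reverse b) (reverse w) ⟩
  leadingZeros (reverse b ++ true ∷ []) ≡⟨ leadingZeros-∷ʳtrue (reverse b) ⟩
  finalDescent b ∎
  where open ≡.≡-Reasoning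

finalDescent-split : ∀ ℓ w → ℓ ≤ finalDescent w → ∃ λ w′ → w ≡ w′ ++ zeros ℓ
finalDescent-split ℓ w le with leadingZeros-split ℓ (reverse w) le
... | r , e = reverse r , (begin
  w ≡⟨ Listₚ.reverse-involutive w ⟨
  reverse (reverse w) ≡⟨ cong reverse e ⟩
  reverse (zeros ℓ ++ r) ≡⟨ Listₚ.reverse-++ (zeros ℓ) r ⟩
  reverse r ++ reverse (zeros ℓ) ≡⟨ cong (reverse r ++_) (reverse-zeros ℓ) ⟩
  reverse r ++ zeros ℓ ∎)
  where open ≡.≡-Reasoning

downs-++ : ∀ a b → downs (a ++ b) ≡ downs a + downs b
downs-++ [] b = refl
downs-++ (true ∷ a) b = downs-++ a b
downs-++ (false ∷ a) b = cong suc (downs-++ a b)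

downs-zeros : ∀ ℓ → downs (zeros ℓ) ≡ ℓ
downs-zeros zero = refl
downs-zeros (suc ℓ) = cong suc (downs-zeros ℓ)

ups-zeros : ∀ ℓ → ups (zeros ℓ) ≡ 0
ups-zeros zero = refl
ups-zeros (suc ℓ) = ups-zeros ℓ

finalDescent≤downs : ∀ w → finalDescent w ≤ downs w
finalDescent≤downs w with finalDescent-split (finalDescent w) w ℕₚ.≤-refl
... | w′ , e = ℕₚ.≤-trans (ℕₚ.≤-trans (ℕₚ.≤-reflexive (sym (downs-zeros (finalDescent w)))) (ℕₚ.m≤n+m _ (downs w′)))
  (ℕₚ.≤-reflexive (trans (sym (downs-++ w′ (zeros (finalDescent w)))) (cong downs (sym e))))

-- A function of bare words, so that the composed path is computed without consulting the irrelevant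
-- proof of its shape.
insertBefore : ℕ → Word → Word → Word
insertBefore ℓ q w = take (length w ∸ ℓ) w ++ q ++ zeros ℓ

insertBefore-zeros : ∀ ℓ q w → insertBefore ℓ q (w ++ zeros ℓ) ≡ w ++ q ++ zeros ℓ
insertBefore-zeros ℓ q w = cong (_++ q ++ zeros ℓ) (begin
  take (length (w ++ zeros ℓ) ∸ ℓ) (w ++ zeros ℓ)
    ≡⟨ cong (λ j → take (j ∸ ℓ) (w ++ zeros ℓ)) (trans (Listₚ.length-++ w) (cong (length w +_) (Listₚ.length-replicate ℓ))) ⟩
  take (length w + ℓ ∸ ℓ) (w ++ zeros ℓ) ≡⟨ cong (λ j → take j (w ++ zeros ℓ)) (ℕₚ.m+n∸n≡m (length w) ℓ) ⟩
  take (length w) (w ++ zeros ℓ) ≡⟨ take-length w (zeros ℓ) ⟩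
  w ∎)
  where
  open ≡.≡-Reasoning
  take-length : ∀ (w r : Word) → take (length w) (w ++ r) ≡ w
  take-length [] r = refl
  take-length (b ∷ w) r = cong (b ∷_) (take-length w r)

-- Dyck words, covers and shapes in terms of paths

module Translation (m′ : ℕ) where

  open Paths m′

  path-nonneg : ∀ {h w k} → Path h w k → T (nonneg m h w)
  path-nonneg [] = _
  path-nonneg (up p) = path-nonneg p
  path-nonneg (dn p) = path-nonneg p

  nonneg-path : ∀ h w → T (nonneg m h w) → ∃ λ k → Path h w k
  nonneg-path h [] t = h , []
  nonneg-path h (true ∷ w) t = let k , p = nonneg-path (h + m) w t in k , up p
  nonneg-path (suc h) (false ∷ w) t = let k , p = nonneg-path h w t in k , dn p

  path-height : ∀ {h w k} → Path h w k → k + downs w ≡ h + m * ups w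
  path-height {h} [] = cong (h +_) (sym (ℕₚ.*-zeroʳ m))
  path-height {h} (up {w = w} p) = trans (path-height p) (trans (ℕₚ.+-assoc h m (m * ups w)) (cong (h +_) (sym (ℕₚ.*-suc m (ups w)))))
  path-height {k = k} (dn {w = w} p) = trans (ℕₚ.+-suc k (downs w)) (cong suc (path-height p))

  dyck-path : ∀ {n w} → IsDyck m n w → Path 0 w 0
  dyck-path {n} {w} (u , d , t) with nonneg-path 0 w t
  ... | k , p = subst (Path 0 w) (ℕₚ.+-cancelʳ-≡ (m * n) k 0 (trans (cong (k +_) (sym d)) (trans (path-height p) (cong (m *_) u)))) p

  path-dyck : ∀ {n w} → Path 0 w 0 → ups w ≡ n → IsDyck m n w
  path-dyck p refl = refl , path-height p , path-nonneg p

  path-dyckAny : ∀ {w} → Path 0 w 0 → IsDyckAny m w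
  path-dyckAny {w} p = ups w , path-dyck p refl

  wrap-path : ∀ {x} → Path m′ x 0 → Path 0 (true ∷ x ++ false ∷ []) 0
  wrap-path p = up (path-++ (path-raise 1 p) (dn []))

  -- The first return to the axis cuts a Dyck path 1 x 0 off the factor, and minimality leaves
  -- nothing behind it.
  cover⇒⋖ : ∀ {w w′} → Cover m w w′ → w ⋖ w′
  cover⇒⋖ (swap p u s (n , dyck) nonempty minimal) with u | dyck-path {n} {u} dyck
  ... | [] | _ = ⊥-elim (nonempty refl)
  ... | true ∷ v | up q with first-passage 0 m′ refl q
  ... | x , _ ∷ _ , refl , px , py =
        ⊥-elim (minimal (true ∷ x ++ false ∷ []) _ (cong (true ∷_) (sym (Listₚ.++-assoc x (false ∷ []) _))) (λ ()) (λ ())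
          (path-dyckAny (wrap-path px)))
  ... | x , [] , refl , px , _ = subst₂ (λ a b → (p ++ false ∷ true ∷ a) ⋖ (p ++ true ∷ b))
        (sym (Listₚ.++-assoc x (false ∷ []) s)) (sym (Listₚ.++-assoc x (false ∷ []) (false ∷ s)))
        (⋖-prepend p (here px))

  ⋖⇒cover : ∀ {w w′} → w ⋖ w′ → Cover m w w′
  ⋖⇒cover c = go [] c
    where
    go : ∀ p {w w′} → w ⋖ w′ → Cover m (p ++ w) (p ++ w′)
    go p (there {b} {w} {w′} c) = subst₂ (Cover m) (Listₚ.++-assoc p (b ∷ []) w) (Listₚ.++-assoc p (b ∷ []) w′) (go (p ++ b ∷ []) c)
    go p (here {x} {s} px) = subst₂ (λ a b → Cover m (p ++ false ∷ true ∷ a) (p ++ true ∷ b))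
      (Listₚ.++-assoc x (false ∷ []) s) (Listₚ.++-assoc x (false ∷ []) (false ∷ s))
      (swap p (true ∷ x ++ false ∷ []) s (path-dyckAny (wrap-path px)) (λ ()) minimal)
      where
      minimal : ∀ a b → true ∷ x ++ false ∷ [] ≡ a ++ b → a ≢ [] → b ≢ [] → ¬ IsDyckAny m a
      minimal [] b e a≢ b≢ d = a≢ refl
      minimal (c ∷ a) b e a≢ b≢ (n , d) with dyck-path {n} {c ∷ a} d
      ... | up q with first-passage-extends 0 refl px q (Listₚ.∷-injectiveʳ e)
      ... | [] , _ , e′ , _ = b≢ (sym e′)
      ... | _ ∷ _ , _ , () , _

  tamari⇒≼ : ∀ {v w} → TamariLe m v w → v ≼ w
  tamari⇒≼ = gmap (λ w → w) cover⇒⋖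

  ≼⇒tamari : ∀ {v w} → v ≼ w → TamariLe m v w
  ≼⇒tamari = gmap (λ w → w) ⋖⇒cover

  descents : List Word → Word
  descents ws = concat (map (false ∷_) ws)

  descents-padded : ∀ ws a → descents (ws ++ replicate a []) ≡ descents ws ++ zeros a
  descents-padded [] zero = refl
  descents-padded [] (suc a) = cong (false ∷_) (descents-padded [] a)
  descents-padded (w ∷ ws) a = cong (false ∷_) (trans (cong (w ++_) (descents-padded ws a)) (sym (Listₚ.++-assoc w (descents ws) (zeros a))))

  descents-path : ∀ {ws} → All (IsDyckAny m) ws → Path (length ws) (descents ws) 0
  descents-path [] = []
  descents-path {w ∷ ws} ((n , d) ∷ ds) = dn (path-++
    (subst (λ j → Path j w (length ws)) (ℕₚ.+-identityʳ _) (subst (Path (length ws + 0) w) (ℕₚ.+-identityʳ _) (path-raise (length ws) (dyck-path {n} {w} d))))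
    (descents-path ds))

  path-descents : ∀ h {y} → Path h y 0 → ∃ λ w → ∃ λ ws → y ≡ w ++ descents ws × IsDyckAny m w × length ws ≡ h × All (IsDyckAny m) ws
  path-descents zero {y} p = y , [] , sym (Listₚ.++-identityʳ y) , path-dyckAny p , refl , []
  path-descents (suc h) p with first-passage h 0 (ℕₚ.+-comm 1 h) p
  ... | x , r , refl , px , pr with path-descents h pr
  ... | w , ws , e , dw , l , dws = x , w ∷ ws , cong (λ t → x ++ false ∷ t) e , path-dyckAny px , cong suc l , dw ∷ dws

  -- With h = i - 1, the empty last components contribute the m - h final zeros, and w_1 0 w_2 ... 0
  -- w_i descends from h to 0.
  shape⇒path : ∀ h {v} → JShape m (suc h) v → ∃ λ y → v ≡ true ∷ y ++ zeros (m ∸ h) × Path h y 0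
  shape⇒path h (w ∷ ws , l , (n , d) ∷ ds , e) = w ++ descents ws ,
    trans e (cong (true ∷_) (trans (cong (w ++_) (descents-padded ws (m ∸ h))) (sym (Listₚ.++-assoc w (descents ws) _)))) ,
    subst (λ j → Path j (w ++ descents ws) 0) (ℕₚ.suc-injective l)
      (path-++ (subst (λ j → Path j w (length ws)) (ℕₚ.+-identityʳ _) (subst (Path (length ws + 0) w) (ℕₚ.+-identityʳ _) (path-raise (length ws) (dyck-path {n} {w} d))))
               (descents-path ds))

  path⇒shape : ∀ h {v} y → v ≡ true ∷ y ++ zeros (m ∸ h) → Path h y 0 → JShape m (suc h) v
  path⇒shape h y e p with path-descents h p
  ... | w , ws , refl , dw , l , dws = w ∷ ws , cong suc l , dw ∷ dws ,
    trans e (cong (true ∷_) (trans (Listₚ.++-assoc w (descents ws) _) (cong (w ++_) (sym (descents-padded ws (m ∸ h))))))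

  shape₀ : ∀ {v} → JShape m 0 v → v ≡ true ∷ zeros m
  shape₀ ([] , _ , _ , e) = trans e (cong (true ∷_) (descents-padded [] m))

  zeros-shape₀ : JShape m 0 (true ∷ zeros m)
  zeros-shape₀ = [] , refl , [] , cong (true ∷_) (sym (descents-padded [] m))

-- Counting intervals

sumℕ : ℕ → (ℕ → ℕ) → ℕ
sumℕ zero f = 0
sumℕ (suc n) f = sumℕ n f + f n

-- A nested sum instead of a bounded index, mirroring the recursion of `sumℕ`; its elements carry no
-- proof of i < n.
Below : ℕ → (ℕ → Set) → Set
Below zero A = ⊥
Below (suc n) A = Below n A ⊎ A n

Below-↔ : ∀ {A f} n → (∀ i → Fin (f i) ↔ A i) → Fin (sumℕ n f) ↔ Below n A
Below-↔ zero h = Finₚ.0↔⊥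
Below-↔ (suc n) h = ↔-trans Finₚ.+↔⊎ (Below-↔ n h ⊎-↔ h n)

module _ {A : ℕ → Set} where

  inject : ∀ n {i} → i < n → A i → Below n A
  inject (suc n) {i} i<1+n x with ℕₚ.m≤n⇒m<n∨m≡n (ℕ.s≤s⁻¹ i<1+n)
  ... | inj₁ i<n = inj₁ (inject n i<n x)
  ... | inj₂ refl = inj₂ x

  index : ∀ n → Below n A → Σ ℕ A
  index (suc n) (inj₁ b) = index n b
  index (suc n) (inj₂ x) = n , x

  index-< : ∀ n b → proj₁ (index n b) < n
  index-< (suc n) (inj₁ b) = ℕₚ.m≤n⇒m≤1+n (index-< n b)
  index-< (suc n) (inj₂ x) = ℕₚ.≤-refl

  index-inject : ∀ n {i} (i<n : i < n) x → index n (inject n i<n x) ≡ (i , x)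
  index-inject (suc n) {i} i<1+n x with ℕₚ.m≤n⇒m<n∨m≡n (ℕ.s≤s⁻¹ i<1+n)
  ... | inj₁ i<n = index-inject n i<n x
  ... | inj₂ refl = refl

  index-injective : ∀ n {b c} → index n b ≡ index n c → b ≡ c
  index-injective (suc n) {inj₁ b} {inj₁ c} h = cong inj₁ (index-injective n h)
  index-injective (suc n) {inj₁ b} {inj₂ y} h = ⊥-elim (ℕₚ.<-irrefl (cong proj₁ h) (index-< n b))
  index-injective (suc n) {inj₂ x} {inj₁ c} h = ⊥-elim (ℕₚ.<-irrefl (cong proj₁ (sym h)) (index-< n c))
  index-injective (suc n) {inj₂ x} {inj₂ y} refl = refl

if-↔ : ∀ {A : Set} {N} b → Fin N ↔ A → Fin (if b then N else 0) ↔ (T b × A)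
if-↔ true h = ↔-trans h (mk↔ₛ′ (λ x → _ , x) proj₂ (λ _ → refl) (λ _ → refl))
if-↔ false h = mk↔ₛ′ (λ ()) (λ ()) (λ ()) (λ ())

-- Read in `Fin`, equality of two elements and existence of a preimage are decidable, hence
-- recomputable from irrelevant evidence.
count-unique : ∀ {X Y : Set} {N c} → Fin N ↔ X → Fin c ↔ Y → (f : X → Y) →
  (∀ x x′ → f x ≡ f x′ → Irrelevant (x ≡ x′)) → (∀ y → Irrelevant (∃ λ x → f x ≡ y)) → N ≡ c
count-unique {X} {Y} {N} {c} iX iY f injective surjective = ℕₚ.≤-antisym
  (Finₚ.injective⇒≤ {f = λ i → Y.from (f (X.to i))} (λ {i} {j} h → fin-injective i j (Y-from-injective h)))
  (Finₚ.injective⇒≤ {f = section} (λ {i} {j} h → trans (sym (section-eq i)) (trans (cong (λ l → Y.from (f (X.to l))) h) (section-eq j))))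
  where
  module X = Inverse iX
  module Y = Inverse iY
  Y-from-injective : ∀ {y y′} → Y.from y ≡ Y.from y′ → y ≡ y′
  Y-from-injective {y} {y′} h = trans (sym (Y.strictlyInverseˡ y)) (trans (cong Y.to h) (Y.strictlyInverseˡ y′))
  fin-injective : ∀ i j → f (X.to i) ≡ f (X.to j) → i ≡ j
  fin-injective i j h with injective _ _ h
  ... | [ e ] = recompute (i Finₚ.≟ j)
    (trans (sym (X.strictlyInverseʳ i)) (trans (cong X.from e) (X.strictlyInverseʳ j)))
  preimage : ∀ l → ∃ λ i → Y.from (f (X.to i)) ≡ l
  preimage l with surjective (Y.to l)
  ... | [ s ] = recompute (Finₚ.any? (λ i → Y.from (f (X.to i)) Finₚ.≟ l))
    (X.from (proj₁ s) , trans (cong (λ x → Y.from (f x)) (X.strictlyInverseˡ (proj₁ s))) (trans (cong Y.from (proj₂ s)) (Y.strictlyInverseʳ l)))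
  section : Fin c → Fin N
  section l = proj₁ (preimage l)
  section-eq : ∀ l → Y.from (f (X.to (section l))) ≡ l
  section-eq l = proj₂ (preimage l)

-- Inserting a prime factor into an interval

module Decomposition (m′ : ℕ) where

  open Paths m′
  open Intervals m′
  open Translation m′

  Valid : ℕ → ℕ → ℕ → Word → Word → Set
  Valid i n k v w = 1 ≤ n × IsDyck m n v × IsDyck m n w × TamariLe m v w × JShape m i v × finalDescent w ≡ k

  -- Between the initial 1 and the final 0^{m-h}, the two paths of an interval of type h + 1 are paths y ≼ z from height h to 0.
  record Core (h n k : ℕ) (v w : Word) : Set where
    constructor core
    field
      {y z} : Word
      v-shape : v ≡ true ∷ y ++ zeros (m ∸ h)
      w-shape : w ≡ true ∷ z ++ zeros (m ∸ h)
      y-path : Path h y 0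
      y≼z : y ≼ z
      size : suc (ups y) ≡ n
      descent : (m ∸ h) + finalDescent z ≡ k

  finalDescent-core : ∀ z ℓ → finalDescent (true ∷ z ++ zeros ℓ) ≡ ℓ + finalDescent z
  finalDescent-core z ℓ = trans (finalDescent-true [] (z ++ zeros ℓ)) (finalDescent-zeros z ℓ)

  ups-core : ∀ y ℓ → ups (true ∷ y ++ zeros ℓ) ≡ suc (ups y)
  ups-core y ℓ = cong suc (trans (ups-++ y (zeros ℓ)) (trans (cong (ups y +_) (ups-zeros ℓ)) (ℕₚ.+-identityʳ _)))

  core-path : ∀ {h y} → h ≤ m → Path h y 0 → Path 0 (true ∷ y ++ zeros (m ∸ h)) 0
  core-path {h} {y} h≤m p = up (path-++ (subst (λ j → Path j y ((m ∸ h) + 0)) (ℕₚ.m∸n+n≡m h≤m) (path-raise (m ∸ h) p)) (path-zeros (m ∸ h)))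

  valid⇒core : ∀ {h n k v w} → Valid (suc h) n k v w → Core h n k v w
  valid⇒core {h} (_ , dv , dw , le , shape , fd) with shape⇒path h shape
  ... | y , refl , py with tamari⇒≼ le
  ... | l = below l py dv fd
    where
    below : ∀ {y w n k} → (true ∷ y ++ zeros (m ∸ h)) ≼ w → Path h y 0 → IsDyck m n (true ∷ y ++ zeros (m ∸ h)) → finalDescent w ≡ k →
      Core h n k (true ∷ y ++ zeros (m ∸ h)) w
    below {y} l py (u , _) fd = finish (under-true l)
      where
      under-true : ∀ {t w} → (true ∷ t) ≼ w → ∃ λ t′ → w ≡ true ∷ t′ × t ≼ t′
      under-true ε = _ , refl , ε
      under-true (there c ◅ cs) = let t′ , e , l = under-true cs in t′ , e , c ◅ l
      finish : (∃ λ t → _ ≡ true ∷ t × (y ++ zeros (m ∸ h)) ≼ t) → _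
      finish (t , refl , l) with ≼-before-zeros (m ∸ h) py l
      ... | z , y≼z , refl = core refl refl py y≼z (trans (sym (ups-core y (m ∸ h))) u)
        (trans (sym (finalDescent-core z (m ∸ h))) fd)

  core⇒valid : ∀ {h n k v w} → h ≤ m → Core h n k v w → Valid (suc h) n k v w
  core⇒valid {h} h≤m (core {y} {z} refl refl py l refl refl) =
    s≤s z≤n , path-dyck (core-path h≤m py) (ups-core y (m ∸ h)) ,
    path-dyck (core-path h≤m (path-≼ py l)) (trans (ups-core z (m ∸ h)) (cong suc (sym (ups-≼ l)))) ,
    ≼⇒tamari (≼-prepend (true ∷ []) (≼-append (zeros (m ∸ h)) l)) ,
    path⇒shape h y refl py , finalDescent-core z (m ∸ h)

  m∸m′ : m ∸ m′ ≡ 1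
  m∸m′ = ℕₚ.m+n∸n≡m 1 m′

  -- The words ((P , q) , (v₀ , w₀)): the prime interval [P,q] and the interval [v₀,w₀] that remains
  -- without it.
  Key : Set
  Key = (Word × Word) × (Word × Word)

  -- In the composed upper path k - `descent` letters follow q, and at least m - h of them must;
  -- `surplus` tells how much further to the left the final descent of w₀ extends.
  record Parts (h n k : ℕ) (key : Key) : Set where
    constructor parts
    private
      P = proj₁ (proj₁ key)
      q = proj₂ (proj₁ key)
      v₀ = proj₁ (proj₂ key)
      w₀ = proj₂ (proj₂ key)
    field
      {size descent surplus} : ℕ
      size≤ : size ≤ n
      descent≤ : descent ≤ k
      enough : m ∸ h ≤ k ∸ descent
      last-factor : Valid m size descent P q
      rest : Valid (suc h) (n ∸ size) (k ∸ descent + surplus) v₀ w₀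

  -- As q is followed by zeros only, the final descent k of the result is that of q plus the number
  -- of letters after q; this fixes where q goes.
  assemble : ℕ → ℕ → Key → Word × Word
  assemble h k ((P , q) , (v₀ , w₀)) = insertBefore (m ∸ h) P v₀ , insertBefore (k ∸ finalDescent q) q w₀

  -- The same data spelled out through the factors of the paths, the form to which uniqueness of
  -- factorisations applies.
  record Assembled (h n k : ℕ) (key : Key) : Set where
    constructor assembled
    field
      {a b y f} : Word
      {ℓ} : ℕ
      key≡ : key ≡ ((true ∷ a ++ false ∷ [] , true ∷ b ++ false ∷ []) ,
                    (true ∷ y ++ zeros (m ∸ h) , true ∷ (f ++ zeros ℓ) ++ zeros (m ∸ h)))
      result : assemble h k key ≡ (true ∷ (y ++ true ∷ a ++ false ∷ []) ++ zeros (m ∸ h) ,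
                                   true ∷ (f ++ true ∷ b ++ false ∷ zeros ℓ) ++ zeros (m ∸ h))
      a-path : Path m′ a 0
      y-path : Path h y 0
      a≼b : a ≼ b
      y≼fz : y ≼ f ++ zeros ℓ
      size : suc (ups y) + suc (ups a) ≡ n
      descent : (m ∸ h) + finalDescent (f ++ true ∷ b ++ false ∷ zeros ℓ) ≡ k

  finalDescent-prime : ∀ f b ℓ → finalDescent (f ++ true ∷ b ++ false ∷ zeros ℓ) ≡ suc ℓ + finalDescent b
  finalDescent-prime f b ℓ = trans (finalDescent-true f (b ++ zeros (suc ℓ))) (finalDescent-zeros b (suc ℓ))

  insert-prime : ∀ α ℓ f q → insertBefore (ℓ + α) q (true ∷ (f ++ zeros ℓ) ++ zeros α) ≡ true ∷ (f ++ q ++ zeros ℓ) ++ zeros α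
  insert-prime α ℓ f q = begin
    insertBefore (ℓ + α) q (true ∷ (f ++ zeros ℓ) ++ zeros α)
      ≡⟨ cong (λ t → insertBefore (ℓ + α) q (true ∷ t)) (trans (Listₚ.++-assoc f (zeros ℓ) (zeros α)) (cong (f ++_) (sym (zeros-+ ℓ α)))) ⟩
    insertBefore (ℓ + α) q ((true ∷ f) ++ zeros (ℓ + α)) ≡⟨ insertBefore-zeros (ℓ + α) q (true ∷ f) ⟩
    (true ∷ f) ++ q ++ zeros (ℓ + α) ≡⟨ cong (λ t → true ∷ f ++ q ++ t) (zeros-+ ℓ α) ⟩
    true ∷ f ++ q ++ zeros ℓ ++ zeros α ≡⟨ cong (λ t → true ∷ f ++ t) (Listₚ.++-assoc q (zeros ℓ) (zeros α)) ⟨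
    true ∷ f ++ (q ++ zeros ℓ) ++ zeros α ≡⟨ cong (true ∷_) (Listₚ.++-assoc f (q ++ zeros ℓ) (zeros α)) ⟨
    true ∷ (f ++ q ++ zeros ℓ) ++ zeros α ∎
    where open ≡.≡-Reasoning

  parts⇒assembled : ∀ {h n k key} → Parts h n k key → Assembled h n k key
  parts⇒assembled {h} {n} {k} (parts {A} {B} {j} A≤ B≤ α≤ last rest)
    with valid⇒core {m′} last | valid⇒core rest
  ... | core {a} {b} refl refl pa a≼b sa db | core {y} {z} refl refl py y≼z sy dz
    rewrite m∸m′ with finalDescent-split ((k ∸ B) ∸ (m ∸ h)) z ℓ≤
    where
    ℓ≤ : (k ∸ B) ∸ (m ∸ h) ≤ finalDescent z
    ℓ≤ = ℕₚ.m≤n+o⇒m∸n≤o (k ∸ B) (m ∸ h) (ℕₚ.≤-trans (ℕₚ.m≤m+n (k ∸ B) j) (ℕₚ.≤-reflexive (sym dz)))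
  ... | f , refl = assembled {ℓ = ℓ} refl
        (cong₂ _,_ (trans (insertBefore-zeros (m ∸ h) _ (true ∷ y)) (cong (true ∷_) (sym (Listₚ.++-assoc y _ _))))
          (trans (cong (λ e → insertBefore e q (true ∷ (f ++ zeros ℓ) ++ zeros (m ∸ h))) position)
            (trans (insert-prime (m ∸ h) ℓ f q) (cong (λ t → true ∷ (f ++ true ∷ t) ++ zeros (m ∸ h)) (Listₚ.++-assoc b (false ∷ []) (zeros ℓ))))))
        pa py a≼b y≼z (trans (cong₂ _+_ sy sa) (ℕₚ.m∸n+n≡m A≤)) total
    where
    ℓ = (k ∸ B) ∸ (m ∸ h)
    q = true ∷ b ++ false ∷ []
    fd-q : finalDescent q ≡ B
    fd-q = trans (finalDescent-core b 1) db
    position : k ∸ finalDescent q ≡ ℓ + (m ∸ h)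
    position = trans (cong (k ∸_) fd-q) (sym (ℕₚ.m∸n+n≡m α≤))
    total : (m ∸ h) + finalDescent (f ++ true ∷ b ++ false ∷ zeros ℓ) ≡ k
    total = begin
      (m ∸ h) + finalDescent (f ++ true ∷ b ++ false ∷ zeros ℓ) ≡⟨ cong ((m ∸ h) +_) (finalDescent-prime f b ℓ) ⟩
      (m ∸ h) + (suc ℓ + finalDescent b) ≡⟨ cong ((m ∸ h) +_) (trans (sym (ℕₚ.+-suc ℓ (finalDescent b))) (cong (ℓ +_) db)) ⟩
      (m ∸ h) + (ℓ + B) ≡⟨ ℕₚ.+-assoc (m ∸ h) ℓ B ⟨
      (m ∸ h) + ℓ + B ≡⟨ cong (_+ B) (trans (ℕₚ.+-comm (m ∸ h) ℓ) (ℕₚ.m∸n+n≡m α≤)) ⟩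
      (k ∸ B) + B ≡⟨ ℕₚ.m∸n+n≡m B≤ ⟩
      k ∎
      where open ≡.≡-Reasoning

  assembled-core : ∀ {h n k key} → Assembled h n k key → Core h n k (proj₁ (assemble h k key)) (proj₂ (assemble h k key))
  assembled-core {h} {n} {k} {key} (assembled {a} {b} {y} {f} {ℓ} _ r pa py l l′ s d) =
    core (cong proj₁ r) (cong proj₂ r) (path-++ py (wrap-path pa)) (prime-insert ℓ pa l′ l)
      (trans (cong suc (trans (ups-++ y _) (cong (ups y +_) (ups-core a 1)))) s) d

-- The decomposition is a bijection

module Bijection (m′ : ℕ) where

  open Paths m′
  open Intervals m′
  open Translation m′
  open Decomposition m′

  lower-shape : ∀ {h n k v w} → h ≤ m → Core h n k v w →
    JShape m h v ⊎ (∃ λ key → Parts h n k key × assemble h k key ≡ (v , w))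
  lower-shape {h} {n} {k} h≤m (core {y} {z} refl refl py l s d) with last-step py
  ... | inj₁ (refl , refl) = inj₁ zeros-shape₀
  ... | inj₂ (inj₁ (x , h′ , refl , refl , px)) = inj₁ (path⇒shape h′ x
        (cong (true ∷_) (trans (zeros-snoc x (m ∸ suc h′)) (cong (λ j → x ++ zeros j) (sym (ℕₚ.+-∸-assoc 1 h≤m))))) px)
  ... | inj₂ (inj₂ (x , a , refl , px , pa)) with prime-remove px pa l
  ... | primeAppended {f} {b} {ℓ} refl pf pb l₁ l₂ =
        inj₂ (key , p , Assembled.result as)
    where
    α = m ∸ h
    key : Key
    key = (true ∷ a ++ false ∷ [] , true ∷ b ++ false ∷ []) , (true ∷ x ++ zeros α , true ∷ (f ++ zeros ℓ) ++ zeros α)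
    A = suc (ups a)
    B = suc (finalDescent b)
    sizes : suc (ups x) + A ≡ n
    sizes = trans (cong suc (trans (cong (ups x +_) (sym (ups-core a 1))) (sym (ups-++ x _)))) s
    descents′ : (α + ℓ) + B ≡ k
    descents′ = trans (ℕₚ.+-assoc α ℓ B) (trans (cong (α +_) (trans (ℕₚ.+-suc ℓ (finalDescent b)) (sym (finalDescent-prime f b ℓ)))) d)
    k∸B : k ∸ B ≡ α + ℓ
    k∸B = trans (cong (_∸ B) (sym descents′)) (ℕₚ.m+n∸n≡m (α + ℓ) B)
    n∸A : n ∸ A ≡ suc (ups x)
    n∸A = trans (cong (_∸ A) (sym sizes)) (ℕₚ.m+n∸n≡m (suc (ups x)) A)
    one-zero : ∀ t → true ∷ t ++ false ∷ [] ≡ true ∷ t ++ zeros (m ∸ m′)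
    one-zero t = cong (λ j → true ∷ t ++ zeros j) (sym m∸m′)
    p : Parts h n k key
    p = parts {surplus = finalDescent f}
      (subst (A ≤_) sizes (ℕₚ.m≤n+m A (suc (ups x))))
      (subst (B ≤_) descents′ (ℕₚ.m≤n+m B (α + ℓ)))
      (subst (α ≤_) (sym k∸B) (ℕₚ.m≤m+n α ℓ))
      (core⇒valid (ℕₚ.n≤1+n m′) (core (one-zero a) (one-zero b) pa l₂ refl (cong (_+ finalDescent b) m∸m′)))
      (core⇒valid h≤m (core refl refl px l₁ (sym n∸A)
        (trans (cong (α +_) (finalDescent-zeros f ℓ)) (trans (sym (ℕₚ.+-assoc α ℓ _)) (cong (_+ finalDescent f) (sym k∸B))))))
    as : Assembled h n k key
    as = assembled {a = a} {b} {x} {f} {ℓ} refl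
      (cong₂ _,_ (trans (insertBefore-zeros α _ (true ∷ x)) (cong (true ∷_) (sym (Listₚ.++-assoc x _ _))))
        (trans (cong (λ e → insertBefore e (true ∷ b ++ false ∷ []) (true ∷ (f ++ zeros ℓ) ++ zeros α)) position)
          (trans (insert-prime α ℓ f _) (cong (λ t → true ∷ (f ++ true ∷ t) ++ zeros α) (Listₚ.++-assoc b (false ∷ []) (zeros ℓ))))))
      pa px l₂ l₁ sizes d
      where
      position : k ∸ finalDescent (true ∷ b ++ false ∷ []) ≡ ℓ + α
      position = trans (cong (k ∸_) (finalDescent-core b 1)) (trans k∸B (ℕₚ.+-comm α ℓ))

  raise-shape : ∀ {h v} → h ≤ m → JShape m h v → JShape m (suc h) v
  raise-shape {zero} h≤m s = path⇒shape 0 [] (shape₀ s) []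
  raise-shape {suc h} h≤m s with shape⇒path h s
  ... | x , e , px = path⇒shape (suc h) (x ++ false ∷ [])
    (trans e (cong (true ∷_) (trans (cong (λ j → x ++ zeros j) (ℕₚ.+-∸-assoc 1 h≤m)) (sym (zeros-snoc x (m ∸ suc h))))))
    (path-++ (path-raise 1 px) (dn []))

  shapes-disjoint : ∀ {h n k key} → h ≤ m → Assembled h n k key → ¬ JShape m h (proj₁ (assemble h k key))
  shapes-disjoint {zero} h≤m (assembled {a} {y = y} _ r _ _ _ _ _ _) s
    with Listₚ.++-cancelʳ (zeros m) _ [] (Listₚ.∷-injectiveʳ (trans (sym (cong proj₁ r)) (shape₀ s)))
  ... | e = nonempty y e
    where
    nonempty : ∀ y → y ++ true ∷ a ++ false ∷ [] ≢ []
    nonempty [] ()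
    nonempty (_ ∷ _) ()
  shapes-disjoint {suc h} h≤m (assembled {y = y} _ r pa py _ _ _ _) s with shape⇒path h s
  ... | x , e , px = last-steps-disjoint px py (Listₚ.++-cancelʳ (zeros (m ∸ suc h)) _ _ (trans
        (trans (zeros-snoc x (m ∸ suc h)) (cong (λ j → x ++ zeros j) (sym (ℕₚ.+-∸-assoc 1 h≤m))))
        (Listₚ.∷-injectiveʳ (trans (sym e) (cong proj₁ r)))))

  -- Locates q in the upper path: q has as many up steps as P, which the lower path determines, and
  -- a 1 is fixed by the number of up steps after it.
  same-ups-split : ∀ f f′ {r r′} → f ++ true ∷ r ≡ f′ ++ true ∷ r′ → ups r ≡ ups r′ → f ≡ f′ × r ≡ r′
  same-ups-split [] [] e u = refl , Listₚ.∷-injectiveʳ e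
  same-ups-split [] (c ∷ f′) {r} {r′} e u = ⊥-elim (ℕₚ.<-irrefl (sym u)
    (ℕₚ.≤-trans (ℕₚ.m≤n+m (suc (ups r′)) (ups f′)) (ℕₚ.≤-reflexive (sym (trans (cong ups (Listₚ.∷-injectiveʳ e)) (ups-++ f′ (true ∷ r′)))))))
  same-ups-split (c ∷ f) [] {r} {r′} e u = ⊥-elim (ℕₚ.<-irrefl u
    (ℕₚ.≤-trans (ℕₚ.m≤n+m (suc (ups r)) (ups f)) (ℕₚ.≤-reflexive (sym (trans (cong ups (sym (Listₚ.∷-injectiveʳ e))) (ups-++ f (true ∷ r)))))))
  same-ups-split (c ∷ f) (d ∷ f′) e u with Listₚ.∷-injective e
  ... | refl , e′ = let e₁ , e₂ = same-ups-split f f′ e′ u in cong (c ∷_) e₁ , e₂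

  assemble-injective : ∀ {h n k key key′} → Assembled h n k key → Assembled h n k key′ →
    assemble h k key ≡ assemble h k key′ → key ≡ key′
  assemble-injective {h} (assembled {a} {b} {y} {f} {ℓ} e r pa py l _ _ _) (assembled {a′} {b′} {y′} {f′} {ℓ′} e′ r′ pa′ py′ l′ _ _ _) eq
    with last-prime-unique py py′ pa pa′ (Listₚ.++-cancelʳ (zeros (m ∸ h)) _ _ (Listₚ.∷-injectiveʳ (cong proj₁ results)))
    where
    results = trans (sym r) (trans eq r′)
  ... | refl , refl
    with same-ups-split f f′ (Listₚ.++-cancelʳ (zeros (m ∸ h)) _ _ (Listₚ.∷-injectiveʳ (cong proj₂ (trans (sym r) (trans eq r′))))) same-ups
    where
    same-ups : ups (b ++ zeros (suc ℓ)) ≡ ups (b′ ++ zeros (suc ℓ′))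
    same-ups = ℕₚ.suc-injective (trans (ups-core b (suc ℓ)) (trans (cong suc (trans (sym (ups-≼ l)) (ups-≼ l′))) (sym (ups-core b′ (suc ℓ′)))))
  ... | refl , tails with first-passage-unique (path-≼ pa l) (path-≼ pa′ l′) tails
  ... | refl , zs with trans (sym (Listₚ.length-replicate ℓ)) (trans (cong length zs) (Listₚ.length-replicate ℓ′))
  ... | refl = trans e (sym e′)

  words : ∀ {i n k} → IntervalsJ m i n k → Word × Word
  words (I , _) = lower I , upper I

  words-injective : ∀ {i n k} {x x′ : IntervalsJ m i n k} → words x ≡ words x′ → x ≡ x′
  words-injective {x = interval _ _ _ _ _ _ , [ _ ]} {interval _ _ _ _ _ _ , [ _ ]} refl = refl

  fromValid : ∀ {i n k} v w → Irrelevant (Valid i n k v w) → IntervalsJ m i n k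
  fromValid v w [ p ] = interval v w (proj₁ p) (proj₁ (proj₂ p)) (proj₁ (proj₂ (proj₂ p))) (proj₁ (proj₂ (proj₂ (proj₂ p)))) ,
    [ proj₂ (proj₂ (proj₂ (proj₂ p))) ]

  valid : ∀ {i n k} (x : IntervalsJ m i n k) → Irrelevant (Valid i n k (proj₁ (words x)) (proj₂ (words x)))
  valid (interval v w a b c d , [ s ]) = [ (a , b , c , d , s) ]

  size≡ : ∀ {i n k} (x : IntervalsJ m i n k) → ups (proj₁ (words x)) ≡ n
  size≡ {n = n} (interval v w _ d _ _ , _) = recompute (ups v ℕₚ.≟ n) (proj₁ d)

  descent≡ : ∀ {i n k} (x : IntervalsJ m i n k) → finalDescent (proj₂ (words x)) ≡ k
  descent≡ {k = k} (interval v w _ _ _ _ , [ s ]) = recompute (finalDescent w ℕₚ.≟ k) (proj₂ s)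

  -- The coefficient of x^ℓ in (x J - x^{m-h} J(1)) / (x - 1) for J of type h + 1: final descent ℓ +
  -- j with any j ≥ 0, provided ℓ ≥ m - h. The bound m n on j loses nothing, as it bounds final
  -- descents.
  Raised : ℕ → ℕ → ℕ → Set
  Raised h n ℓ = T ((m ∸ h) ℕ.≤ᵇ ℓ) × Below (suc (m * n)) (λ j → IntervalsJ m (suc h) n (ℓ + j))

  -- Cutting the last prime factor P off the part y of the lower path gives an interval [P,q] of type m; q is inserted
  -- before the last k - b letters of the upper path of the remaining interval.
  Composite : ℕ → ℕ → ℕ → Set
  Composite h n k = Below (suc n) λ a → Below (suc k) λ b → IntervalsJ m m a b × Raised h (n ∸ a) (k ∸ b)

  module _ {h n k : ℕ} where

    raisedWords : ∀ {n ℓ} → Σ ℕ (λ j → IntervalsJ m (suc h) n (ℓ + j)) → Word × Word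
    raisedWords (j , y) = words y

    raisedWords-injective : ∀ {n ℓ} (s s′ : Σ ℕ (λ j → IntervalsJ m (suc h) n (ℓ + j))) → raisedWords s ≡ raisedWords s′ → s ≡ s′
    raisedWords-injective {n} {ℓ} (j , y) (j′ , y′) e
      with ℕₚ.+-cancelˡ-≡ ℓ j j′ (trans (sym (descent≡ y)) (trans (cong (λ u → finalDescent (proj₂ u)) e) (descent≡ y′)))
    ... | refl = cong (j ,_) (words-injective e)

    key₂ : ∀ {a} → Σ ℕ (λ b → IntervalsJ m m a b × Raised h (n ∸ a) (k ∸ b)) → Key
    key₂ {a} (b , x , _ , e) = words x , raisedWords {n ∸ a} {k ∸ b} (index (suc (m * (n ∸ a))) e)

    key₂-injective : ∀ {a} (s s′ : Σ ℕ (λ b → IntervalsJ m m a b × Raised h (n ∸ a) (k ∸ b))) → key₂ s ≡ key₂ s′ → s ≡ s′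
    key₂-injective {a} (b , x , t , e) (b′ , x′ , t′ , e′) h≡
      with trans (sym (descent≡ x)) (trans (cong (λ u → finalDescent (proj₂ (proj₁ u))) h≡) (descent≡ x′))
    ... | refl = cong₂ (λ x (r : Raised h (n ∸ a) (k ∸ b)) → b , x , r) (words-injective (cong proj₁ h≡))
      (cong₂ _,_ (T-irrelevant t t′)
        (index-injective (suc (m * (n ∸ a))) (raisedWords-injective {n ∸ a} {k ∸ b} _ _ (cong proj₂ h≡))))

    key₁ : Σ ℕ (λ a → Below (suc k) λ b → IntervalsJ m m a b × Raised h (n ∸ a) (k ∸ b)) → Key
    key₁ (a , e) = key₂ {a} (index (suc k) e)

    key₁-injective : ∀ s s′ → key₁ s ≡ key₁ s′ → s ≡ s′
    key₁-injective (a , e) (a′ , e′) h≡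
      with trans (sym (size≡ (proj₁ (proj₂ (index (suc k) e))))) (trans (cong (λ u → ups (proj₁ (proj₁ u))) h≡) (size≡ (proj₁ (proj₂ (index (suc k) e′)))))
    ... | refl = cong (a ,_) (index-injective (suc k) (key₂-injective _ _ h≡))

    keyOf : Composite h n k → Key
    keyOf e = key₁ (index (suc n) e)

    -- The indices of the nested sums can be read off from the words: they are the size and the
    -- final descent of [P,q] and the final descent of w₀.
    keyOf-injective : ∀ {e e′} → keyOf e ≡ keyOf e′ → e ≡ e′
    keyOf-injective h≡ = index-injective (suc n) (key₁-injective _ _ h≡)

    composite-parts : ∀ e → Irrelevant (Parts h n k (keyOf e))
    composite-parts e = build (index-< (suc n) e) (index-< (suc k) e₁) (valid x) (valid y)
      where
      e₁ = proj₂ (index (suc n) e)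
      a = proj₁ (index (suc n) e)
      b = proj₁ (index (suc k) e₁)
      x = proj₁ (proj₂ (index (suc k) e₁))
      t = proj₁ (proj₂ (proj₂ (index (suc k) e₁)))
      j = proj₁ (index (suc (m * (n ∸ a))) (proj₂ (proj₂ (proj₂ (index (suc k) e₁)))))
      y = proj₂ (index (suc (m * (n ∸ a))) (proj₂ (proj₂ (proj₂ (index (suc k) e₁)))))
      build : a < suc n → b < suc k → Irrelevant (Valid m a b (proj₁ (words x)) (proj₂ (words x))) →
        Irrelevant (Valid (suc h) (n ∸ a) ((k ∸ b) + j) (proj₁ (words y)) (proj₂ (words y))) → Irrelevant (Parts h n k (keyOf e))
      build a< b< [ vx ] [ vy ] = [ parts {surplus = j} (ℕ.s≤s⁻¹ a<) (ℕ.s≤s⁻¹ b<) (ℕₚ.≤ᵇ⇒≤ (m ∸ h) (k ∸ b) t) vx vy ]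

    parts-composite : ∀ {key} → Parts h n k key → ∃ λ e → keyOf e ≡ key
    parts-composite {(P , q) , (v₀ , w₀)} (parts {A} {B} {j} A≤ B≤ α≤ last rest) = e , key-eq
      where
      y : IntervalsJ m (suc h) (n ∸ A) ((k ∸ B) + j)
      y = fromValid v₀ w₀ [ rest ]
      j< : j < suc (m * (n ∸ A))
      j< = s≤s (ℕₚ.≤-trans (ℕₚ.m≤n+m j (k ∸ B)) (ℕₚ.≤-trans (ℕₚ.≤-reflexive (sym (proj₂ (proj₂ (proj₂ (proj₂ (proj₂ rest)))))))
        (ℕₚ.≤-trans (finalDescent≤downs w₀) (ℕₚ.≤-reflexive (proj₁ (proj₂ (proj₁ (proj₂ (proj₂ rest)))))))))
      t : T ((m ∸ h) ℕ.≤ᵇ (k ∸ B))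
      t = ℕₚ.≤⇒≤ᵇ α≤
      e₂ : Below (suc (m * (n ∸ A))) (λ j → IntervalsJ m (suc h) (n ∸ A) ((k ∸ B) + j))
      e₂ = inject (suc (m * (n ∸ A))) j< y
      e₁ : Below (suc k) λ b → IntervalsJ m m A b × Raised h (n ∸ A) (k ∸ b)
      e₁ = inject (suc k) (s≤s B≤) (fromValid P q [ last ] , t , e₂)
      e : Composite h n k
      e = inject (suc n) (s≤s A≤) e₁
      key-eq : keyOf e ≡ ((P , q) , (v₀ , w₀))
      key-eq = trans (cong key₁ (index-inject (suc n) (s≤s A≤) e₁)) (trans (cong (key₂ {A}) (index-inject (suc k) (s≤s B≤) _))
        (cong (λ s → (P , q) , raisedWords {n ∸ A} {k ∸ B} s) (index-inject (suc (m * (n ∸ A))) j< y)))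

    -- Directed from the parts to the interval: its words are computed, and their validity is needed
    -- only irrelevantly.
    decompose : h ≤ m → IntervalsJ m h n k ⊎ Composite h n k → IntervalsJ m (suc h) n k
    decompose h≤m (inj₁ x) = fromValid _ _ (Irr.map (λ { (a , b , c , d , s , f) → a , b , c , d , raise-shape h≤m s , f }) (valid x))
    decompose h≤m (inj₂ e) = fromValid _ _ (Irr.map (λ p → core⇒valid h≤m (assembled-core (parts⇒assembled p))) (composite-parts e))

    decompose-injective : ∀ h≤m x x′ → decompose h≤m x ≡ decompose h≤m x′ → Irrelevant (x ≡ x′)
    decompose-injective h≤m (inj₁ x) (inj₁ x′) e = [ cong inj₁ (words-injective (cong words e)) ]
    decompose-injective h≤m (inj₁ x) (inj₂ c) e = disjoint (valid x) (composite-parts c)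
      where
      disjoint : Irrelevant _ → Irrelevant _ → Irrelevant _
      disjoint [ v ] [ p ] = [ ⊥-elim (shapes-disjoint h≤m (parts⇒assembled p)
        (subst (JShape m h) (cong (λ y → proj₁ (words y)) e) (proj₁ (proj₂ (proj₂ (proj₂ (proj₂ v))))))) ]
    decompose-injective h≤m (inj₂ c) (inj₁ x) e = disjoint (valid x) (composite-parts c)
      where
      disjoint : Irrelevant _ → Irrelevant _ → Irrelevant _
      disjoint [ v ] [ p ] = [ ⊥-elim (shapes-disjoint h≤m (parts⇒assembled p)
        (subst (JShape m h) (cong (λ y → proj₁ (words y)) (sym e)) (proj₁ (proj₂ (proj₂ (proj₂ (proj₂ v))))))) ]
    decompose-injective h≤m (inj₂ c) (inj₂ c′) e = same (composite-parts c) (composite-parts c′)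
      where
      same : Irrelevant _ → Irrelevant _ → Irrelevant _
      same [ p ] [ p′ ] = [ cong inj₂ (keyOf-injective (assemble-injective (parts⇒assembled p) (parts⇒assembled p′) (cong words e))) ]

    decompose-surjective : ∀ h≤m y → Irrelevant (∃ λ x → decompose h≤m x ≡ y)
    decompose-surjective h≤m y = go (valid y)
      where
      go : Irrelevant _ → Irrelevant _
      go [ v ] = [ found (lower-shape h≤m (valid⇒core v)) ]
        where
        found : _ ⊎ _ → ∃ λ x → decompose h≤m x ≡ y
        found (inj₁ s) = inj₁ (fromValid _ _ [ (proj₁ v , proj₁ (proj₂ v) , proj₁ (proj₂ (proj₂ v)) , proj₁ (proj₂ (proj₂ (proj₂ v))) , s ,
          proj₂ (proj₂ (proj₂ (proj₂ (proj₂ v))))) ]) , words-injective refl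
        found (inj₂ (key , p , e)) = let c , e′ = parts-composite p in
          inj₂ c , words-injective (trans (cong (assemble h k) e′) e)

  module _ (cJ : ℕ → ℕ → ℕ → ℕ) (cJ-counts : ∀ i n k → i ≤ suc m → Fin (cJ i n k) ↔ IntervalsJ m i n k) where

    raisedCount : ℕ → ℕ → ℕ → ℕ
    raisedCount h n ℓ = if (m ∸ h) ℕ.≤ᵇ ℓ then sumℕ (suc (m * n)) (λ j → cJ (suc h) n (ℓ + j)) else 0

    count-recurrence : ∀ h n k → h ≤ m →
      cJ (suc h) n k ≡ cJ h n k + sumℕ (suc n) (λ a → sumℕ (suc k) (λ b → cJ m a b * raisedCount h (n ∸ a) (k ∸ b)))
    count-recurrence h n k h≤m = sym (count-unique
      (↔-trans Finₚ.+↔⊎ (cJ-counts h n k (ℕₚ.m≤n⇒m≤1+n h≤m) ⊎-↔ Below-↔ (suc n) (λ a → Below-↔ (suc k) (λ b →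
        ↔-trans Finₚ.*↔× (cJ-counts m a b (ℕₚ.n≤1+n m) ×-↔
          if-↔ ((m ∸ h) ℕ.≤ᵇ (k ∸ b)) (Below-↔ (suc (m * (n ∸ a))) (λ j → cJ-counts (suc h) (n ∸ a) ((k ∸ b) + j) (s≤s h≤m))))))))
      (cJ-counts (suc h) n k (s≤s h≤m))
      (decompose h≤m) (decompose-injective h≤m) (decompose-surjective h≤m))

-- Counts as rational coefficients

fromℕᵘ : ∀ n → ℚ.toℚᵘ (fromℕ n) ℚᵘ.≃ ℚᵘ.mkℚᵘ (ℤ.+ n) 0
fromℕᵘ n = ℚₚ.toℚᵘ-fromℚᵘ (ℚᵘ.mkℚᵘ (ℤ.+ n) 0)

fromℕ-+ : ∀ a b → fromℕ (a + b) ≡ fromℕ a ℚ.+ fromℕ b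
fromℕ-+ a b = ℚₚ.toℚᵘ-injective (ℚᵘₚ.≃-trans (fromℕᵘ (a + b)) (ℚᵘₚ.≃-sym
  (ℚᵘₚ.≃-trans (ℚₚ.toℚᵘ-homo-+ (fromℕ a) (fromℕ b)) (ℚᵘₚ.≃-trans (ℚᵘₚ.+-cong (fromℕᵘ a) (fromℕᵘ b))
    (ℚᵘ.*≡* (cong (ℤ._* ℤ.1ℤ) (cong₂ ℤ._+_ (ℤₚ.*-identityʳ (ℤ.+ a)) (ℤₚ.*-identityʳ (ℤ.+ b)))))))))

fromℕ-* : ∀ a b → fromℕ (a * b) ≡ fromℕ a ℚ.* fromℕ b
fromℕ-* a b = ℚₚ.toℚᵘ-injective (ℚᵘₚ.≃-trans (fromℕᵘ (a * b)) (ℚᵘₚ.≃-sym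
  (ℚᵘₚ.≃-trans (ℚₚ.toℚᵘ-homo-* (fromℕ a) (fromℕ b)) (ℚᵘₚ.≃-trans (ℚᵘₚ.*-cong (fromℕᵘ a) (fromℕᵘ b))
    (ℚᵘ.*≡* (cong (ℤ._* ℤ.1ℤ) (sym (ℤₚ.pos-* a b))))))))

fromℕ-injective : ∀ {a b} → fromℕ a ≡ fromℕ b → a ≡ b
fromℕ-injective {a} {b} h with ℚᵘₚ.≃-trans (ℚᵘₚ.≃-sym (fromℕᵘ a)) (ℚᵘₚ.≃-trans (ℚₚ.toℚᵘ-cong h) (fromℕᵘ b))
... | ℚᵘ.*≡* e = ℤₚ.+-injective (trans (sym (ℤₚ.*-identityʳ (ℤ.+ a))) (trans e (ℤₚ.*-identityʳ (ℤ.+ b))))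

fromℕ-sum : ∀ n f → fromℕ (sumℕ n f) ≡ sumBelow n (λ i → fromℕ (f i))
fromℕ-sum zero f = refl
fromℕ-sum (suc n) f = trans (fromℕ-+ (sumℕ n f) (f n)) (cong (ℚ._+ fromℕ (f n)) (fromℕ-sum n f))

sumℕ-head : ∀ n f → sumℕ (suc n) f ≡ f 0 + sumℕ n (λ i → f (suc i))
sumℕ-head zero f = sym (ℕₚ.+-identityʳ (f 0))
sumℕ-head (suc n) f = trans (cong (_+ f (suc n)) (sumℕ-head n f)) (ℕₚ.+-assoc (f 0) _ _)

sumℕ-zero : ∀ n {f} → (∀ i → f i ≡ 0) → sumℕ n f ≡ 0
sumℕ-zero zero h = refl
sumℕ-zero (suc n) h = cong₂ _+_ (sumℕ-zero n h) (h n)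

count-zero : ∀ {Y : Set} {c} → Fin c ↔ Y → (Y → Irrelevant ⊥) → c ≡ 0
count-zero iY empty = sym (count-unique Finₚ.0↔⊥ iY (λ ()) (λ ()) (λ y → Irr.map ⊥-elim (empty y)))

monomial-coefficient : ∀ α {c} → ConstantInX c → ∀ n k → (xS ↑ α *S c) n k ≡ (if α ℕ.≡ᵇ k then c n 0 else 0ℚ)
monomial-coefficient zero {c} K n zero = coeff (𝕊.⊗-idˡ c) n 0
monomial-coefficient zero {c} K n (suc k) = trans (coeff (𝕊.⊗-idˡ c) n (suc k)) (K n k)
monomial-coefficient (suc α) {c} K n zero = trans (coeff (𝕊.⊗-assoc xS (xS ↑ α) c) n 0) (x-shift₀ (xS ↑ α *S c) n)
monomial-coefficient (suc α) {c} K n (suc k) =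
  trans (coeff (𝕊.⊗-assoc xS (xS ↑ α) c) n (suc k)) (trans (x-shift (xS ↑ α *S c) n k) (monomial-coefficient α {c} K n k))

-- The counting series satisfy the system

module ActualSystem (m′ : ℕ) (cJ : ℕ → ℕ → ℕ → ℕ)
  (cJ-counts : ∀ i n k → i ≤ suc (suc m′) → Fin (cJ i n k) ↔ IntervalsJ (suc m′) i n k) where

  open Paths m′
  open Intervals m′
  open Translation m′
  open Decomposition m′
  open Bijection m′

  count-size0 : ∀ i k → i ≤ suc m → cJ i 0 k ≡ 0
  count-size0 i k i≤ = count-zero (cJ-counts i 0 k i≤) (λ x → Irr.map (λ { (() , _) }) (valid x))

  count-large : ∀ i n k → i ≤ suc m → m * n < k → cJ i n k ≡ 0
  count-large i n k i≤ lt = count-zero (cJ-counts i n k i≤) (λ x → Irr.map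
    (λ { (_ , _ , (_ , d , _) , _ , _ , fd) → ℕₚ.<-irrefl refl (ℕₚ.<-≤-trans lt
      (ℕₚ.≤-trans (ℕₚ.≤-reflexive (sym fd)) (ℕₚ.≤-trans (finalDescent≤downs (proj₂ (words x))) (ℕₚ.≤-reflexive d)))) }) (valid x))

  count-small : ∀ h n k → h ≤ m → k < m ∸ h → cJ (suc h) n k ≡ 0
  count-small h n k h≤m lt = count-zero (cJ-counts (suc h) n k (s≤s h≤m)) (λ x → Irr.map
    (λ v → ℕₚ.<-irrefl refl (ℕₚ.<-≤-trans lt (ℕₚ.≤-trans (ℕₚ.m≤m+n (m ∸ h) _) (ℕₚ.≤-reflexive (Core.descent (valid⇒core v)))))) (valid x))

  -- Type 0 forces the lower path 1 0^m, which has no valley and hence nothing else above it.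
  minimal-interval : ∀ {n k v w} → Valid 0 n k v w → n ≡ 1 × k ≡ m × v ≡ true ∷ zeros m × w ≡ true ∷ zeros m
  minimal-interval (a , b , c , d , s , f) with valid⇒core {0} (a , b , c , d , raise-shape z≤n s , f)
  ... | core {y} {z} vs ws _ l size descent with Listₚ.++-cancelʳ (zeros m) y [] (Listₚ.∷-injectiveʳ (trans (sym vs) (shape₀ s)))
  ... | refl with z | l
  ... | [] | ε = sym size , trans (sym descent) (ℕₚ.+-identityʳ m) , vs , ws
  ... | _ ∷ _ | () ◅ _

  minimal-valid : Valid 0 1 m (true ∷ zeros m) (true ∷ zeros m)
  minimal-valid with core⇒valid {0} z≤n (core {0} {1} {m} {y = []} {z = []} refl refl [] ε refl (ℕₚ.+-identityʳ m))
  ... | a , b , c , d , _ , f = a , b , c , d , zeros-shape₀ , f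

  count-minimal : cJ 0 1 m ≡ 1
  count-minimal = sym (count-unique Finₚ.1↔⊤ (cJ-counts 0 1 m z≤n) (λ _ → fromValid _ _ [ minimal-valid ])
    (λ _ _ _ → [ refl ])
    (λ y → Irr.map (λ v → tt , words-injective (cong₂ _,_ (sym (proj₁ (proj₂ (proj₂ (minimal-interval v)))))
      (sym (proj₂ (proj₂ (proj₂ (minimal-interval v))))))) (valid y)))

  count-minimal-else : ∀ n k → ¬ (n ≡ 1 × k ≡ m) → cJ 0 n k ≡ 0
  count-minimal-else n k no-match = count-zero (cJ-counts 0 n k z≤n)
    (λ x → Irr.map (λ v → no-match (proj₁ (minimal-interval v) , proj₁ (proj₂ (minimal-interval v)))) (valid x))

  J : ℕ → Series
  J i = ofCounts (cJ i)

  -- The number of intervals of final descent at least ℓ; final descents are at most m n, so the sum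
  -- can stop there.
  tail : ℕ → ℕ → ℕ → ℕ
  tail i n ℓ = sumℕ (suc (m * n)) (λ j → cJ i n (ℓ + j))

  value : ℕ → Series
  value i = ofCountsT (λ n → tail i n 0)

  value-constant : ∀ i → ConstantInX (value i)
  value-constant i n k = refl

  tail-step : ∀ i n ℓ → i ≤ suc m → tail i n ℓ ≡ cJ i n ℓ + tail i n (suc ℓ)
  tail-step i n ℓ i≤ = trans (sumℕ-head (m * n) (λ j → cJ i n (ℓ + j))) (cong₂ _+_ (cong (cJ i n) (ℕₚ.+-identityʳ ℓ))
    (trans (sum-shift (m * n)) (trans (sym (ℕₚ.+-identityʳ _)) (cong (sumℕ (m * n) (λ j → cJ i n (suc ℓ + j)) +_)
      (sym (count-large i n (suc ℓ + m * n) i≤ (s≤s (ℕₚ.m≤n+m (m * n) ℓ))))))))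
    where
    sum-shift : ∀ N → sumℕ N (λ j → cJ i n (ℓ + suc j)) ≡ sumℕ N (λ j → cJ i n (suc ℓ + j))
    sum-shift zero = refl
    sum-shift (suc N) = cong₂ _+_ (sum-shift N) (cong (cJ i n) (ℕₚ.+-suc ℓ N))

  tail-large : ∀ i n ℓ → i ≤ suc m → m * n < ℓ → tail i n ℓ ≡ 0
  tail-large i n ℓ i≤ lt = sumℕ-zero (suc (m * n)) (λ j → count-large i n (ℓ + j) i≤ (ℕₚ.<-≤-trans lt (ℕₚ.m≤m+n ℓ j)))

  -- Final descents below m - h do not occur, so up to there the tail is the full count.
  tail-low : ∀ h n ℓ → h ≤ m → ℓ ≤ m ∸ h → tail (suc h) n ℓ ≡ tail (suc h) n 0
  tail-low h n zero h≤m le = refl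
  tail-low h n (suc ℓ) h≤m le = trans
    (sym (trans (tail-step (suc h) n ℓ (s≤s h≤m)) (cong (_+ tail (suc h) n (suc ℓ)) (count-small h n ℓ h≤m le))))
    (tail-low h n ℓ h≤m (ℕₚ.<⇒≤ le))

  difference : ∀ a b c → a ≡ b + c → fromℕ a ℚ.- fromℕ c ≡ fromℕ b
  difference a b c refl = trans (cong (λ q → q ℚ.- fromℕ c) (fromℕ-+ b c))
    (trans (ℚₚ.+-assoc (fromℕ b) (fromℕ c) (ℚ.- fromℕ c)) (trans (cong (fromℕ b ℚ.+_) (ℚₚ.+-inverseʳ (fromℕ c))) (ℚₚ.+-identityʳ _)))

  J~value : ∀ i → i ≤ suc m → J i ~ value i
  J~value i i≤ = congruent
    (λ n → m * n , λ k lt → cong fromℕ (count-large i n k i≤ lt))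
    (λ n → 0 , λ { (suc k) _ → refl })
    -- The quotient of J(x) - J(1) by x - 1: each interval of final descent k contributes (x^k -
    -- 1)/(x - 1), that is 1 at every ℓ < k.
    (λ n ℓ → fromℕ (tail i n (suc ℓ)))
    (λ n → m * n , λ k lt → cong fromℕ (tail-large i n (suc k) i≤ (ℕₚ.m≤n⇒m≤1+n lt)))
    (≋-mk λ { n zero → trans (value₀ n) (sym (x-1₀ (λ n ℓ → fromℕ (tail i n (suc ℓ))) n))
            ; n (suc k) → trans (ℚₚ.+-identityʳ (fromℕ (cJ i n (suc k)))) (trans
                (sym (difference (tail i n (suc k)) (cJ i n (suc k)) (tail i n (suc (suc k))) (tail-step i n (suc k) i≤)))
                (sym (x-1-suc (λ n ℓ → fromℕ (tail i n (suc ℓ))) n k))) })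
    where
    value₀ : ∀ n → fromℕ (cJ i n 0) ℚ.- fromℕ (tail i n 0) ≡ ℚ.- fromℕ (tail i n 1)
    value₀ n = begin
      fromℕ (cJ i n 0) ℚ.- fromℕ (tail i n 0)
        ≡⟨ cong (λ t → fromℕ (cJ i n 0) ℚ.- t) (trans (cong fromℕ (tail-step i n 0 i≤)) (fromℕ-+ (cJ i n 0) (tail i n 1))) ⟩
      fromℕ (cJ i n 0) ℚ.- (fromℕ (cJ i n 0) ℚ.+ fromℕ (tail i n 1))
        ≡⟨ ℚR.solve 2 (λ a b → a ℚR.:- (a ℚR.:+ b) ℚR.:= ℚR.:- b) refl (fromℕ (cJ i n 0)) (fromℕ (tail i n 1)) ⟩
      ℚ.- fromℕ (tail i n 1) ∎
      where open ≡.≡-Reasoning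

  raised : ℕ → Series
  raised h = ofCounts (raisedCount cJ cJ-counts h)

  J-step : ∀ h → h ≤ m → J (suc h) ≋ J h +S J m *S raised h
  J-step h h≤m = ≋-mk λ n k → trans (cong fromℕ (count-recurrence cJ cJ-counts h n k h≤m))
    (trans (fromℕ-+ (cJ h n k) _) (cong (fromℕ (cJ h n k) ℚ.+_)
      (trans (fromℕ-sum (suc n) _) (sumBelow-cong (suc n) (λ a _ →
        trans (fromℕ-sum (suc k) _) (sumBelow-cong (suc k) (λ b _ → fromℕ-* (cJ m a b) _)))))))

  raised-≥ : ∀ h n k → m ∸ h ≤ k → raisedCount cJ cJ-counts h n k ≡ tail (suc h) n k
  raised-≥ h n k le = cong (λ b → if b then tail (suc h) n k else 0) (≤ᵇ-true le)

  raised-< : ∀ h n k → k < m ∸ h → raisedCount cJ cJ-counts h n k ≡ 0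
  raised-< h n k lt = cong (λ b → if b then tail (suc h) n k else 0) (≤ᵇ-false lt)

  ≡ᵇ-refl : ∀ k → (k ℕ.≡ᵇ k) ≡ true
  ≡ᵇ-refl zero = refl
  ≡ᵇ-refl (suc k) = ≡ᵇ-refl k

  ≢-≡ᵇ : ∀ {j k} → j ≢ k → (j ℕ.≡ᵇ k) ≡ false
  ≢-≡ᵇ {j} {k} ne with j ℕ.≡ᵇ k in e
  ... | false = refl
  ... | true = ⊥-elim (ne (ℕₚ.≡ᵇ⇒≡ j k (subst T (sym e) _)))

  -- Beyond m - h two consecutive tails differ by one count. Where the tails set in, the jump is the
  -- full value at x = 1 by `tail-low`, and this is the term with x^{m-h}; below, both sides vanish.
  raised-equation : ∀ h → h ≤ m → (xS -S 1S) *S raised h ≋ xS ⊗ J (suc h) ⊖ xS ↑ (m ∸ h) ⊗ value (suc h)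
  raised-equation h h≤m = ≋-mk λ n k → trans (left n k) (sym (cong (λ q → (xS ⊗ J (suc h)) n k ℚ.- q) (monomial-coefficient α {value (suc h)} (value-constant (suc h)) n k)))
    where
    open ≡.≡-Reasoning
    α = m ∸ h
    r : ℕ → ℕ → ℕ
    r = raisedCount cJ cJ-counts h
    left : ∀ n k → ((xS -S 1S) *S raised h) n k ≡ (xS ⊗ J (suc h)) n k ℚ.- (if α ℕ.≡ᵇ k then value (suc h) n 0 else 0ℚ)
    left n zero = begin
      ((xS -S 1S) *S raised h) n 0 ≡⟨ x-1₀ (raised h) n ⟩
      ℚ.- fromℕ (r n 0) ≡⟨ cong ℚ.-_ (bottom (ℕₚ.m≤n⇒m<n∨m≡n {0} {α} z≤n)) ⟩
      ℚ.- (if α ℕ.≡ᵇ 0 then value (suc h) n 0 else 0ℚ) ≡⟨ ℚₚ.+-identityˡ _ ⟨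
      0ℚ ℚ.- (if α ℕ.≡ᵇ 0 then value (suc h) n 0 else 0ℚ)
        ≡⟨ cong (λ q → q ℚ.- (if α ℕ.≡ᵇ 0 then value (suc h) n 0 else 0ℚ)) (x-shift₀ (J (suc h)) n) ⟨
      (xS ⊗ J (suc h)) n 0 ℚ.- (if α ℕ.≡ᵇ 0 then value (suc h) n 0 else 0ℚ) ∎
      where
      bottom : 0 < α ⊎ 0 ≡ α → fromℕ (r n 0) ≡ (if α ℕ.≡ᵇ 0 then value (suc h) n 0 else 0ℚ)
      bottom (inj₁ lt) = trans (cong fromℕ (raised-< h n 0 lt)) (cong (λ b → if b then value (suc h) n 0 else 0ℚ) (sym (≢-≡ᵇ (ℕₚ.>⇒≢ lt))))
      bottom (inj₂ e) = trans (cong fromℕ (raised-≥ h n 0 (ℕₚ.≤-reflexive (sym e))))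
        (cong (λ a → if a ℕ.≡ᵇ 0 then value (suc h) n 0 else 0ℚ) e)
    left n (suc k) = trans (x-1-suc (raised h) n k) (trans (middle (ℕₚ.<-cmp α (suc k)))
      (cong (λ q → q ℚ.- (if α ℕ.≡ᵇ suc k then value (suc h) n 0 else 0ℚ)) (sym (x-shift (J (suc h)) n k))))
      where
      Goal = fromℕ (r n k) ℚ.- fromℕ (r n (suc k)) ≡ fromℕ (cJ (suc h) n k) ℚ.- (if α ℕ.≡ᵇ suc k then value (suc h) n 0 else 0ℚ)
      if-false : ∀ {b} {q : ℚ} → b ≡ false → (if b then q else 0ℚ) ≡ 0ℚ
      if-false refl = refl
      if-true : ∀ {b} {q : ℚ} → b ≡ true → (if b then q else 0ℚ) ≡ q
      if-true refl = refl
      middle : Tri (α < suc k) (α ≡ suc k) (suc k < α) → Goal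
      middle (tri< lt ne _) = begin
        fromℕ (r n k) ℚ.- fromℕ (r n (suc k))
          ≡⟨ cong₂ (λ a b → fromℕ a ℚ.- fromℕ b) (raised-≥ h n k (ℕ.s≤s⁻¹ lt)) (raised-≥ h n (suc k) (ℕₚ.<⇒≤ lt)) ⟩
        fromℕ (tail (suc h) n k) ℚ.- fromℕ (tail (suc h) n (suc k))
          ≡⟨ difference _ (cJ (suc h) n k) _ (tail-step (suc h) n k (s≤s h≤m)) ⟩
        fromℕ (cJ (suc h) n k) ≡⟨ ℚₚ.+-identityʳ _ ⟨
        fromℕ (cJ (suc h) n k) ℚ.- 0ℚ ≡⟨ cong (λ q → fromℕ (cJ (suc h) n k) ℚ.- q) (if-false (≢-≡ᵇ ne)) ⟨
        fromℕ (cJ (suc h) n k) ℚ.- (if α ℕ.≡ᵇ suc k then value (suc h) n 0 else 0ℚ) ∎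
      middle (tri≈ _ e _) = cong₂ ℚ._-_
        (cong fromℕ (trans (raised-< h n k k<α) (sym (count-small h n k h≤m k<α))))
        (trans (cong fromℕ (trans (raised-≥ h n (suc k) (ℕₚ.≤-reflexive e)) (tail-low h n (suc k) h≤m (ℕₚ.≤-reflexive (sym e)))))
          (sym (if-true (trans (cong (ℕ._≡ᵇ suc k) e) (≡ᵇ-refl k)))))
        where
        k<α : k < α
        k<α = ℕₚ.≤-reflexive (sym e)
      middle (tri> _ ne lt) = cong₂ ℚ._-_
        (cong fromℕ (trans (raised-< h n k (ℕₚ.<⇒≤ lt)) (sym (count-small h n k h≤m (ℕₚ.<⇒≤ lt)))))
        (trans (cong fromℕ (raised-< h n (suc k) lt)) (sym (if-false (≢-≡ᵇ ne))))

  system : System m J value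
  system = record
    { order₀ = λ i i≤ k → cong fromℕ (count-size0 i k i≤)
    ; recurrence = recurrence
    ; value-constant = λ i _ → value-constant i
    ; value-at-1 = J~value }
    where
    recurrence : ∀ i → i ≤ m → (xS ⊖ 1S) ⊗ (J (suc i) ⊖ J i) ≋ J m ⊗ (xS ⊗ J (suc i) ⊖ xS ↑ (m ∸ i) ⊗ value (suc i))
    recurrence i i≤m = by₂ (x ⊖ 1#) (J m) (J-step i i≤m) (raised-equation i i≤m)
      (solve 6 (λ x j₁ j₀ jm r e → (x :- :1) :* (j₁ :- j₀) :+ (x :- :1) :* (j₀ :+ jm :* r) :+ jm :* e
        := jm :* e :+ (x :- :1) :* j₁ :+ jm :* ((x :- :1) :* r)) ≈-refl
        x (J (suc i)) (J i) (J m) (raised i) (xS ⊗ J (suc i) ⊖ xS ↑ (m ∸ i) ⊗ value (suc i)))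
      where
      open 𝕊
      x = xS

  J₀ : J 0 ≋ tS *S xS ↑ m
  J₀ = ≋-mk coefficients
    where
    open ≡.≡-Reasoning
    power : ∀ n k → (xS ↑ m) n k ≡ (if m ℕ.≡ᵇ k then 1S n 0 else 0ℚ)
    power n k = trans (sym (coeff (𝕊.⊗-idʳ (xS ↑ m)) n k)) (monomial-coefficient m {1S} (Subring.P-1 constantInX) n k)
    coefficients : J 0 ≈S tS *S xS ↑ m
    coefficients zero k = trans (cong fromℕ (count-size0 0 k z≤n)) (sym (t-shift₀ (xS ↑ m) k))
    coefficients (suc (suc n)) k = trans (cong fromℕ (count-minimal-else (suc (suc n)) k (λ { (() , _) })))
      (sym (trans (t-shift (xS ↑ m) (suc n) k) (trans (power (suc n) k) (if-same (m ℕ.≡ᵇ k)))))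
      where
      if-same : ∀ b → (if b then 0ℚ else 0ℚ) ≡ 0ℚ
      if-same true = refl
      if-same false = refl
    coefficients (suc zero) k with k ℕₚ.≟ m
    ... | yes refl = trans (cong fromℕ count-minimal) (sym (trans (t-shift (xS ↑ m) 0 m) (trans (power 0 m)
        (cong (λ b → if b then 1ℚ else 0ℚ) (≡ᵇ-refl m)))))
    ... | no ne = trans (cong fromℕ (count-minimal-else 1 k (λ e → ne (proj₂ e)))) (sym (trans (t-shift (xS ↑ m) 0 k) (trans (power 0 k)
        (cong (λ b → if b then 1ℚ else 0ℚ) (≢-≡ᵇ (λ e → ne (sym e)))))))

-- Fuss–Catalan numbers

absorption : ∀ n k → suc k * (suc n C suc k) ≡ suc n * (n C k)
absorption zero zero = refl
absorption zero (suc k) = trans (cong (suc (suc k) *_) (k>n⇒nCk≡0 {1} {suc (suc k)} (s≤s (s≤s z≤n)))) (trans (ℕₚ.*-zeroʳ (suc (suc k)))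
  (sym (cong (1 *_) (k>n⇒nCk≡0 {0} {suc k} (s≤s z≤n)))))
absorption (suc n) zero = trans (ℕₚ.+-identityʳ _) (trans (nC1≡n (suc (suc n))) (sym (ℕₚ.*-identityʳ (suc (suc n)))))
absorption (suc n) (suc k) = begin
  suc (suc k) * (suc (suc n) C suc (suc k))
    ≡⟨ cong (suc (suc k) *_) (pascal (suc n) (suc k)) ⟩
  suc (suc k) * (a + b) ≡⟨ ℕₚ.*-distribˡ-+ (suc (suc k)) a b ⟩
  a + suc k * a + suc (suc k) * b ≡⟨ cong₂ (λ s t → a + s + t) (absorption n k) (absorption n (suc k)) ⟩
  a + suc n * (n C k) + suc n * (n C suc k) ≡⟨ ℕₚ.+-assoc a _ _ ⟩
  a + (suc n * (n C k) + suc n * (n C suc k))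
    ≡⟨ cong (a +_) (trans (sym (ℕₚ.*-distribˡ-+ (suc n) (n C k) (n C suc k))) (cong (suc n *_) (sym (pascal n k)))) ⟩
  a + suc n * a ∎
  where
  open ≡.≡-Reasoning
  a = suc n C suc k
  b = suc n C suc (suc k)

absorption′ : ∀ n k → suc k * ((n C k) + (n C suc k)) ≡ suc n * (n C k)
absorption′ n k = trans (cong (suc k *_) (sym (pascal n k))) (absorption n k)

module FussCatalan (p′ : ℕ) where

  p : ℕ
  p = suc p′

  -- r/(pn+r) C(pn+r,n) = C(pn+r,n) - p C(pn+r-1,n-1), which also makes sense at n = r = 0.
  fussCatalan : ℕ → ℕ → ℚ
  fussCatalan zero r = 1ℚ
  fussCatalan (suc n) r = fromℕ (suc (p′ + p * n + r) C suc n) ℚ.- fromℕ p ℚ.* fromℕ ((p′ + p * n + r) C n)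

  -- Absorption with top entry (n+1) p makes the two binomial terms equal, in accordance with B^0 =
  -- 1.
  fussCatalan-0 : ∀ n → fussCatalan (suc n) 0 ≡ 0ℚ
  fussCatalan-0 n = trans (cong (λ q → q ℚ.- fromℕ p ℚ.* fromℕ (N C n)) (trans (cong fromℕ top) (fromℕ-* p (N C n))))
    (ℚₚ.+-inverseʳ (fromℕ p ℚ.* fromℕ (N C n)))
    where
    N = p′ + p * n + 0
    suc-N : suc N ≡ suc n * p
    suc-N = trans (cong suc (ℕₚ.+-identityʳ _)) (cong (λ t → suc (p′ + t)) (ℕₚ.*-comm p n))
    top : suc N C suc n ≡ p * (N C n)
    top = ℕₚ.*-cancelˡ-≡ (suc N C suc n) (p * (N C n)) (suc n)
      (trans (absorption N n) (trans (cong (_* (N C n)) suc-N) (ℕₚ.*-assoc (suc n) p (N C n))))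

  -- Pascal's rule; this is the coefficient form of B^{r+1} = B^r + t B^{r+p}.
  fussCatalan-suc : ∀ n r → fussCatalan (suc n) (suc r) ≡ fussCatalan (suc n) r ℚ.+ fussCatalan n (r + p)
  fussCatalan-suc n r = begin
    fromℕ (suc (p′ + p * n + suc r) C suc n) ℚ.- fromℕ p ℚ.* fromℕ ((p′ + p * n + suc r) C n)
      ≡⟨ cong (λ M → fromℕ (suc M C suc n) ℚ.- fromℕ p ℚ.* fromℕ (M C n)) (ℕₚ.+-suc (p′ + p * n) r) ⟩
    fromℕ (suc (suc N) C suc n) ℚ.- fromℕ p ℚ.* fromℕ (suc N C n)
      ≡⟨ cong (λ q → q ℚ.- fromℕ p ℚ.* fromℕ (suc N C n)) (trans (cong fromℕ (pascal (suc N) n)) (fromℕ-+ (suc N C n) (suc N C suc n))) ⟩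
    fromℕ (suc N C n) ℚ.+ fromℕ (suc N C suc n) ℚ.- fromℕ p ℚ.* fromℕ (suc N C n)
      ≡⟨ ℚR.solve 4 (λ a b q c → (a ℚR.:+ b) ℚR.:- q ℚR.:* a ℚR.:= (b ℚR.:- q ℚR.:* c) ℚR.:+ (a ℚR.:- q ℚR.:* (a ℚR.:- c))) refl
           (fromℕ (suc N C n)) (fromℕ (suc N C suc n)) (fromℕ p) (fromℕ (N C n)) ⟩
    fussCatalan (suc n) r ℚ.+ (fromℕ (suc N C n) ℚ.- fromℕ p ℚ.* (fromℕ (suc N C n) ℚ.- fromℕ (N C n)))
      ≡⟨ cong (fussCatalan (suc n) r ℚ.+_) (rest n) ⟩
    fussCatalan (suc n) r ℚ.+ fussCatalan n (r + p) ∎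
    where
    open ≡.≡-Reasoning
    N = p′ + p * n + r
    rest : ∀ n → let N = p′ + p * n + r in
      fromℕ (suc N C n) ℚ.- fromℕ p ℚ.* (fromℕ (suc N C n) ℚ.- fromℕ (N C n)) ≡ fussCatalan n (r + p)
    rest zero = ℚR.solve 1 (λ q → ℚR.:1 ℚR.:- q ℚR.:* (ℚR.:1 ℚR.:- ℚR.:1) ℚR.:= ℚR.:1) refl (fromℕ p)
    rest (suc n) = begin
      fromℕ (suc N′ C suc n) ℚ.- fromℕ p ℚ.* (fromℕ (suc N′ C suc n) ℚ.- fromℕ (N′ C suc n))
        ≡⟨ cong (λ t → fromℕ (suc N′ C suc n) ℚ.- fromℕ p ℚ.* t)
             (trans (cong (λ q → q ℚ.- fromℕ (N′ C suc n)) (trans (cong fromℕ (pascal N′ n)) (fromℕ-+ (N′ C n) (N′ C suc n))))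
               (ℚR.solve 2 (λ a b → (a ℚR.:+ b) ℚR.:- b ℚR.:= a) refl (fromℕ (N′ C n)) (fromℕ (N′ C suc n)))) ⟩
      fromℕ (suc N′ C suc n) ℚ.- fromℕ p ℚ.* fromℕ (N′ C n)
        ≡⟨ cong (λ M → fromℕ (suc M C suc n) ℚ.- fromℕ p ℚ.* fromℕ (M C n)) exponents ⟩
      fussCatalan (suc n) (r + p) ∎
      where
      N′ = p′ + p * suc n + r
      exponents : p′ + p * suc n + r ≡ p′ + p * n + (r + p)
      exponents = trans (cong (λ t → p′ + t + r) (trans (ℕₚ.*-suc p n) (ℕₚ.+-comm p (p * n))))
        (trans (cong (_+ r) (sym (ℕₚ.+-assoc p′ (p * n) p))) (trans (ℕₚ.+-assoc (p′ + p * n) p r) (cong (p′ + p * n +_) (ℕₚ.+-comm p r))))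

  module _ (B : Series) (B-equation : B ≋ 1S +S tS *S B ↑ p) where

    power-step : ∀ r → B ↑ suc r ≋ B ↑ r +S tS *S B ↑ (r + p)
    power-step r = by₂ (B ↑ r) (⊝ t) B-equation (𝕊∑.↑-+ B r p)
      (solve 5 (λ b t q s w → b :* q :+ q :* (:1 :+ t :* s) :+ (:- t) :* (q :* s) := (q :+ t :* w) :+ q :* b :+ (:- t) :* w) ≈-refl
        B t (B ↑ r) (B ↑ p) (B ↑ (r + p)))
      where
      open 𝕊
      t = tS

    -- Induction on the order and then on the exponent: the larger exponent r + p occurs only at the
    -- previous order.
    power-coefficient : ∀ n r → (B ↑ r) n 0 ≡ fussCatalan n r
    power-coefficient zero zero = refl
    power-coefficient zero (suc r) = trans (coeff (power-step r) 0 0) (trans (cong₂ ℚ._+_ (power-coefficient 0 r) (t-shift₀ (B ↑ (r + p)) 0)) (ℚₚ.+-identityʳ 1ℚ))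
    power-coefficient (suc n) zero = sym (fussCatalan-0 n)
    power-coefficient (suc n) (suc r) = trans (coeff (power-step r) (suc n) 0)
      (trans (cong₂ ℚ._+_ (power-coefficient (suc n) r) (trans (t-shift (B ↑ (r + p)) n 0) (power-coefficient n (r + p))))
        (sym (fussCatalan-suc n r)))

module IntervalNumber (m : ℕ) where

  p′ : ℕ
  p′ = m * m + 2 * m

  open FussCatalan p′

  -- The hypothesis on c comes from 1 + Ī(1) = (m+1) B^{m+1} - m B^{m+2}; here n = n₁ + 1.
  interval-number : ∀ n₁ c → fromℕ c ≡ fromℕ (suc m) ℚ.* fussCatalan (suc n₁) (suc m) ℚ.- fromℕ m ℚ.* fussCatalan (suc n₁) (2 + m) →
    suc n₁ * (m * suc n₁ + 1) * c ≡ suc m * ((suc m ^ 2 * suc n₁ + m) C n₁)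
  interval-number n₁ c h = fromℕ-injective (begin
    fromℕ (suc n₁ * (m * suc n₁ + 1) * c)
      ≡⟨ trans (fromℕ-* (suc n₁ * (m * suc n₁ + 1)) c) (cong (ℚ._* fromℕ c) (trans (fromℕ-* (suc n₁) (m * suc n₁ + 1))
           (cong₂ ℚ._*_ (fromℕ-+ 1 n₁) (trans (fromℕ-+ (m * suc n₁) 1) (cong (ℚ._+ 1ℚ) (trans (fromℕ-* m (suc n₁)) (cong (M ℚ.*_) (fromℕ-+ 1 n₁)))))))) ⟩
    (1ℚ ℚ.+ N) ℚ.* (M ℚ.* (1ℚ ℚ.+ N) ℚ.+ 1ℚ) ℚ.* fromℕ c
      ≡⟨ cong ((1ℚ ℚ.+ N) ℚ.* (M ℚ.* (1ℚ ℚ.+ N) ℚ.+ 1ℚ) ℚ.*_) expanded ⟩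
    (1ℚ ℚ.+ N) ℚ.* (M ℚ.* (1ℚ ℚ.+ N) ℚ.+ 1ℚ) ℚ.* ((1ℚ ℚ.+ M) ℚ.* (X ℚ.+ Y ℚ.- P ℚ.* X) ℚ.- M ℚ.* (W ℚ.+ X ℚ.+ (X ℚ.+ Y) ℚ.- P ℚ.* (W ℚ.+ X)))
      -- The absorption relations eliminate Y = C(A,n₁+1) and W = C(A,n₁-1) in favour of X =
      -- C(A,n₁); the two multipliers are those that cancel Y and W, using p = (m+1)^2.
      ≡⟨ ℚR.by₂ (M ℚ.* (1ℚ ℚ.+ N) ℚ.+ 1ℚ) (ℚ.- ((1ℚ ℚ.+ N) ℚ.* M ℚ.* M)) absorb-Y absorb-X
           (ℚR.solve 5 (λ n m x y w →
             let p = :1 :+ (m :* m :+ (:1 :+ :1) :* m) ; a = (m :* m :+ (:1 :+ :1) :* m) :+ p :* n :+ (:1 :+ m) in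
             (:1 :+ n) :* (m :* (:1 :+ n) :+ :1) :* ((:1 :+ m) :* (x :+ y :- p :* x) :- m :* (w :+ x :+ (x :+ y) :- p :* (w :+ x)))
               :+ (m :* (:1 :+ n) :+ :1) :* ((:1 :+ a) :* x) :+ (:- ((:1 :+ n) :* m :* m)) :* ((:1 :+ a) :* w)
             := ((:1 :+ m) :* x) :+ (m :* (:1 :+ n) :+ :1) :* ((:1 :+ n) :* (x :+ y)) :+ (:- ((:1 :+ n) :* m :* m)) :* (n :* (w :+ x)))
             refl N M X Y W) ⟩
    (1ℚ ℚ.+ M) ℚ.* X
      ≡⟨ trans (cong (ℚ._* X) (sym (fromℕ-+ 1 m))) (trans (sym (fromℕ-* (suc m) (A C n₁))) (cong (λ a → fromℕ (suc m * (a C n₁))) A≡)) ⟩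
    fromℕ (suc m * ((suc m ^ 2 * suc n₁ + m) C n₁)) ∎)
    where
    open ≡.≡-Reasoning
    open ℚR using (:1; _:+_; _:*_; _:-_; :-_; _:=_)
    A = p′ + p * n₁ + suc m
    -- C(A,n₁-1), with the value 0 at n₁ = 0, so that Pascal's rule and absorption hold there too.
    previous : ℕ → ℕ
    previous zero = 0
    previous (suc n₂) = A C n₂
    M = fromℕ m
    N = fromℕ n₁
    X = fromℕ (A C n₁)
    Y = fromℕ (A C suc n₁)
    W = fromℕ (previous n₁)
    P′ = M ℚ.* M ℚ.+ (1ℚ ℚ.+ 1ℚ) ℚ.* M
    P = 1ℚ ℚ.+ P′
    A≡ : A ≡ suc m ^ 2 * suc n₁ + m
    A≡ = ℕSolver.+-*-Solver.solve 2 (λ m n → let p′ = m ℕS.:* m ℕS.:+ ℕS.con 2 ℕS.:* m in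
      p′ ℕS.:+ (ℕS.con 1 ℕS.:+ p′) ℕS.:* n ℕS.:+ (ℕS.con 1 ℕS.:+ m)
      ℕS.:= (ℕS.con 1 ℕS.:+ m) ℕS.:* ((ℕS.con 1 ℕS.:+ m) ℕS.:* ℕS.con 1) ℕS.:* (ℕS.con 1 ℕS.:+ n) ℕS.:+ m) refl m n₁
      where module ℕS = ℕSolver.+-*-Solver
    fromℕ-p′ : fromℕ p′ ≡ P′
    fromℕ-p′ = trans (fromℕ-+ (m * m) (2 * m)) (cong₂ ℚ._+_ (fromℕ-* m m) (fromℕ-* 2 m))
    fromℕ-p : fromℕ p ≡ P
    fromℕ-p = trans (fromℕ-+ 1 p′) (cong (1ℚ ℚ.+_) fromℕ-p′)
    fromℕ-A : fromℕ (suc A) ≡ 1ℚ ℚ.+ (P′ ℚ.+ P ℚ.* N ℚ.+ (1ℚ ℚ.+ M))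
    fromℕ-A = trans (fromℕ-+ 1 A) (cong (1ℚ ℚ.+_) (trans (fromℕ-+ (p′ + p * n₁) (suc m))
      (cong₂ ℚ._+_ (trans (fromℕ-+ p′ (p * n₁)) (cong₂ ℚ._+_ fromℕ-p′ (trans (fromℕ-* p n₁) (cong (ℚ._* N) fromℕ-p)))) (fromℕ-+ 1 m))))
    step-X : fromℕ (suc A C n₁) ≡ W ℚ.+ X
    step-X = trans (cong fromℕ (split n₁)) (fromℕ-+ (previous n₁) (A C n₁))
      where
      split : ∀ k → suc A C k ≡ previous k + (A C k)
      split zero = refl
      split (suc k) = pascal A k
    step-Y : fromℕ (suc A C suc n₁) ≡ X ℚ.+ Y
    step-Y = trans (cong fromℕ (pascal A n₁)) (fromℕ-+ (A C n₁) (A C suc n₁))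
    expanded : fromℕ c ≡ (1ℚ ℚ.+ M) ℚ.* (X ℚ.+ Y ℚ.- P ℚ.* X) ℚ.- M ℚ.* (W ℚ.+ X ℚ.+ (X ℚ.+ Y) ℚ.- P ℚ.* (W ℚ.+ X))
    expanded = trans h (cong₂ ℚ._-_ (cong₂ ℚ._*_ (fromℕ-+ 1 m) (cong₂ ℚ._-_ step-Y (cong (ℚ._* X) fromℕ-p)))
      (cong (M ℚ.*_) (trans (cong (λ K → fromℕ (suc K C suc n₁) ℚ.- fromℕ p ℚ.* fromℕ (K C n₁)) (ℕₚ.+-suc (p′ + p * n₁) (suc m)))
        (cong₂ ℚ._-_ (trans (cong fromℕ (pascal (suc A) n₁)) (trans (fromℕ-+ (suc A C n₁) (suc A C suc n₁)) (cong₂ ℚ._+_ step-X step-Y)))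
          (cong₂ ℚ._*_ fromℕ-p step-X)))))
    absorb-Y : (1ℚ ℚ.+ N) ℚ.* (X ℚ.+ Y) ≡ (1ℚ ℚ.+ (P′ ℚ.+ P ℚ.* N ℚ.+ (1ℚ ℚ.+ M))) ℚ.* X
    absorb-Y = trans (sym (trans (fromℕ-* (suc n₁) ((A C n₁) + (A C suc n₁))) (cong₂ ℚ._*_ (fromℕ-+ 1 n₁) (fromℕ-+ (A C n₁) (A C suc n₁)))))
      (trans (cong fromℕ (absorption′ A n₁)) (trans (fromℕ-* (suc A) (A C n₁)) (cong (ℚ._* X) fromℕ-A)))
    absorb-X : N ℚ.* (W ℚ.+ X) ≡ (1ℚ ℚ.+ (P′ ℚ.+ P ℚ.* N ℚ.+ (1ℚ ℚ.+ M))) ℚ.* W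
    absorb-X = trans (sym (trans (fromℕ-* n₁ (previous n₁ + (A C n₁))) (cong (N ℚ.*_) (fromℕ-+ (previous n₁) (A C n₁)))))
      (trans (cong fromℕ (absorb n₁)) (trans (fromℕ-* (suc A) (previous n₁)) (cong (ℚ._* W) fromℕ-A)))
      where
      absorb : ∀ k → k * (previous k + (A C k)) ≡ suc A * previous k
      absorb zero = sym (ℕₚ.*-zeroʳ (suc A))
      absorb (suc k) = absorption′ A k

-- The polynomials of the statement in terms of Gᵢ

^S≡↑ : ∀ f e → f ^S e ≡ f ↑ e
^S≡↑ f zero = refl
^S≡↑ f (suc e) = cong (f *S_) (^S≡↑ f e)

sumBelowS≋∑ : ∀ n {f g : ℕ → Series} → (∀ i → i < n → f i ≋ g i) → sumBelowS n f ≋ 𝕊∑.∑ n g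
sumBelowS≋∑ zero h = 𝕊.≈-refl
sumBelowS≋∑ (suc n) h = 𝕊.⊕-cong (sumBelowS≋∑ n (λ i i<n → h i (ℕₚ.m≤n⇒m≤1+n i<n))) (h n ℕₚ.≤-refl)

·S≋ι : ∀ n f → fromℕ n ·S f ≋ 𝕊.ι n ⊗ f
·S≋ι zero f = 𝕊.≈-trans (≋-mk λ i k → ℚₚ.*-zeroˡ (f i k)) (𝕊.≈-sym (𝕊.⊗-zeroˡ f))
·S≋ι (suc n) f = 𝕊.≈-trans
  (≋-mk λ i k → trans (cong (ℚ._* f i k) (fromℕ-+ 1 n)) (trans (ℚₚ.*-distribʳ-+ (f i k) 1ℚ (fromℕ n))
    (cong (ℚ._+ fromℕ n ℚ.* f i k) (ℚₚ.*-identityˡ (f i k)))))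
  (𝕊.≈-trans (𝕊.⊕-cong (𝕊.≈-sym (𝕊.⊗-idˡ f)) (·S≋ι n f))
    (𝕊.≈-trans (𝕊.≈-sym (𝕊.⊗-distribʳ f 1S (𝕊.ι n))) (𝕊.⊗-congʳ f (𝕊.≈-sym (𝕊.ι-suc n)))))

·S-cong : ∀ n {f g} → f ≋ g → fromℕ n ·S f ≋ 𝕊.ι n ⊗ g
·S-cong n {f} {g} h = 𝕊.≈-trans (·S≋ι n f) (𝕊.⊗-congˡ (𝕊.ι n) h)

↑≋ : ∀ f e → f ^S e ≋ f ↑ e
↑≋ f e = 𝕊.≈-reflexive (^S≡↑ f e)

-S-cong : ∀ a {p q} → p ≋ q → a -S p ≋ a ⊖ q
-S-cong a h = ≋-mk λ n k → cong (λ r → a n k ℚ.- r) (coeff h n k)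

module 𝕊H = HPolynomials seriesRing

module HSeries (m : ℕ) (z u : Series) where

  open 𝕊
  open 𝕊∑ using (∑; ∑-head; ∑-⊕; ∑-cong)
  open 𝕊H

  -- Unrolls the recursion of `Q`, which lowers the exponent as the sum grows, into the inner sum of
  -- the statement.
  Q-sum : ∀ k c p → Q u k c p ≈ ∑ c (λ e → ι ((e + k) C e) ⊗ u ↑ (p + c ∸ suc e))
  Q-sum k zero p = ≈-refl
  Q-sum k (suc c) p = ⊕-cong
    (≈-trans (Q-sum k c (suc p)) (∑-cong c (λ e _ → ⊗-congˡ (ι ((e + k) C e)) (≈-reflexive (cong (λ j → u ↑ (j ∸ suc e)) (sym (ℕₚ.+-suc p c)))))))
    (⊗-congˡ (ι ((c + k) C c)) (≈-reflexive (cong (u ↑_) (sym (ℕₚ.m+n∸n≡m p (suc c))))))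

  first-sum : ∀ i j → sumRangeS 0 (m ∸ i) (λ e → binom (e + suc j ∸ 1) e ·S (u ^S e)) ≋ S u (suc j) (suc (m ∸ i))
  first-sum i j = sumBelowS≋∑ (suc (m ∸ i)) (λ e _ → ·S-cong ((e + suc j ∸ 1) C e) (↑≋ u e))

  second-sum : ∀ i j → i ≤ m → j < i →
    sumRangeS 0 (i ∸ suc j) (λ e → binom (e + suc j) e ·S (u ^S (suc m ∸ suc j ∸ e))) ≋ Q u (suc j) (i ∸ j) (suc (m ∸ i))
  second-sum i j i≤m j<i = ≈-trans
    (sumBelowS≋∑ (suc (i ∸ suc j)) (λ e _ → ·S-cong ((e + suc j) C e) (≈-trans (↑≋ u (m ∸ j ∸ e)) (≈-reflexive (cong (u ↑_) (exponent e))))))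
    (≈-trans (≈-reflexive (cong (λ c → ∑ c (λ e → ι ((e + suc j) C e) ⊗ u ↑ (suc (m ∸ i) + (i ∸ j) ∸ suc e))) (sym (ℕₚ.+-∸-assoc 1 j<i))))
      (≈-sym (Q-sum (suc j) (i ∸ j) (suc (m ∸ i)))))
    where
    exponent : ∀ e → m ∸ j ∸ e ≡ suc (m ∸ i) + (i ∸ j) ∸ suc e
    exponent e = cong (_∸ e) (trans (cong (_∸ j) (sym (ℕₚ.m∸n+n≡m i≤m))) (ℕₚ.+-∸-assoc (m ∸ i) (ℕₚ.<⇒≤ j<i)))

  firstTerm secondTerm : ℕ → ℕ → Series
  firstTerm i k = ((-S z) ^S k) *S (binom (suc i) k ·S sumRangeS 0 (m ∸ i) (λ e → binom (e + k ∸ 1) e ·S (u ^S e)))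
  secondTerm i k = ((-S z) ^S k) *S (binom (m + k ∸ i ∸ 1) (k ∸ 1) ·S sumRangeS 0 (i ∸ k) (λ e → binom (e + k) e ·S (u ^S (suc m ∸ k ∸ e))))

  Hsmall≡ : ∀ i → Hsmall m i z u ≡ (u ^S suc i) *S (1S +S sumRangeS 1 (suc i) (firstTerm i) +S sumRangeS 1 i (secondTerm i))
  Hsmall≡ i = refl

  firstG secondG : ℕ → ℕ → Series
  firstG i j = (⊝ z) ↑ suc j ⊗ (ι (suc i C suc j) ⊗ S u (suc j) (suc (m ∸ i)))
  secondG i j = (⊝ z) ↑ suc j ⊗ (ι ((m ∸ i + j) C j) ⊗ Q u (suc j) (i ∸ j) (suc (m ∸ i)))

  firstTerm≋ : ∀ i j → firstTerm i (suc j) ≋ firstG i j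
  firstTerm≋ i j = ⊗-cong (↑≋ (-S z) (suc j)) (·S-cong (suc i C suc j) (first-sum i j))

  secondTerm≋ : ∀ i j → i ≤ m → j < i → secondTerm i (suc j) ≋ secondG i j
  secondTerm≋ i j i≤m j<i = ⊗-cong (↑≋ (-S z) (suc j))
    (≈-trans (·S-cong ((m + suc j ∸ i ∸ 1) C j) (second-sum i j i≤m j<i))
      (⊗-congʳ (Q u (suc j) (i ∸ j) (suc (m ∸ i))) (ι-cong (cong (_C j) top))))
    where
    top : m + suc j ∸ i ∸ 1 ≡ m ∸ i + j
    top = cong (_∸ 1) (trans (ℕₚ.+-∸-comm (suc j) i≤m) (ℕₚ.+-suc (m ∸ i) j))

  G-terms : ∀ i → G z u i (m ∸ i) ≋ 1S ⊕ ∑ (suc i) (firstG i) ⊕ ∑ i (secondG i)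
  G-terms i = begin
    G z u i (m ∸ i) ≈⟨ ∑-head (suc i) (λ k → (⊝ z) ↑ k ⊗ g u i (m ∸ i) k) ⟩
    1S ⊗ 1S ⊕ ∑ (suc i) (λ j → (⊝ z) ↑ suc j ⊗ g u i (m ∸ i) (suc j))
      ≈⟨ ⊕-cong (⊗-idˡ 1S) (∑-cong (suc i) {λ j → (⊝ z) ↑ suc j ⊗ g u i (m ∸ i) (suc j)} {λ j → firstG i j ⊕ secondG i j} (λ j _ → ⊗-distribˡ ((⊝ z) ↑ suc j)
           (ι (suc i C suc j) ⊗ S u (suc j) (suc (m ∸ i))) (ι ((m ∸ i + j) C j) ⊗ Q u (suc j) (i ∸ j) (suc (m ∸ i))))) ⟩
    1S ⊕ ∑ (suc i) (λ j → firstG i j ⊕ secondG i j)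
      ≈⟨ ⊕-congˡ′ 1S (∑-⊕ (suc i) (firstG i) (secondG i)) ⟩
    1S ⊕ (∑ (suc i) (firstG i) ⊕ (∑ i (secondG i) ⊕ secondG i i))
      -- In `G` both sums run to k = i + 1, in the statement the second one stops at i; the extra
      -- term contains an empty inner sum.
      ≈⟨ ⊕-congˡ′ 1S (⊕-congˡ′ (∑ (suc i) (firstG i)) (≈-trans (⊕-congˡ′ (∑ i (secondG i)) last-term) (⊕-idʳ (∑ i (secondG i))))) ⟩
    1S ⊕ (∑ (suc i) (firstG i) ⊕ ∑ i (secondG i))
      ≈⟨ ⊕-assoc 1S (∑ (suc i) (firstG i)) (∑ i (secondG i)) ⟨
    1S ⊕ ∑ (suc i) (firstG i) ⊕ ∑ i (secondG i) ∎
    where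
    ⊕-congˡ′ : ∀ a {b c} → b ≋ c → a ⊕ b ≋ a ⊕ c
    ⊕-congˡ′ a {b} {c} h = ⊕-cong {a} {a} {b} {c} ≈-refl h
    last-term : secondG i i ≋ 0S
    last-term = ≈-trans (⊗-congˡ ((⊝ z) ↑ suc i) (≈-trans (⊗-congˡ (ι ((m ∸ i + i) C i))
      (≈-reflexive (cong (λ c → Q u (suc i) c (suc (m ∸ i))) (ℕₚ.n∸n≡0 i)))) (⊗-zeroʳ (ι ((m ∸ i + i) C i))))) (⊗-zeroʳ ((⊝ z) ↑ suc i))

  H-terms : ∀ i → i ≤ m → 1S +S sumRangeS 1 (suc i) (firstTerm i) +S sumRangeS 1 i (secondTerm i) ≋ 1S ⊕ ∑ (suc i) (firstG i) ⊕ ∑ i (secondG i)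
  H-terms i i≤m = ⊕-cong
    (⊕-cong {1S} {1S} {sumRangeS 1 (suc i) (firstTerm i)} {∑ (suc i) (firstG i)} ≈-refl
      (sumBelowS≋∑ (suc i) {λ j → firstTerm i (suc j)} {firstG i} (λ j _ → firstTerm≋ i j)))
    (sumBelowS≋∑ i {λ j → secondTerm i (suc j)} {secondG i} (λ j j<i → secondTerm≋ i j i≤m j<i))

  Hsmall≋ : ∀ i → i ≤ m → Hsmall m i z u ≋ u ↑ suc i ⊗ G z u i (m ∸ i)
  Hsmall≋ i i≤m = ≈-trans (≈-reflexive (Hsmall≡ i)) (⊗-cong (↑≋ u (suc i)) (≈-trans (H-terms i i≤m) (≈-sym (G-terms i))))

  lastTerm : ℕ → Series
  lastTerm e = fromℕ (suc m ∸ e) ·S (u ^S e)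

  lastG : ℕ → Series
  lastG e = ι (suc m ∸ e) ⊗ u ↑ e

  Hlast≡ : Hlast m z u ≡ (u ^S suc (suc m)) *S (1S -S z *S sumRangeS 0 m lastTerm)
  Hlast≡ = refl

  last-sum : sumRangeS 0 m lastTerm ≋ ∑ (suc m) lastG
  last-sum = sumBelowS≋∑ (suc m) {lastTerm} {lastG} (λ e _ → ·S-cong (suc m ∸ e) (↑≋ u e))

  last-factor : 1S -S z *S sumRangeS 0 m lastTerm ≋ 1S ⊖ z ⊗ ∑ (suc m) lastG
  last-factor = -S-cong 1S {z *S sumRangeS 0 m lastTerm} {z ⊗ ∑ (suc m) lastG} (⊗-congˡ z {sumRangeS 0 m lastTerm} {∑ (suc m) lastG} last-sum)

  G-last≡ : G-last z u m ≡ 1S ⊖ z ⊗ ∑ (suc m) lastG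
  G-last≡ = refl

  Hlast≋ : Hlast m z u ≋ u ↑ suc (suc m) ⊗ G-last z u m
  Hlast≋ = ≈-trans (≈-reflexive Hlast≡) (≈-trans
    (⊗-cong {u ^S suc (suc m)} {u ↑ suc (suc m)} {1S -S z *S sumRangeS 0 m lastTerm} {1S ⊖ z ⊗ ∑ (suc m) lastG}
      (↑≋ u (suc (suc m))) last-factor)
    (≈-reflexive (cong (u ↑ suc (suc m) ⊗_) (sym G-last≡))))

  H-last : H m (suc m) z u ≡ Hlast m z u
  H-last = cong (λ b → if b then Hsmall m (suc m) z u else Hlast m z u) (≤ᵇ-false (ℕₚ.n<1+n m))

  H-small : ∀ i → i ≤ m → H m i z u ≡ Hsmall m i z u
  H-small i i≤m = cong (λ b → if b then Hsmall m i z u else Hlast m z u) (≤ᵇ-true i≤m)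

  H-last≋ : H m (suc m) z u ≋ u ↑ suc (suc m) ⊗ Gᵢ m z u (suc m)
  H-last≋ = ≈-trans (≈-reflexive H-last) (≈-trans Hlast≋
    (≈-reflexive (cong (u ↑ suc (suc m) ⊗_) (sym (Gᵢ-last m z u)))))

  H-small≋ : ∀ i → i ≤ m → H m i z u ≋ u ↑ suc i ⊗ Gᵢ m z u i
  H-small≋ i i≤m = ≈-trans (≈-reflexive (H-small i i≤m)) (≈-trans (Hsmall≋ i i≤m)
    (≈-reflexive (cong (u ↑ suc i ⊗_) (sym (Gᵢ-small z u i≤m)))))

  H≋ : ∀ i → i ≤ suc m → H m i z u ≋ u ↑ suc i ⊗ Gᵢ m z u i
  H≋ i i≤ = cases (ℕₚ.m≤n⇒m<n∨m≡n i≤)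
    where
    cases : i < suc m ⊎ i ≡ suc m → H m i z u ≋ u ↑ suc i ⊗ Gᵢ m z u i
    cases (inj₁ lt) = H-small≋ i (ℕ.s≤s⁻¹ lt)
    cases (inj₂ e) = subst (λ i → H m i z u ≋ u ↑ suc i ⊗ Gᵢ m z u i) (sym e) H-last≋

-- From the counts to the stated formulas

module MainTheorem (m′ : ℕ) (Z : Series)
  (Z₀ : ∀ k → Z 0 k ≡ 0ℚ) (Z-constant : ∀ n k → Z n (suc k) ≡ 0ℚ)
  (Z-equation : tS ≈S Z *S ((1S -S Z) ^S (suc m′ * suc m′ + 2 * suc m′)))
  (U : Series) (U-finite : FiniteDegree U)
  (U-equation : xS *S ((1S -S Z) ^S (suc m′ + 2)) ≈S U *S (1S -S Z *S sumRangeS 0 (suc m′) (λ e → U ^S e)))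
  (cI : ℕ → ℕ → ℕ) (cI-counts : ∀ n k → Fin (cI n k) ↔ IntervalsD (suc m′) n k)
  (cJ : ℕ → ℕ → ℕ → ℕ) (cJ-counts : ∀ i n k → i ≤ suc (suc m′) → Fin (cJ i n k) ↔ IntervalsJ (suc m′) i n k)
  (cAll : ℕ → ℕ) (cAll-counts : ∀ n → Fin (cAll n) ↔ Interval (suc m′) n)
  where

  open Paths m′ using (m; Path; []; up)
  open Translation m′
  open Bijection m′ using (words; fromValid; words-injective)
  open ActualSystem m′ cJ cJ-counts
  open 𝕊
  open 𝕊H using (Gᵢ)

  x-finite : FiniteDegree xS
  x-finite zero = 1 , λ { (suc zero) (s≤s ()) ; (suc (suc k)) _ → refl }
  x-finite (suc n) = 0 , λ k _ → refl

  Z-finite : FiniteDegree Z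
  Z-finite n = 0 , λ { (suc k) _ → Z-constant n k }

  invert : ∀ r → FiniteDegree r → ∃ λ v → FiniteDegree v × ((1S ⊖ Z ⊗ r) ⊗ v ≋ 1S)
  invert r Fr = geometricSeries (Z *S r) , geometricSeries-finiteDegree (Subring.P-⊗ finiteDegree {Z} {r} Z-finite Fr) ,
    geometricSeries-inverse (*S-order₀ {Z} r Z₀)

  U-equation′ : xS ⊗ (1S ⊖ Z) ↑ (m + 2) ≋ U ⊗ (1S ⊖ Z ⊗ 𝕊∑.∑ (suc m) (U ↑_))
  U-equation′ = ≈-trans (⊗-congˡ xS (≈-sym (↑≋ (1S -S Z) (m + 2)))) (≈-trans
    (≋-mk {g = U *S (1S -S Z *S powers)} U-equation)
    (⊗-congˡ U {1S -S Z *S powers} {1S ⊖ Z ⊗ 𝕊∑.∑ (suc m) (U ↑_)}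
      (-S-cong 1S {Z *S powers} {Z ⊗ 𝕊∑.∑ (suc m) (U ↑_)} (⊗-congˡ Z {powers} {𝕊∑.∑ (suc m) (U ↑_)}
        (sumBelowS≋∑ (suc m) {U ^S_} {U ↑_} (λ e _ → ↑≋ U e))))))
    where
    powers = sumRangeS 0 m (U ^S_)

  module Sol = Solution seriesRing finiteDegree m xS Z U x-finite Z-finite U-finite invert U-equation′
  open Sol using (Ĵ; Ĉ; W; B; c; y)

  Ĵ-order₀ : ∀ i k → Ĵ i 0 k ≡ 0ℚ
  Ĵ-order₀ i = *S-order₀ {Z ⊗ y ↑ m ⊗ Sol.K ↑ suc i} (Gᵢ m Z U i) (*S-order₀ {Z ⊗ y ↑ m} (Sol.K ↑ suc i) (*S-order₀ {Z} (y ↑ m) Z₀))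

  Ĉ-constant : ∀ i → ConstantInX (Ĉ i)
  Ĉ-constant i = X.Pˡ (X.~-⊗ (X.~-⊗ (X.~-⊗ Z~ (X.~-↑ m (X.~-↑ (m + 2) W~))) (X.~-↑ (suc i) (X.~-↑ (suc m) B~))) (X.~-Gᵢ m i Z-constant W~))
    where
    -- Congruence modulo 0 serves only for its closure properties: they carry constancy in x through
    -- powers, sums and the polynomials `Gᵢ`.
    module X = Congruence seriesRing constantInX 0S
    Z~ : Z X.~ Z
    Z~ = X.~-refl Z-constant
    W~ : W X.~ W
    W~ = X.~-⊕ {1S} {1S} {⊝ Z} {⊝ Z} (X.~-refl {1S} (Subring.P-1 constantInX)) (X.~-⊝ {Z} {Z} Z~)
    B~ : B X.~ B
    B~ = X.~-refl (geometricSeries-constantInX (Subring.P-⊗ constantInX {Z} {1S} Z-constant (Subring.P-1 constantInX)))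

  candidate : System m Ĵ Ĉ
  candidate = record
    { order₀ = λ i _ → Ĵ-order₀ i
    ; recurrence = Sol.recurrence
    ; value-constant = λ i _ → Ĉ-constant i
    ; value-at-1 = λ i _ → Sol.Ĵ~Ĉ i }

  t≋ : tS ≋ Z ⊗ W ↑ (m * m + 2 * m)
  t≋ = ≈-trans (≋-mk Z-equation) (⊗-congˡ Z (↑≋ (1S -S Z) (m * m + 2 * m)))

  -- The exponent in the equation of Z is chosen for this: m^2 + 2m = m (m+2), so t x^m = Z (x c)^m
  -- = Z y^m.
  Ĵ₀≋ : J 0 ≋ Ĵ 0
  Ĵ₀≋ = ≈-trans J₀ (≈-trans (⊗-congʳ (xS ↑ m) t≋) (≈-trans
    (≈-trans (⊗-assoc Z (W ↑ (m * m + 2 * m)) (xS ↑ m)) (⊗-congˡ Z (≈-trans (⊗-comm (W ↑ (m * m + 2 * m)) (xS ↑ m))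
      (≈-trans (⊗-congˡ (xS ↑ m) (≈-trans (≈-reflexive (cong (W ↑_) exponents)) (𝕊∑.↑-* W m (m + 2)))) (≈-sym (𝕊∑.↑-⊗ xS c m))))))
    (≈-sym Sol.Ĵ₀)))
    where
    exponents : m * m + 2 * m ≡ m * (m + 2)
    exponents = trans (cong (m * m +_) (ℕₚ.*-comm 2 m)) (sym (ℕₚ.*-distribˡ-+ m m 2))

  J≋ : ∀ i → i ≤ suc m → J i ≋ Ĵ i
  J≋ i i≤ = ≋-mk λ n k → proj₁ (system-unique system candidate Ĵ₀≋ n i i≤) k

  value≋ : ∀ i → i ≤ suc m → value i ≋ Ĉ i
  value≋ i i≤ = ≋-mk λ n k → proj₂ (system-unique system candidate Ĵ₀≋ n i i≤) k

  -- For i = m + 1 no final zeros are prescribed, and what follows the first up step is a path from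
  -- m to 0.
  all-shape : ∀ {n v} → 1 ≤ n → IsDyck m n v → JShape m (suc m) v
  all-shape {n} {v} n≥1 d = go (proj₁ d) (dyck-path {n} {v} d)
    where
    go : ∀ {v} → ups v ≡ n → Path 0 v 0 → JShape m (suc m) v
    go e [] = ⊥-elim (ℕₚ.1+n≰n (ℕₚ.≤-trans n≥1 (ℕₚ.≤-reflexive (sym e))))
    go e (up {w = y} p) = path⇒shape m y (cong (true ∷_) (sym (trans (cong (λ j → y ++ zeros j) (ℕₚ.n∸n≡0 m)) (Listₚ.++-identityʳ y)))) p

  cJ-last : ∀ n k → cJ (suc m) n k ≡ cI n k
  cJ-last n k = count-unique (cJ-counts (suc m) n k ℕₚ.≤-refl) (cI-counts n k)
    forget
    (λ { (I , [ _ ]) (I′ , [ _ ]) e → [ words-injective (cong (λ d → lower (proj₁ d) , upper (proj₁ d)) e) ] })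
    (λ { (interval v w a b d l , [ s ]) → [ (interval v w a b d l , [ all-shape {n} {v} a b , s ]) , refl ] })
    where
    forget : IntervalsJ m (suc m) n k → IntervalsD m n k
    forget (I , [ s ]) = I , [ proj₂ s ]

  cAll-sum : ∀ n → sumℕ (suc (m * n)) (cI n) ≡ cAll n
  cAll-sum n = count-unique (Below-↔ (suc (m * n)) (cI-counts n)) (cAll-counts n)
    (λ b → proj₁ (proj₂ (index (suc (m * n)) b)))
    (λ b b′ e → [ index-injective (suc (m * n)) (same (index (suc (m * n)) b) (index (suc (m * n)) b′) e) ])
    (λ { (interval v w a b d l) → [ find (interval v w a b d l) (bound {w} d) ] })
    where
    find : ∀ I → finalDescent (upper I) < suc (m * n) → ∃ λ b → proj₁ (proj₂ (index (suc (m * n)) b)) ≡ I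
    find I lt = inject {IntervalsD m n} (suc (m * n)) lt (I , [ refl ]) ,
      cong (λ s → proj₁ (proj₂ s)) (index-inject {IntervalsD m n} (suc (m * n)) lt (I , [ refl ]))
    bound : ∀ {w} → IsDyck m n w → finalDescent w < suc (m * n)
    bound {w} d = s≤s (ℕₚ.≤-trans (finalDescent≤downs w) (ℕₚ.≤-reflexive (proj₁ (proj₂ d))))
    descent-of : ∀ {k} (s : IntervalsD m n k) → finalDescent (upper (proj₁ s)) ≡ k
    descent-of {k} (I , [ e ]) = recompute (finalDescent (upper I) ℕₚ.≟ k) e
    same : ∀ (s s′ : Σ ℕ (IntervalsD m n)) → proj₁ (proj₂ s) ≡ proj₁ (proj₂ s′) → s ≡ s′
    same (k , s) (k′ , s′) e with trans (sym (descent-of s)) (trans (cong (λ I → finalDescent (upper I)) e) (descent-of s′))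
    ... | refl = cong (k ,_) (pair s s′ e)
      where
      pair : ∀ {k} (s s′ : IntervalsD m n k) → proj₁ s ≡ proj₁ s′ → s ≡ s′
      pair (I , [ _ ]) (_ , [ _ ]) refl = refl

  cI≋J : ofCounts cI ≋ J (suc m)
  cI≋J = ≋-mk λ n k → cong fromℕ (sym (cJ-last n k))

  cAll≋Ĉ : ofCountsT cAll ≋ Ĉ (suc m)
  cAll≋Ĉ = ≈-trans (≋-mk λ { n zero → cong fromℕ (trans (sym (cAll-sum n)) (sum-cong (suc (m * n)) (λ k → sym (cJ-last n k))))
                           ; n (suc k) → refl }) (value≋ (suc m) ℕₚ.≤-refl)
    where
    sum-cong : ∀ N {f g} → (∀ i → f i ≡ g i) → sumℕ N f ≡ sumℕ N g
    sum-cong zero h = refl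
    sum-cong (suc N) h = cong₂ _+_ (sum-cong N h) (h N)

  J-formula : ∀ i → i ≤ suc m →
    (xS ^S (suc i ∸ m)) *S ((1S -S Z) ^S ((m + 2) * (suc i ∸ m))) *S ofCounts (cJ i)
    ≋ (xS ^S (m ∸ suc i)) *S ((1S -S Z) ^S ((m + 2) * (m ∸ suc i))) *S Z *S H m i Z U
  J-formula i i≤ = begin
    (xS ^S (suc i ∸ m)) ⊗ (W ^S ((m + 2) * (suc i ∸ m))) ⊗ J i
      ≈⟨ ⊗-cong (⊗-cong (↑≋ xS (suc i ∸ m)) (↑≋ W ((m + 2) * (suc i ∸ m)))) (J≋ i i≤) ⟩
    xS ↑ (suc i ∸ m) ⊗ W ↑ ((m + 2) * (suc i ∸ m)) ⊗ Ĵ i ≈⟨ Sol.Ĵ-formula i ⟩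
    xS ↑ (m ∸ suc i) ⊗ W ↑ ((m + 2) * (m ∸ suc i)) ⊗ Z ⊗ (U ↑ suc i ⊗ Gᵢ m Z U i)
      ≈⟨ ⊗-cong (⊗-congʳ Z (⊗-cong (↑≋ xS (m ∸ suc i)) (↑≋ W ((m + 2) * (m ∸ suc i))))) (HSeries.H≋ m Z U i i≤) ⟨
    (xS ^S (m ∸ suc i)) ⊗ (W ^S ((m + 2) * (m ∸ suc i))) ⊗ Z ⊗ H m i Z U ∎

  -- The case i = m + 1, where the exponent m - i - 1 is -2, which accounts for x^2 and for
  -- (1-Z)^{2m+4}.
  I-formula : ((1S -S Z) ^S (2 * m + 4)) *S (xS ^S 2) *S ofCounts cI ≋ Z *S Hlast m Z U
  I-formula = begin
    (W ^S (2 * m + 4)) ⊗ (xS ^S 2) ⊗ ofCounts cI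
      ≈⟨ ⊗-cong (≈-trans (⊗-comm (W ^S (2 * m + 4)) (xS ^S 2)) (⊗-congˡ (xS ^S 2) (≈-reflexive (cong (W ^S_) exponent)))) cI≋J ⟩
    (xS ^S 2) ⊗ (W ^S ((m + 2) * 2)) ⊗ J (suc m)
      ≡⟨ cong (λ e → (xS ^S e) ⊗ (W ^S ((m + 2) * e)) ⊗ J (suc m)) (ℕₚ.m+n∸n≡m 2 m) ⟨
    (xS ^S (suc (suc m) ∸ m)) ⊗ (W ^S ((m + 2) * (suc (suc m) ∸ m))) ⊗ J (suc m) ≈⟨ J-formula (suc m) ℕₚ.≤-refl ⟩
    (xS ^S (m ∸ suc (suc m))) ⊗ (W ^S ((m + 2) * (m ∸ suc (suc m)))) ⊗ Z ⊗ H m (suc m) Z U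
      ≡⟨ cong₂ (λ e h → (xS ^S e) ⊗ (W ^S ((m + 2) * e)) ⊗ Z ⊗ h) (ℕₚ.m≤n⇒m∸n≡0 (ℕₚ.m≤n+m m 2)) (HSeries.H-last m Z U) ⟩
    (xS ^S 0) ⊗ (W ^S ((m + 2) * 0)) ⊗ Z ⊗ Hlast m Z U
      ≈⟨ ⊗-congʳ (Hlast m Z U) (≈-trans (⊗-congʳ Z (≈-trans (⊗-idˡ _) (≈-reflexive (cong (W ^S_) (ℕₚ.*-zeroʳ (m + 2)))))) (⊗-idˡ Z)) ⟩
    Z ⊗ Hlast m Z U ∎
    where
    exponent : 2 * m + 4 ≡ (m + 2) * 2
    exponent = trans (cong (_+ 4) (ℕₚ.*-comm 2 m)) (sym (ℕₚ.*-distribʳ-+ 2 m 2))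

  total≋ : 1S +S ofCountsT cAll ≋ 1S ⊕ Ĉ (suc m)
  total≋ = ⊕-cong {1S} {1S} {ofCountsT cAll} {Ĉ (suc m)} ≈-refl cAll≋Ĉ

  total-formula : (1S +S ofCountsT cAll) *S ((1S -S Z) ^S (m + 2)) ≋ 1S -S fromℕ (suc m) ·S Z
  total-formula = ≈-trans (⊗-cong total≋ (↑≋ W (m + 2)))
    (≈-trans Sol.Ĉ-last (≈-sym (-S-cong 1S {fromℕ (suc m) ·S Z} {ι (suc m) ⊗ Z} (·S≋ι (suc m) Z))))

  Jₘ-formula : xS *S (U -S 1S +S Z) *S ofCounts (cJ m) ≋ (xS -S 1S) *S Z *S (U ^S suc m)
  Jₘ-formula = ≈-trans (⊗-congˡ (xS ⊗ (U ⊖ 1S ⊕ Z)) (J≋ m (ℕₚ.n≤1+n m)))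
    (≈-trans Sol.Ĵₘ-formula (⊗-congˡ ((xS ⊖ 1S) ⊗ Z) (≈-sym (↑≋ U (suc m)))))

  open FussCatalan (m * m + 2 * m)

  -- W B = 1 gives B = 1 + Z B, and in t B^p the power of W contained in t cancels all but one
  -- factor B.
  B-equation : B ≋ 1S +S tS *S B ↑ p
  B-equation = by₃ 1# (⊝ (B ↑ p)) (⊝ (Z ⊗ B)) Sol.WB≈1 t≋ (Sol.WB↑ (m * m + 2 * m))
    (solve 5 (λ z b t w q →
      b :+ :1 :* :1 :+ (:- (b :* q)) :* (z :* w) :+ (:- (z :* b)) :* :1
      := (:1 :+ t :* (b :* q)) :+ :1 :* ((:1 :- z) :* b) :+ (:- (b :* q)) :* t :+ (:- (z :* b)) :* (w :* q)) ≈-refl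
      Z B tS (W ↑ (m * m + 2 * m)) (B ↑ (m * m + 2 * m)))

  total-coefficient : ∀ n₁ → fromℕ (cAll (suc n₁)) ≡
    fromℕ (suc m) ℚ.* fussCatalan (suc n₁) (suc m) ℚ.- fromℕ m ℚ.* fussCatalan (suc n₁) (2 + m)
  total-coefficient n₁ = trans (sym (ℚₚ.+-identityˡ (fromℕ (cAll (suc n₁))))) (trans
    (coeff (≈-trans total≋ (≈-trans Sol.Ĉ-last-B (≈-sym
      (⊕-cong {p₁} {ι (suc m) ⊗ B ↑ suc m} {⊝ p₂} {⊝ (ι m ⊗ B ↑ (2 + m))} (·S≋ι (suc m) (B ↑ suc m))
        (⊝-cong {p₂} {ι m ⊗ B ↑ (2 + m)} (·S≋ι m (B ↑ (2 + m)))))))) (suc n₁) 0)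
    (cong₂ ℚ._-_ (cong (fromℕ (suc m) ℚ.*_) (power-coefficient B B-equation (suc n₁) (suc m)))
                 (cong (fromℕ m ℚ.*_) (power-coefficient B B-equation (suc n₁) (2 + m)))))
    where
    p₁ = fromℕ (suc m) ·S B ↑ suc m
    p₂ = fromℕ m ·S B ↑ (2 + m)

theorem5p4 : (m : ℕ) → 1 ≤ m →
    (Z : Series) →
    (∀ k → Z 0 k ≡ 0ℚ) →
    (∀ n k → Z n (suc k) ≡ 0ℚ) →
    tS ≈S Z *S ((1S -S Z) ^S (m * m + 2 * m)) →
    (U : Series) →
    (∀ n → Σ ℕ λ d → ∀ k → d < k → U n k ≡ 0ℚ) →
    xS *S ((1S -S Z) ^S (m + 2)) ≈S
    U *S (1S -S Z *S sumRangeS 0 m (λ e → U ^S e)) →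
    (cI : ℕ → ℕ → ℕ) →
    (∀ n k → Fin (cI n k) ↔ IntervalsD m n k) →
    (cJ : ℕ → ℕ → ℕ → ℕ) →
    (∀ i n k → i ≤ suc m → Fin (cJ i n k) ↔ IntervalsJ m i n k) →
    (cAll : ℕ → ℕ) →
    (∀ n → Fin (cAll n) ↔ Interval m n) →
    (((1S -S Z) ^S (2 * m + 4)) *S (xS ^S 2) *S ofCounts cI ≈S
    Z *S Hlast m Z U)
    ×
    ((1S +S ofCountsT cAll) *S ((1S -S Z) ^S (m + 2)) ≈S
    1S -S fromℕ (suc m) ·S Z)
    ×
    (∀ n → 1 ≤ n →
    n * (m * n + 1) * cAll n ≡ suc m * (((suc m) ^ 2 * n + m) C (n ∸ 1)))
    ×
    (xS *S (U -S 1S +S Z) *S ofCounts (cJ m) ≈S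
    (xS -S 1S) *S Z *S (U ^S suc m))
    ×
    (∀ i → i ≤ suc m →
    (xS ^S (suc i ∸ m)) *S ((1S -S Z) ^S ((m + 2) * (suc i ∸ m))) *S
    ofCounts (cJ i)
    ≈S
    (xS ^S (m ∸ suc i)) *S ((1S -S Z) ^S ((m + 2) * (m ∸ suc i))) *S
    Z *S H m i Z U)
theorem5p4 (suc m′) _ Z Z₀ Z-constant Z-equation U U-finite U-equation cI cI-counts cJ cJ-counts cAll cAll-counts =
  coeff I-formula , coeff total-formula ,
  (λ { (suc n₁) _ → IntervalNumber.interval-number (suc m′) n₁ (cAll (suc n₁)) (total-coefficient n₁) }) ,
  coeff Jₘ-formula , λ i i≤ → coeff (J-formula i i≤)
  where
  open MainTheorem m′ Z Z₀ Z-constant Z-equation U U-finite U-equation cI cI-counts cJ cJ-counts cAll cAll-counts
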